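{- Let $\mathbb{F}$ be any field, let $m$ be a growing parameter and let $\Delta=\Delta(m)\geq 1$ be an integer-valued function of $m$ with $\Delta = m^{o(1)}$. Let $P^{(\Delta)}\in\mathbb{F}[X^{(\Delta)}]$ be the polynomial defined in the context, on $n_\Delta = 8(2m)^\Delta$ variables. Then any multilinear circuit of product-depth $\Delta$ computing $P^{(\Delta)}$ must have size at least $\exp(m^{\Omega(1)}) = \exp\big(n_\Delta^{\Omega(1/\Delta)}\big)$.
   Context: Polynomials: $X^{(0)}=\{x_{i,j}: i\in[4], j\in[2]\}$ and $P^{(0)} = \sum_{i_1\in\{1,2\},\, i_2\in\{3,4\}} x_{i_1,1}x_{i_1,2}x_{i_2,1}x_{i_2,2}$. For $\Delta\geq 0$, $X^{(\Delta+1)}$ is the disjoint union of $2m$ disjoint copies $X^{(\Delta+1)}_{i,j}$ ($i\in[m]$, $j\in[2]$) of $X^{(\Delta)}$, and $P^{(\Delta+1)}(X^{(\Delta+1)}) = \prod_{i\in[m]}\big(P^{(\Delta)}(X^{(\Delta+1)}_{i,1}) + P^{(\Delta)}(X^{(\Delta+1)}_{i,2})\big)$, where $P^{(\Delta)}(X^{(\Delta+1)}_{i,j})$ denotes the copy of $P^{(\Delta)}$ on the variables $X^{(\Delta+1)}_{i,j}$. Thus $|X^{(\Delta)}| = n_\Delta = 8(2m)^\Delta$. Circuits: algebraic circuits over $\mathbb{F}$ with sum and product gates of unbounded fan-in; size is the number of gates (including input gates); product-depth is the maximum number of product gates on any path from an input gate to the output gate. A circuit is multilinear if every gate computes a multilinear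 polynomial (degree at most $1$ in each variable). -}

module Defs where

open import Level using (Level) renaming (suc to lsuc)
open import Algebra.Bundles using (CommutativeRing)
open import Data.Nat as ℕ using (ℕ; zero; suc; _≤_; _⊔_)
open import Data.Nat.Properties using () renaming (_≟_ to _≟ℕ_)
open import Data.Fin using (Fin; zero; suc; _≟_)
open import Data.Product using (Σ; ∃; ∃-syntax; _×_; _,_)
open import Data.List as L using (List; []; _∷_; _++_; foldr; concatMap; allFin)
open import Data.Vec as V using (Vec; concat; replicate; tabulate; zipWith; lookup)
open import Data.Vec.Properties using (≡-dec)
open import Relation.Nullary using (¬_; yes; no)
open import Relation.Binary.PropositionalEquality using (_≡_)

record Field (c ℓ : Level) : Set (lsuc (c Level.⊔ ℓ)) where
  field
    commutativeRing : CommutativeRing c ℓ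
  open CommutativeRing commutativeRing public
  field
    0≉1     : ¬ (0# ≈ 1#)
    inverse : ∀ x → ¬ (x ≈ 0#) → ∃[ y ] (x * y ≈ 1#)

Monomial : ℕ → Set
Monomial n = Vec ℕ n

module _ {c ℓ} (F : Field c ℓ) where
  open Field F using (Carrier; _≈_; _+_; _*_; 0#; 1#)

  -- A polynomial in F[x_0,…,x_{n-1}] given as a finite formal sum of terms
  -- (coefficient, monomial); equality is equality of all coefficients.
  Poly : ℕ → Set c
  Poly n = List (Carrier × Monomial n)

  coeff : ∀ {n} → Poly n → Monomial n → Carrier
  coeff []             e = 0#
  coeff ((a , e') ∷ p) e with ≡-dec _≟ℕ_ e' e
  ... | yes _ = a + coeff p e
  ... | no  _ = coeff p e

  _≈P_ : ∀ {n} → Poly n → Poly n → Set ℓ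
  p ≈P q = ∀ e → coeff p e ≈ coeff q e

  IsMultilinear : ∀ {n} → Poly n → Set ℓ
  IsMultilinear {n} p = ∀ e → (∃[ i ] (2 ≤ lookup e i)) → coeff p e ≈ 0#

  zeroMon : ∀ {n} → Monomial n
  zeroMon {n} = replicate n 0

  constP : ∀ {n} → Carrier → Poly n
  constP a = (a , zeroMon) ∷ []

  oneP : ∀ {n} → Poly n
  oneP = constP 1#

  varP : ∀ {n} → Fin n → Poly n
  varP v = (1# , tabulate (λ i → unit i)) ∷ []
    where
    unit : _ → ℕ
    unit i with i ≟ v
    ... | yes _ = 1
    ... | no  _ = 0

  scaleP : ∀ {n} → Carrier → Poly n → Poly n
  scaleP a = L.map (λ { (b , e) → (a * b , e) })

  mulP : ∀ {n} → Poly n → Poly n → Poly n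
  mulP p q = concatMap (λ { (a , e) → L.map (λ { (b , f) → (a * b , zipWith ℕ._+_ e f) }) q }) p

  -- Algebraic circuits with unbounded fan-in sum and product gates.
  -- A circuit with k gates over n variables is a list of gates in
  -- topological order; each gate may only refer to earlier gates.
  -- References are de Bruijn style: in a gate appended to a circuit with
  -- k gates, a child  j : Fin k  denotes the j-th most recent earlier gate.
  -- Sum gates compute F-linear combinations of their children (edge labels
  -- in F); input gates are labelled by a variable or a field constant.

  data Gate (n k : ℕ) : Set c where
    input : Fin n → Gate n k
    const : Carrier → Gate n k
    sumG  : List (Carrier × Fin k) → Gate n k
    prodG : List (Fin k) → Gate n k

  data Circuit (n : ℕ) : ℕ → Set c where
    []  : Circuit n 0
    _▷_ : ∀ {k} → Circuit n k → Gate n k → Circuit n (suc k)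

  evalGate : ∀ {n k} → Gate n k → (Fin k → Poly n) → Poly n
  evalGate (input v) ρ = varP v
  evalGate (const a) ρ = constP a
  evalGate (sumG cs) ρ = concatMap (λ { (a , j) → scaleP a (ρ j) }) cs
  evalGate (prodG js) ρ = foldr (λ j acc → mulP (ρ j) acc) oneP js

  gatePoly : ∀ {n k} → Circuit n k → Fin k → Poly n
  gatePoly (C ▷ g) zero    = evalGate g (gatePoly C)
  gatePoly (C ▷ g) (suc j) = gatePoly C j

  output : ∀ {n k} → Circuit n (suc k) → Poly n
  output C = gatePoly C zero

  size : ∀ {n k} → Circuit n k → ℕ
  size {k = k} _ = k

  Computes : ∀ {n k} → Circuit n (suc k) → Poly n → Set ℓ
  Computes C P = output C ≈P P

  IsMultilinearCircuit : ∀ {n k} → Circuit n k → Set ℓ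
  IsMultilinearCircuit C = ∀ j → IsMultilinear (gatePoly C j)

  gatePD : ∀ {n k} → Circuit n k → Fin k → ℕ
  gatePD (C ▷ input _) zero = 0
  gatePD (C ▷ const _) zero = 0
  gatePD (C ▷ sumG cs) zero = foldr (λ { (_ , j) acc → gatePD C j ⊔ acc }) 0 cs
  gatePD (C ▷ prodG js) zero = suc (foldr (λ j acc → gatePD C j ⊔ acc) 0 js)
  gatePD (C ▷ g) (suc j) = gatePD C j

  productDepth : ∀ {n k} → Circuit n (suc k) → ℕ
  productDepth C = gatePD C zero

  -- The hard polynomials P^(Δ) (parameter m).
  -- Variables of X^(0) = {x_{i,j} : i ∈ [4], j ∈ [2]} are indexed by
  -- 2(i-1)+(j-1) ∈ Fin 8.  Variables of X^(Δ+1) are indexed by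
  -- Fin (m * (2 * n_Δ)) via concatenation: copy (i,j) (i ∈ Fin m,
  -- j ∈ Fin 2) of X^(Δ) occupies block number 2i+j.

  numVars : ℕ → ℕ → ℕ
  numVars m zero    = 8
  numVars m (suc Δ) = m ℕ.* (2 ℕ.* numVars m Δ)

  placeMon : ∀ {m d} → Fin m → Fin 2 → Monomial d → Monomial (m ℕ.* (2 ℕ.* d))
  placeMon {m} {d} i j e =
    concat (tabulate {n = m} (λ i' → concat (tabulate {n = 2} (λ j' → pick i' j'))))
    where
    pick : Fin m → Fin 2 → Monomial d
    pick i' j' with i' ≟ i | j' ≟ j
    ... | yes _ | yes _ = e
    ... | _     | _     = zeroMon

  embedP : ∀ {m d} → Fin m → Fin 2 → Poly d → Poly (m ℕ.* (2 ℕ.* d))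
  embedP i j = L.map (λ { (a , e) → (a , placeMon i j e) })

  -- P^(0) = Σ_{i1 ∈ {1,2}, i2 ∈ {3,4}} x_{i1,1} x_{i1,2} x_{i2,1} x_{i2,2}
  P0 : Poly 8
  P0 = (1# , 1 V.∷ 1 V.∷ 0 V.∷ 0 V.∷ 1 V.∷ 1 V.∷ 0 V.∷ 0 V.∷ V.[])
     ∷ (1# , 1 V.∷ 1 V.∷ 0 V.∷ 0 V.∷ 0 V.∷ 0 V.∷ 1 V.∷ 1 V.∷ V.[])
     ∷ (1# , 0 V.∷ 0 V.∷ 1 V.∷ 1 V.∷ 1 V.∷ 1 V.∷ 0 V.∷ 0 V.∷ V.[])
     ∷ (1# , 0 V.∷ 0 V.∷ 1 V.∷ 1 V.∷ 0 V.∷ 0 V.∷ 1 V.∷ 1 V.∷ V.[])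
     ∷ []

  P : (m Δ : ℕ) → Poly (numVars m Δ)
  P m zero    = P0
  P m (suc Δ) =
    foldr (λ i acc → mulP (embedP i zero (P m Δ) ++ embedP i (suc zero) (P m Δ)) acc)
          oneP (allFin m)

-- Asymptotic notions, stated over ℕ.
-- Δ = m^{o(1)} : for every b ≥ 1, eventually Δ(m)^b ≤ m  (i.e. Δ ≤ m^{1/b}).

IsSubpolynomial : (ℕ → ℕ) → Set
IsSubpolynomial Δ = ∀ b → 1 ≤ b → ∃[ M ] (∀ m → M ≤ m → Δ m ℕ.^ b ≤ m)

-- s ≥ 2^{⌊m^{1/b}⌋}, i.e. 2^k ≤ s for every k with k^b ≤ m.
AtLeastExpRoot : (b m s : ℕ) → Set
AtLeastExpRoot b m s = ∀ k → k ℕ.^ b ≤ m → 2 ℕ.^ k ≤ s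

{-# OPTIONS --safe #-}

-- A circuit of product-depth Δ whose gates are multilinear is a ΣΠ…ΣΠΣ formula with Δ product layers in which the
-- factors of every product have disjoint sets of variables: otherwise the product of the leading monomials would have
-- degree 2 in a common variable. Apply a random restriction that leaves some variables y and z unfixed, and consider
-- the rank of the matrix of values indexed by 0/1 assignments to the y's and to the z's. If L variables remain
-- unfixed, the rank is at most 2^(L/2). P^(Δ) always attains this bound, because its restriction is a product of terms
-- y + z on disjoint variables (evaluated as a - b, a permutation matrix). For a function computed by a small formula,
-- the average of rank² / 2^L is exponentially small, by induction on the depth. P^(d) is a product of blocks A + B; a
-- block is either set to 1 or to y + z with random leaves y of A and z of B, or one of A and B is set to 0 and the
-- other one is restricted recursively. Consider a product whose factors live on the parts of a partition of the
-- variables.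
-- * If many variables lie in parts of size at most half of a copy, then many blocks y + z connect different parts, so
--   many parts have an odd number of unfixed variables, and each of these costs a factor of 2.
-- * Otherwise, with high probability some part contains many variables of the blocks that are treated recursively, and
--   the induction hypothesis applies to its factor.
-- At the lowest level the factors are affine and have rank at most 2, while the trivial bound is larger unless exactly
-- 0 or 2 of their variables are unfixed; blocks with four unfixed variables make sure that this happens often.

module Submission where

open import Defs
open import Level using (_⊔_)
open import Data.Bool using (Bool; true; false; not; _∧_; _∨_; _xor_; if_then_else_)
import Data.Bool.Properties as Boolₚ
open import Data.Empty using (⊥; ⊥-elim)
open import Data.Fin using (Fin; zero; suc; combine; remQuot; splitAt; _↑ˡ_; _↑ʳ_; punchIn)
import Data.Fin as Fin
import Data.Fin.Properties as Finₚ
open import Data.List using (List; []; _∷_; _++_; map; concatMap; foldr; length; deduplicate)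
open import Data.List.Membership.Propositional using (_∈_)
open import Data.List.Membership.Propositional.Properties using (∈-deduplicate⁺; ∈-++⁺ˡ; ∈-++⁺ʳ)
import Data.List.Properties as Listₚ
open import Data.List.Relation.Unary.All using (All)
import Data.List.Relation.Unary.All as All
import Data.List.Relation.Unary.AllPairs as AllPairs
open import Data.List.Relation.Unary.Any using (here; there)
import Data.List.Relation.Unary.Any as Any
open import Data.List.Relation.Unary.Unique.Propositional using (Unique)
open import Data.List.Relation.Unary.Unique.DecPropositional.Properties using (deduplicate-!)
open import Data.Maybe using (Maybe; just; nothing)
open import Data.Maybe.Properties using (just-injective)
open import Data.Nat using (ℕ; zero; suc; _+_; _*_; _∸_; _^_; _≤_; _<_; z≤n; s≤s; _⊓_; NonZero; _≤?_; _≤ᵇ_; >-nonZero; >-nonZero⁻¹)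
open import Data.Nat.Properties
open import Data.Nat.Tactic.RingSolver using (solve-∀)
open import Data.Product using (Σ; ∃-syntax; _×_; _,_; proj₁; proj₂; uncurry)
open import Data.Sum using (_⊎_; inj₁; inj₂; [_,_]′)
open import Data.Sum.Properties using (inj₂-injective)
open import Data.Unit using (tt)
open import Data.Vec using (Vec; []; _∷_; lookup)
import Data.Vec as Vec
import Data.Vec.Properties as Vecₚ
open import Function using (_∘_; case_of_)
open import Relation.Binary.Definitions using (module Tri)
open import Relation.Binary.PropositionalEquality using (_≡_; _≢_; refl; sym; trans; cong; cong₂; subst; subst₂)
open import Relation.Nullary using (¬_; Dec; yes; no; does)
open import Relation.Nullary.Decidable using (decidable-stable; dec-true; dec-false)

-- The quantity averaged is the square of the rank: ranks are compared with 2^(L/2), and squaring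
-- keeps all exponents integral. By Cauchy-Schwarz a sum of s terms loses a factor s², so Δ layers
-- lose about (2s²)^Δ. If s ≤ 2^κ this is at most 2^((2κ+1)Δ), so it suffices to force a deficiency
-- 2^k with k just above (2κ+1)Δ; that takes m polynomially large in κΔ, and here the growth
-- condition on Δ enters. Probabilities appear only multiplied out, as inequalities between sums
-- over lists of all choices. Upper bounds on rank are explicit sums of outer products; lower bounds
-- are needed only for diagonal matrices. Equality in the field comes without a decision procedure,
-- so leading monomials and pivots exist only under double negation. The final inequality between
-- natural numbers is decidable, which removes it again. The obstacle in the induction is a part
-- that is large but spread thinly over many copies, or confined to very few: truncating its mass in
-- each copy separates the two cases. Since the induction hypothesis is applied to a single part, it
-- must hold for families of blocks with holes.

-- Finite sums over lists.

∑ : ∀ {ℓ} {A : Set ℓ} → List A → (A → ℕ) → ℕ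
∑ []       f = 0
∑ (x ∷ xs) f = f x + ∑ xs f

fins : ∀ n → List (Fin n)
fins zero    = []
fins (suc n) = zero ∷ map suc (fins n)

pairs : {A B : Set} → List A → List B → List (A × B)
pairs []       ys = []
pairs (x ∷ xs) ys = map (x ,_) ys ++ pairs xs ys

vecs : {A : Set} → List A → ∀ N → List (Vec A N)
vecs xs zero    = [] ∷ []
vecs xs (suc N) = map (uncurry _∷_) (pairs xs (vecs xs N))

⟦_⟧ : Bool → ℕ
⟦ true ⟧  = 1
⟦ false ⟧ = 0

∣_∣ : ∀ {ℓ} {A : Set ℓ} → List A → ℕ
∣ xs ∣ = ∑ xs (λ _ → 1)

module _ {ℓ} {A : Set ℓ} where

  ∑-mono : (xs : List A) {f g : A → ℕ} → (∀ x → f x ≤ g x) → ∑ xs f ≤ ∑ xs g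
  ∑-mono []       h = z≤n
  ∑-mono (x ∷ xs) h = +-mono-≤ (h x) (∑-mono xs h)

  ∑-cong : (xs : List A) {f g : A → ℕ} → (∀ x → f x ≡ g x) → ∑ xs f ≡ ∑ xs g
  ∑-cong []       h = refl
  ∑-cong (x ∷ xs) h = cong₂ _+_ (h x) (∑-cong xs h)

  ∑-+ : (xs : List A) (f g : A → ℕ) → ∑ xs (λ x → f x + g x) ≡ ∑ xs f + ∑ xs g
  ∑-+ []       f g = refl
  ∑-+ (x ∷ xs) f g rewrite ∑-+ xs f g = lem (f x) (g x) (∑ xs f) (∑ xs g)
    where
    lem : ∀ a b c d → a + b + (c + d) ≡ a + c + (b + d)
    lem = solve-∀

  ∑-*ʳ : (xs : List A) (f : A → ℕ) (c : ℕ) → ∑ xs (λ x → f x * c) ≡ ∑ xs f * c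
  ∑-*ʳ []       f c = refl
  ∑-*ʳ (x ∷ xs) f c rewrite ∑-*ʳ xs f c = sym (*-distribʳ-+ c (f x) (∑ xs f))

  ∑-*ˡ : (xs : List A) (c : ℕ) (f : A → ℕ) → ∑ xs (λ x → c * f x) ≡ c * ∑ xs f
  ∑-*ˡ []       c f = sym (*-zeroʳ c)
  ∑-*ˡ (x ∷ xs) c f rewrite ∑-*ˡ xs c f = sym (*-distribˡ-+ c (f x) (∑ xs f))

  ∑-const : (xs : List A) (c : ℕ) → ∑ xs (λ _ → c) ≡ ∣ xs ∣ * c
  ∑-const []       c = refl
  ∑-const (x ∷ xs) c = cong (c +_) (∑-const xs c)

  ∑-zero : (xs : List A) → ∑ xs (λ _ → 0) ≡ 0
  ∑-zero []       = refl
  ∑-zero (x ∷ xs) = ∑-zero xs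

  ∑-++ : (xs ys : List A) (f : A → ℕ) → ∑ (xs ++ ys) f ≡ ∑ xs f + ∑ ys f
  ∑-++ []       ys f = refl
  ∑-++ (x ∷ xs) ys f rewrite ∑-++ xs ys f = sym (+-assoc (f x) (∑ xs f) (∑ ys f))

∑-map : ∀ {ℓ ℓ′} {A : Set ℓ} {B : Set ℓ′} (h : A → B) (xs : List A) (f : B → ℕ) → ∑ (map h xs) f ≡ ∑ xs (f ∘ h)
∑-map h []       f = refl
∑-map h (x ∷ xs) f = cong (f (h x) +_) (∑-map h xs f)

∑-swap : ∀ {ℓ ℓ′} {A : Set ℓ} {B : Set ℓ′} (xs : List A) (ys : List B) (f : A → B → ℕ) →
         ∑ xs (λ x → ∑ ys (f x)) ≡ ∑ ys (λ y → ∑ xs (λ x → f x y))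
∑-swap []       ys f = sym (∑-zero ys)
∑-swap (x ∷ xs) ys f rewrite ∑-swap xs ys f = sym (∑-+ ys (f x) (λ y → ∑ xs (λ x → f x y)))

∑-pairs : {A B : Set} (xs : List A) (ys : List B) (f : A × B → ℕ) →
          ∑ (pairs xs ys) f ≡ ∑ xs (λ x → ∑ ys (λ y → f (x , y)))
∑-pairs []       ys f = refl
∑-pairs (x ∷ xs) ys f = trans (∑-++ (map (x ,_) ys) (pairs xs ys) f)
                              (cong₂ _+_ (∑-map (x ,_) ys f) (∑-pairs xs ys f))

∑-vecs : {A : Set} (xs : List A) (N : ℕ) (f : Vec A (suc N) → ℕ) →
         ∑ (vecs xs (suc N)) f ≡ ∑ xs (λ x → ∑ (vecs xs N) (λ v → f (x ∷ v)))
∑-vecs xs N f = trans (∑-map (uncurry _∷_) (pairs xs (vecs xs N)) f)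
                      (∑-pairs xs (vecs xs N) (f ∘ uncurry _∷_))

∑-fins : ∀ n (f : Fin (suc n) → ℕ) → ∑ (fins (suc n)) f ≡ f zero + ∑ (fins n) (f ∘ suc)
∑-fins n f = cong (f zero +_) (∑-map suc (fins n) f)

∣fins∣ : ∀ n → ∣ fins n ∣ ≡ n
∣fins∣ zero    = refl
∣fins∣ (suc n) = trans (∑-fins n (λ _ → 1)) (cong suc (∣fins∣ n))

∣pairs∣ : {A B : Set} (xs : List A) (ys : List B) → ∣ pairs xs ys ∣ ≡ ∣ xs ∣ * ∣ ys ∣
∣pairs∣ xs ys = trans (∑-pairs xs ys (λ _ → 1)) (∑-const xs ∣ ys ∣)

∣vecs∣ : {A : Set} (xs : List A) (N : ℕ) → ∣ vecs xs N ∣ ≡ ∣ xs ∣ ^ N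
∣vecs∣ xs zero    = refl
∣vecs∣ xs (suc N) = trans (∑-vecs xs N (λ _ → 1)) (trans (∑-const xs ∣ vecs xs N ∣) (cong (∣ xs ∣ *_) (∣vecs∣ xs N)))

≤∑-fins : ∀ {n} (f : Fin n → ℕ) i → f i ≤ ∑ (fins n) f
≤∑-fins {suc n} f i rewrite ∑-fins n f with i
... | zero  = m≤m+n (f zero) _
... | suc j = ≤-trans (≤∑-fins (f ∘ suc) j) (m≤n+m _ (f zero))

∑-fins-↑ : ∀ m n (f : Fin (m + n) → ℕ) →
           ∑ (fins (m + n)) f ≡ ∑ (fins m) (λ i → f (i ↑ˡ n)) + ∑ (fins n) (λ i → f (m ↑ʳ i))
∑-fins-↑ zero    n f = refl
∑-fins-↑ (suc m) n f = trans (∑-fins (m + n) f)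
  (trans (cong (f zero +_) (∑-fins-↑ m n (f ∘ suc)))
  (trans (sym (+-assoc (f zero) (∑ (fins m) (λ i → f (suc (i ↑ˡ n)))) (∑ (fins n) (λ i → f (suc (m ↑ʳ i))))))
         (cong (_+ ∑ (fins n) (λ i → f (suc m ↑ʳ i))) (sym (∑-fins m (λ i → f (i ↑ˡ n)))))))

∑-combine : ∀ m n (f : Fin (m * n) → ℕ) →
            ∑ (fins (m * n)) f ≡ ∑ (fins m) (λ i → ∑ (fins n) (λ j → f (combine i j)))
∑-combine zero    n f = refl
∑-combine (suc m) n f = trans (∑-fins-↑ n (m * n) f)
  (trans (cong (∑ (fins n) (λ i → f (i ↑ˡ (m * n))) +_) (∑-combine m n (λ i → f (n ↑ʳ i))))
         (sym (∑-fins m (λ i → ∑ (fins n) (λ j → f (combine i j))))))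

-- Used for the ranks of the terms of a sum, where it is the source of the first factor `s` lost in
-- squared rank. The cross terms of the induction are absorbed by `2ab ≤ a² + b²`.
cauchy-schwarz : ∀ {ℓ} {A : Set ℓ} (xs : List A) (f : A → ℕ) → ∑ xs f * ∑ xs f ≤ ∣ xs ∣ * ∑ xs (λ x → f x * f x)
cauchy-schwarz []       f = z≤n
cauchy-schwarz (x ∷ xs) f = begin
  (a + s) * (a + s)                     ≡⟨ e₁ a s ⟩
  a * a + (2 * a * s + s * s)           ≤⟨ +-monoʳ-≤ (a * a) (+-mono-≤ cross (cauchy-schwarz xs f)) ⟩
  a * a + ((n * (a * a) + q) + n * q)   ≡⟨ e₂ a n q ⟩
  (1 + n) * (a * a + q)                 ∎
  where
  open ≤-Reasoning
  a = f x
  s = ∑ xs f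
  n = ∣ xs ∣
  q = ∑ xs (λ x → f x * f x)
  e₁ : ∀ a s → (a + s) * (a + s) ≡ a * a + (2 * a * s + s * s)
  e₁ = solve-∀
  e₂ : ∀ a n q → a * a + ((n * (a * a) + q) + n * q) ≡ (1 + n) * (a * a + q)
  e₂ = solve-∀
  ∙-amgm : ∀ a b → 2 * a * b ≤ a * a + b * b
  ∙-amgm a b with ≤-total a b
  ... | inj₁ a≤b with m≤n⇒∃[o]m+o≡n a≤b
  ...   | d , refl = ≤-trans (m≤m+n _ (d * d)) (≤-reflexive (e a d))
    where e : ∀ a d → 2 * a * (a + d) + d * d ≡ a * a + (a + d) * (a + d)
          e = solve-∀
  ∙-amgm a b | inj₂ b≤a with m≤n⇒∃[o]m+o≡n b≤a
  ...   | d , refl = ≤-trans (m≤m+n _ (d * d)) (≤-reflexive (e b d))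
    where e : ∀ b d → 2 * (b + d) * b + d * d ≡ (b + d) * (b + d) + b * b
          e = solve-∀
  cross : 2 * a * s ≤ n * (a * a) + q
  cross = begin
    2 * a * s                                   ≡⟨ ∑-*ˡ xs (2 * a) f ⟨
    ∑ xs (λ y → 2 * a * f y)                    ≤⟨ ∑-mono xs (λ y → ∙-amgm a (f y)) ⟩
    ∑ xs (λ y → a * a + f y * f y)              ≡⟨ ∑-+ xs (λ _ → a * a) (λ y → f y * f y) ⟩
    ∑ xs (λ _ → a * a) + q                      ≡⟨ cong (_+ q) (∑-const xs (a * a)) ⟩
    n * (a * a) + q                             ∎

⟦⟧-≤1 : ∀ b → ⟦ b ⟧ ≤ 1
⟦⟧-≤1 true  = ≤-refl
⟦⟧-≤1 false = z≤n

-- Exponential inequalities over the natural numbers.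

-- This is `(1 + 1/a)^n ≥ 1 + n/a` multiplied by `a^(n+1)`, which avoids division.
bernoulli : ∀ a n → a ^ n * a + n * a ^ n ≤ (1 + a) ^ n * a
bernoulli a zero    = ≤-reflexive (+-identityʳ _)
bernoulli a (suc n) = begin
  a * a ^ n * a + (a * a ^ n + n * (a * a ^ n))     ≡⟨ e a (a ^ n) n ⟩
  a * (a ^ n * a + n * a ^ n) + a ^ n * a           ≤⟨ +-mono-≤ (*-monoʳ-≤ a (bernoulli a n)) (≤-trans (m≤m+n _ (n * a ^ n)) (bernoulli a n)) ⟩
  a * ((1 + a) ^ n * a) + (1 + a) ^ n * a           ≡⟨ e′ a ((1 + a) ^ n) ⟩
  (1 + a) * (1 + a) ^ n * a                         ∎
  where
  open ≤-Reasoning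
  e : ∀ a p n → a * p * a + (a * p + n * (a * p)) ≡ a * (p * a + n * p) + p * a
  e = solve-∀
  e′ : ∀ a p → a * (p * a) + p * a ≡ (1 + a) * p * a
  e′ = solve-∀

-- Since (1 - 1/n)^n ≤ 1/2.
2*pred^n≤n^n : ∀ a → 2 * a ^ suc a ≤ suc a ^ suc a
2*pred^n≤n^n zero    = z≤n
2*pred^n≤n^n a@(suc _) = *-cancelʳ-≤ _ _ a (begin
  2 * a ^ suc a * a                      ≤⟨ m≤m+n _ _ ⟩
  2 * a ^ suc a * a + a ^ suc a          ≡⟨ e (a ^ suc a) a ⟩
  a ^ suc a * a + suc a * a ^ suc a      ≤⟨ bernoulli a (suc a) ⟩
  (1 + a) ^ suc a * a                    ∎)
  where
  open ≤-Reasoning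
  e : ∀ p a → 2 * p * a + p ≡ p * a + suc a * p
  e = solve-∀

^-distribʳ-* : ∀ a b n → (a * b) ^ n ≡ a ^ n * b ^ n
^-distribʳ-* a b zero    = refl
^-distribʳ-* a b (suc n) rewrite ^-distribʳ-* a b n = e a b (a ^ n) (b ^ n)
  where e : ∀ a b p q → a * b * (p * q) ≡ a * p * (b * q)
        e = solve-∀

-- (1 - x/D)^D ≤ 2^(-x), written with d = D - x.
exp-bound : ∀ d x → d ^ (d + x) * 2 ^ x ≤ (d + x) ^ (d + x)
exp-bound d zero    rewrite +-identityʳ d | *-identityʳ (d ^ d) = ≤-refl
exp-bound d (suc x) rewrite +-suc d x = begin
  d ^ suc (d + x) * (2 * 2 ^ x)          ≡⟨ cong (_* (2 * 2 ^ x)) (^-distribˡ-+-* d (suc d) x) ⟩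
  d ^ suc d * d ^ x * (2 * 2 ^ x)        ≡⟨ e (d ^ suc d) (d ^ x) (2 ^ x) ⟩
  2 * d ^ suc d * (d ^ x * 2 ^ x)        ≤⟨ *-mono-≤ (2*pred^n≤n^n d) (*-monoˡ-≤ (2 ^ x) (^-monoˡ-≤ x (n≤1+n d))) ⟩
  suc d ^ suc d * (suc d ^ x * 2 ^ x)    ≡⟨ *-assoc (suc d ^ suc d) _ _ ⟨
  suc d ^ suc d * suc d ^ x * 2 ^ x      ≡⟨ cong (_* 2 ^ x) (^-distribˡ-+-* (suc d) (suc d) x) ⟨
  suc d ^ (suc d + x) * 2 ^ x            ≤⟨ exp-bound (suc d) x ⟩
  (suc d + x) ^ (suc d + x)              ∎
  where
  open ≤-Reasoning
  e : ∀ p q r → p * q * (2 * r) ≡ 2 * p * (q * r)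
  e = solve-∀

^-cancelˡ-≤ : ∀ n {a b} → a ^ suc n ≤ b ^ suc n → a ≤ b
^-cancelˡ-≤ n {a} {b} h with a ≤? b
... | yes p = p
... | no  q = ⊥-elim (<-irrefl refl (<-≤-trans (lem (suc n)) h))
  where
  lem : ∀ n → .{{NonZero n}} → b ^ n < a ^ n
  lem n = ^-monoˡ-< n (≰⇒> q)

-- Triple sums, products over independent choices, and a lower tail bound.

module _ {A B C : Set} (xs : List A) (ys : List B) (zs : List C) where

  ∑³ : (A → B → C → ℕ) → ℕ
  ∑³ h = ∑ xs (λ x → ∑ ys (λ y → ∑ zs (h x y)))

  ∑³-mono : ∀ {h h′ : A → B → C → ℕ} → (∀ x y z → h x y z ≤ h′ x y z) → ∑³ h ≤ ∑³ h′
  ∑³-mono hh = ∑-mono xs (λ x → ∑-mono ys (λ y → ∑-mono zs (hh x y)))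

  ∑³-cong : ∀ {h h′ : A → B → C → ℕ} → (∀ x y z → h x y z ≡ h′ x y z) → ∑³ h ≡ ∑³ h′
  ∑³-cong hh = ∑-cong xs (λ x → ∑-cong ys (λ y → ∑-cong zs (hh x y)))

  ∑³-+ : ∀ h h′ → ∑³ (λ x y z → h x y z + h′ x y z) ≡ ∑³ h + ∑³ h′
  ∑³-+ h h′ = trans (∑-cong xs (λ x → trans (∑-cong ys (λ y → ∑-+ zs (h x y) (h′ x y))) (∑-+ ys (λ y → ∑ zs (h x y)) (λ y → ∑ zs (h′ x y)))))
                    (∑-+ xs (λ x → ∑ ys (λ y → ∑ zs (h x y))) (λ x → ∑ ys (λ y → ∑ zs (h′ x y))))

  ∑³-*ʳ : ∀ h k → ∑³ (λ x y z → h x y z * k) ≡ ∑³ h * k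
  ∑³-*ʳ h k = trans (∑-cong xs (λ x → trans (∑-cong ys (λ y → ∑-*ʳ zs (h x y) k)) (∑-*ʳ ys (λ y → ∑ zs (h x y)) k)))
                    (∑-*ʳ xs (λ x → ∑ ys (λ y → ∑ zs (h x y))) k)

  ∑³-const : ∀ k → ∑³ (λ _ _ _ → k) ≡ ∣ xs ∣ * (∣ ys ∣ * (∣ zs ∣ * k))
  ∑³-const k = trans (∑-cong xs (λ x → trans (∑-cong ys (λ y → ∑-const zs k)) (∑-const ys (∣ zs ∣ * k))))
                     (∑-const xs (∣ ys ∣ * (∣ zs ∣ * k)))

  ∑³-swap : ∀ {W : Set} (ws : List W) (h : W → A → B → C → ℕ) →
            ∑ ws (λ w → ∑³ (h w)) ≡ ∑³ (λ x y z → ∑ ws (λ w → h w x y z))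
  ∑³-swap ws h = trans (∑-swap ws xs (λ w x → ∑ ys (λ y → ∑ zs (h w x y)))) (∑-cong xs (λ x →
    trans (∑-swap ws ys (λ w y → ∑ zs (h w x y))) (∑-cong ys (λ y → ∑-swap ws zs (λ w z → h w x y z)))))

∏ : ∀ n → (Fin n → ℕ) → ℕ
∏ zero    f = 1
∏ (suc n) f = f zero * ∏ n (f ∘ suc)

∏-const* : ∀ n q (f : Fin n → ℕ) → ∏ n (λ i → q * f i) ≡ q ^ n * ∏ n f
∏-const* zero    q f = refl
∏-const* (suc n) q f rewrite ∏-const* n q (f ∘ suc) = e q (f zero) (q ^ n) (∏ n (f ∘ suc))
  where e : ∀ q a p b → q * a * (p * b) ≡ q * p * (a * b)
        e = solve-∀

∏-cong : ∀ n {f g : Fin n → ℕ} → (∀ i → f i ≡ g i) → ∏ n f ≡ ∏ n g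
∏-cong zero    h = refl
∏-cong (suc n) h = cong₂ _*_ (h zero) (∏-cong n (h ∘ suc))

-- Independence of the coordinates of a uniformly random vector: the mean of a product is the
-- product of the means.
∑-∏ : {S : Set} (xs : List S) (N : ℕ) (f : Fin N → S → ℕ) →
      ∑ (vecs xs N) (λ v → ∏ N (λ i → f i (lookup v i))) ≡ ∏ N (λ i → ∑ xs (f i))
∑-∏ xs zero    f = refl
∑-∏ xs (suc N) f = trans (∑-vecs xs N (λ v → ∏ (suc N) (λ i → f i (lookup v i)))) (trans
  (∑-cong xs (λ s → trans (∑-*ˡ (vecs xs N) (f zero s) (λ v → ∏ N (λ i → f (suc i) (lookup v i))))
                          (cong (f zero s *_) (∑-∏ xs N (f ∘ suc)))))
  (∑-*ʳ xs (f zero) (∏ N (λ i → ∑ xs (f (suc i))))))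

-- This is `∏ (1 - cᵢ/D) ≥ 1 - ∑ cᵢ/D` multiplied by `D^(N+1)`; the subtracted term stands on the
-- other side because subtraction is truncated.
weierstrass : ∀ N D (c : Fin N → ℕ) → (∀ i → c i ≤ D) →
              D ^ N * D ≤ ∏ N (λ i → D ∸ c i) * D + D ^ N * ∑ (fins N) c
weierstrass zero    D c h = ≤-trans (≤-reflexive (+-comm 0 (1 * D))) (≤-reflexive (cong (1 * D +_) refl))
weierstrass (suc N) D c h rewrite ∑-fins N c = begin
  D * D ^ N * D                                    ≡⟨ cong (λ z → z * D ^ N * D) D≡ ⟩
  (a + e) * D ^ N * D                              ≡⟨ l₁ a e (D ^ N) D ⟩
  e * (D ^ N * D) + a * D ^ N * D                  ≤⟨ +-monoˡ-≤ (a * D ^ N * D) (*-monoʳ-≤ e (weierstrass N D (c ∘ suc) (h ∘ suc))) ⟩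
  e * (W * D + D ^ N * s) + a * D ^ N * D          ≤⟨ +-monoˡ-≤ (a * D ^ N * D) lem ⟩
  (e * W * D + D * D ^ N * s) + a * D ^ N * D      ≡⟨ l₂ (e * W * D) (D ^ N) a s D ⟩
  e * W * D + D * D ^ N * (a + s)                  ∎
  where
  open ≤-Reasoning
  a = c zero
  e = D ∸ c zero
  W = ∏ N (λ i → D ∸ c (suc i))
  s = ∑ (fins N) (c ∘ suc)
  D≡ : D ≡ a + e
  D≡ = sym (m+[n∸m]≡n (h zero))
  l₁ : ∀ a e p D → (a + e) * p * D ≡ e * (p * D) + a * p * D
  l₁ = solve-∀
  l₂ : ∀ x p a s D → (x + D * p * s) + a * p * D ≡ x + D * p * (a + s)
  l₂ = solve-∀
  l₃ : ∀ e W D p s → e * (W * D + p * s) ≡ e * W * D + e * (p * s)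
  l₃ = solve-∀
  lem : e * (W * D + D ^ N * s) ≤ e * W * D + D * D ^ N * s
  lem = ≤-trans (≤-reflexive (l₃ e W D (D ^ N) s))
          (+-monoʳ-≤ (e * W * D) (≤-trans (*-monoˡ-≤ (D ^ N * s) (m∸n≤m D a)) (≤-reflexive (sym (*-assoc D (D ^ N) s)))))

-- The estimate `1 - x/D ≤ 2^(-x/D)` in every factor, raised to the power `D` to keep the exponents
-- integral.
∏-exp-bound : ∀ N D (x : Fin N → ℕ) → (∀ i → x i ≤ D) →
              ∏ N (λ i → D ∸ x i) ^ D * 2 ^ ∑ (fins N) x ≤ (D ^ N) ^ D
∏-exp-bound zero    D x h = ≤-reflexive (*-identityʳ (1 ^ D))
∏-exp-bound (suc N) D x h rewrite ∑-fins N x = begin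
  (y * Y) ^ D * 2 ^ (x zero + s)                   ≡⟨ cong₂ _*_ (^-distribʳ-* y Y D) (^-distribˡ-+-* 2 (x zero) s) ⟩
  y ^ D * Y ^ D * (2 ^ x zero * 2 ^ s)             ≡⟨ e (y ^ D) (Y ^ D) (2 ^ x zero) (2 ^ s) ⟩
  (y ^ D * 2 ^ x zero) * (Y ^ D * 2 ^ s)           ≤⟨ *-mono-≤ first (∏-exp-bound N D (x ∘ suc) (h ∘ suc)) ⟩
  D ^ D * (D ^ N) ^ D                              ≡⟨ ^-distribʳ-* D (D ^ N) D ⟨
  (D * D ^ N) ^ D                                  ∎
  where
  open ≤-Reasoning
  y = D ∸ x zero
  Y = ∏ N (λ i → D ∸ x (suc i))
  s = ∑ (fins N) (x ∘ suc)
  e : ∀ a b c d → a * b * (c * d) ≡ (a * c) * (b * d)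
  e = solve-∀
  first : y ^ D * 2 ^ x zero ≤ D ^ D
  first = subst (λ z → y ^ z * 2 ^ x zero ≤ z ^ z) (m∸n+n≡m (h zero)) (exp-bound y (x zero))

-- Markov's inequality for ∏ (1 - σᵢ / 2T), which is at least 1/2 on the bad event.
lower-tail : {S : Set} (xs : List S) (q : ℕ) .{{_ : NonZero q}} → ∣ xs ∣ ≡ q * 3 →
  ∀ N T .{{_ : NonZero T}} (σ : Fin N → S → ℕ) (x : Fin N → ℕ) →
  (∀ i s → σ i s ≤ T) → (∀ i → ∑ xs (σ i) ≡ q * x i) →
  ∀ k → suc k * (6 * T) ≤ ∑ (fins N) x →
  (bad : Vec S N → Bool) → (∀ v → bad v ≡ true → ∑ (fins N) (λ i → σ i (lookup v i)) < T) →
  ∑ (vecs xs N) (⟦_⟧ ∘ bad) * 2 ^ k ≤ ∣ xs ∣ ^ N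
lower-tail {S} xs q ∣xs∣ N T@(suc _) σ x σ≤T ∑σ k big bad isbad =
  *-cancelʳ-≤ _ _ (D ^ N) {{m^n≢0 D N}} (begin
    B * 2 ^ k * D ^ N                          ≡⟨ l₁ B (2 ^ k) (D ^ N) ⟩
    B * D ^ N * 2 ^ k                          ≤⟨ *-monoˡ-≤ (2 ^ k) B≤ ⟩
    2 * (q ^ N * Y) * 2 ^ k                    ≡⟨ l₂ (q ^ N) Y (2 ^ k) ⟩
    q ^ N * (Y * 2 ^ suc k)                    ≤⟨ *-monoʳ-≤ (q ^ N) Y≤ ⟩
    q ^ N * (6 * T) ^ N                        ≡⟨ ^-distribʳ-* q (6 * T) N ⟨
    (q * (6 * T)) ^ N                          ≡⟨ cong (_^ N) (l₃ q T) ⟩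
    (q * 3 * D) ^ N                            ≡⟨ ^-distribʳ-* (q * 3) D N ⟩
    (q * 3) ^ N * D ^ N                        ≡⟨ cong (λ z → z ^ N * D ^ N) ∣xs∣ ⟨
    ∣ xs ∣ ^ N * D ^ N                         ∎)
  where
  open ≤-Reasoning
  D = 2 * T
  B = ∑ (vecs xs N) (⟦_⟧ ∘ bad)
  Y = ∏ N (λ i → 6 * T ∸ x i)
  W : Vec S N → ℕ
  W v = ∏ N (λ i → D ∸ σ i (lookup v i))
  l₁ : ∀ a b c → a * b * c ≡ a * c * b
  l₁ = solve-∀
  l₂ : ∀ a y b → 2 * (a * y) * b ≡ a * (y * (2 * b))
  l₂ = solve-∀
  l₃ : ∀ q T → q * (6 * T) ≡ q * 3 * (2 * T)
  l₃ = solve-∀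
  σ≤D : ∀ i s → σ i s ≤ D
  σ≤D i s = ≤-trans (σ≤T i s) (m≤m+n T _)
  -- The mean of `σ i` is `x i / 3`, so `1 - σ i / 2T` has mean `1 - x i / 6T`; this is where
  -- `6 * T` comes from.
  ∑∸ : ∀ i → ∑ xs (λ s → D ∸ σ i s) + q * x i ≡ q * (6 * T)
  ∑∸ i = begin-equality
    ∑ xs (λ s → D ∸ σ i s) + q * x i           ≡⟨ cong (∑ xs (λ s → D ∸ σ i s) +_) (∑σ i) ⟨
    ∑ xs (λ s → D ∸ σ i s) + ∑ xs (σ i)        ≡⟨ ∑-+ xs (λ s → D ∸ σ i s) (σ i) ⟨
    ∑ xs (λ s → D ∸ σ i s + σ i s)             ≡⟨ ∑-cong xs (λ s → m∸n+n≡m (σ≤D i s)) ⟩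
    ∑ xs (λ _ → D)                             ≡⟨ ∑-const xs D ⟩
    ∣ xs ∣ * D                                 ≡⟨ cong (_* D) ∣xs∣ ⟩
    q * 3 * D                                  ≡⟨ l₃ q T ⟨
    q * (6 * T)                                ∎
  x≤ : ∀ i → x i ≤ 6 * T
  x≤ i = *-cancelˡ-≤ q (≤-trans (m≤n+m (q * x i) _) (≤-reflexive (∑∸ i)))
  ∑W : ∑ (vecs xs N) W ≡ q ^ N * Y
  ∑W = trans (∑-∏ xs N (λ i s → D ∸ σ i s)) (trans (∏-cong N (λ i →
         trans (sym (m+n∸n≡m _ (q * x i))) (trans (cong (_∸ q * x i) (∑∸ i)) (sym (*-distribˡ-∸ q (6 * T) (x i))))))
         (∏-const* N q (λ i → 6 * T ∸ x i)))
  bad≤ : ∀ v → ⟦ bad v ⟧ * D ^ N ≤ 2 * W v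
  bad≤ v with bad v | isbad v
  ... | false | _ = z≤n
  ... | true  | h = *-cancelʳ-≤ _ _ T (+-cancelʳ-≤ (D ^ N * T) _ _ (begin
    1 * D ^ N * T + D ^ N * T                  ≡⟨ l₄ (D ^ N) T ⟩
    D ^ N * D                                  ≤⟨ weierstrass N D (λ i → σ i (lookup v i)) (λ i → σ≤D i _) ⟩
    W v * D + D ^ N * ∑ (fins N) (λ i → σ i (lookup v i)) ≤⟨ +-monoʳ-≤ (W v * D) (*-monoʳ-≤ (D ^ N) (<⇒≤ (h refl))) ⟩
    W v * D + D ^ N * T                        ≡⟨ cong (_+ D ^ N * T) (l₅ (W v) T) ⟩
    2 * W v * T + D ^ N * T                    ∎))
    where
    l₄ : ∀ p T → 1 * p * T + p * T ≡ p * (2 * T)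
    l₄ = solve-∀
    l₅ : ∀ w T → w * (2 * T) ≡ 2 * w * T
    l₅ = solve-∀
  B≤ : B * D ^ N ≤ 2 * (q ^ N * Y)
  B≤ = begin
    B * D ^ N                                          ≡⟨ ∑-*ʳ (vecs xs N) (⟦_⟧ ∘ bad) (D ^ N) ⟨
    ∑ (vecs xs N) (λ v → ⟦ bad v ⟧ * D ^ N)            ≤⟨ ∑-mono (vecs xs N) bad≤ ⟩
    ∑ (vecs xs N) (λ v → 2 * W v)                      ≡⟨ ∑-*ˡ (vecs xs N) 2 W ⟩
    2 * ∑ (vecs xs N) W                                ≡⟨ cong (2 *_) ∑W ⟩
    2 * (q ^ N * Y)                                    ∎
  -- Compared after raising to the power `6 * T`, the form in which `∏-exp-bound` is available;
  -- `six` only displays that exponent as a successor. One of the `suc k` factors 2 pays for the 1/2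
  -- in Markov's inequality.
  Y≤ : Y * 2 ^ suc k ≤ (6 * T) ^ N
  Y≤ = ^-cancelˡ-≤ (5 + 6 * T ∸ 6) (subst (λ z → (Y * 2 ^ suc k) ^ z ≤ ((6 * T) ^ N) ^ z) (six T) (begin
    (Y * 2 ^ suc k) ^ (6 * T)                  ≡⟨ ^-distribʳ-* Y (2 ^ suc k) (6 * T) ⟩
    Y ^ (6 * T) * (2 ^ suc k) ^ (6 * T)        ≡⟨ cong (Y ^ (6 * T) *_) (^-*-assoc 2 (suc k) (6 * T)) ⟩
    Y ^ (6 * T) * 2 ^ (suc k * (6 * T))        ≤⟨ *-monoʳ-≤ (Y ^ (6 * T)) (^-monoʳ-≤ 2 big) ⟩
    Y ^ (6 * T) * 2 ^ ∑ (fins N) x             ≤⟨ ∏-exp-bound N (6 * T) x x≤ ⟩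
    ((6 * T) ^ N) ^ (6 * T)                    ∎))
    where
    six : ∀ T .{{_ : NonZero T}} → 6 * T ≡ suc (5 + 6 * T ∸ 6)
    six (suc t) = sym (trans (cong suc (+-∸-assoc 5 {6 * suc t} {6} (m≤m*n 6 (suc t)))) (m+[n∸m]≡n (m≤m*n 6 (suc t))))

-- Deficiencies forced by exposing the blocks one at a time.

-- The gaps `2 * Z - f s` are all nonnegative and the one at `s₁` is at least `Z`; since `s₁` occurs
-- in `xs`, their sum is at least `Z`. Thus a single favourable choice lowers the average by a
-- definite ratio.
complement-sum : {S : Set} (xs : List S) → (∀ (f : S → ℕ) s → f s ≤ ∑ xs f) →
  ∀ (f : S → ℕ) Z s₁ → (∀ s → f s ≤ 2 * Z) → f s₁ ≤ Z → ∑ xs f + Z ≤ ∣ xs ∣ * (2 * Z)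
complement-sum xs complete f Z s₁ f≤ f₁≤ = begin
  ∑ xs f + Z                                   ≤⟨ +-monoʳ-≤ (∑ xs f) Z≤ ⟩
  ∑ xs f + ∑ xs g                              ≡⟨ ∑-+ xs f g ⟨
  ∑ xs (λ s → f s + g s)                       ≡⟨ ∑-cong xs (λ s → m+[n∸m]≡n (f≤ s)) ⟩
  ∑ xs (λ _ → 2 * Z)                           ≡⟨ ∑-const xs (2 * Z) ⟩
  ∣ xs ∣ * (2 * Z)                             ∎
  where
  open ≤-Reasoning
  g = λ s → 2 * Z ∸ f s
  Z≤ : Z ≤ ∑ xs g
  Z≤ = ≤-trans (≤-trans (≤-reflexive (trans (sym (m+n∸m≡n Z Z)) (cong (λ z → Z + z ∸ Z) (sym (+-identityʳ Z)))))
                        (∸-monoʳ-≤ (2 * Z) f₁≤)) (complete g s₁)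

module _ {S : Set} {N : ℕ} where

  OffBy : Fin N → Vec S N → Vec S N → Set
  OffBy i v v′ = ∀ i′ → i′ ≢ i → lookup v i′ ≡ lookup v′ i′

offBy-∷ : ∀ {S N} {s : S} {i : Fin N} {v v′} → OffBy i v v′ → OffBy (suc i) (s ∷ v) (s ∷ v′)
offBy-∷ h zero     _  = refl
offBy-∷ h (suc i′) ne = h i′ (ne ∘ cong suc)

offBy-head : ∀ {S N} (s s′ : S) (v : Vec S N) → OffBy zero (s ∷ v) (s′ ∷ v)
offBy-head s s′ v zero    ne = ⊥-elim (ne refl)
offBy-head s s′ v (suc i) ne = refl

⟦⟧-∧-≤ʳ : ∀ a b → ⟦ a ∧ b ⟧ ≤ ⟦ b ⟧
⟦⟧-∧-≤ʳ true  b = ≤-refl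
⟦⟧-∧-≤ʳ false b = z≤n

⟦⟧-∧-≤ˡ : ∀ a b → ⟦ a ∧ b ⟧ ≤ ⟦ a ⟧
⟦⟧-∧-≤ˡ true  b = ⟦⟧-≤1 b
⟦⟧-∧-≤ˡ false b = z≤n

∧-trueˡ : ∀ a {b} → a ∧ b ≡ true → a ≡ true
∧-trueˡ true _ = refl

∧-trueʳ : ∀ a {b} → a ∧ b ≡ true → b ≡ true
∧-trueʳ true e = e

m≤∑* : ∀ {R} (f : Fin R → Bool) (g : Fin R → ℕ) (D : ℕ) → (∀ j → f j ≡ true → g j ≤ D) →
       ∑ (fins R) (λ j → ⟦ f j ⟧ * g j) ≤ ∑ (fins R) (⟦_⟧ ∘ f) * D
m≤∑* {R} f g D h = ≤-trans (∑-mono (fins R) (λ j → pt j (f j) refl)) (≤-reflexive (∑-*ʳ (fins R) (⟦_⟧ ∘ f) D))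
  where
  pt : ∀ j b → f j ≡ b → ⟦ b ⟧ * g j ≤ ⟦ b ⟧ * D
  pt j true  e = *-monoʳ-≤ 1 (h j e)
  pt j false e = z≤n

drop-2^ : ∀ a e {Z} → a * 2 ^ e ≤ Z → a ≤ Z
drop-2^ a e = ≤-trans (m≤m*n a (2 ^ e) {{m^n≢0 2 e}})

∑-fins-tail : ∀ {N} (f : Fin (suc N) → ℕ) → f zero ≡ 0 → ∑ (fins (suc N)) f ≡ ∑ (fins N) (f ∘ suc)
∑-fins-tail {N} f f0 = trans (∑-fins N f) (cong (_+ ∑ (fins N) (f ∘ suc)) f0)

-- Blocks are exposed one at a time. If the next block touches a part of `c`, then, whatever the
-- other blocks are, one of its `∣ xs ∣` choices makes that part bad and saves a factor 2, so the
-- average drops by `1 - 1/(2∣xs∣) = p / suc p`. All parts touched by this block then leave `c`,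
-- because their badness depends on the exposed choice. This uses up at most `E * D` incidences
-- between blocks and parts, so `h * (E * D)` incidences allow `h` such drops.
bounded-parts : {S : Set} (xs : List S) → S → (∀ (f : S → ℕ) s → f s ≤ ∑ xs f) → ∀ p → 2 * ∣ xs ∣ ≡ suc p →
  ∀ {R} E D .{{_ : NonZero E}} .{{_ : NonZero D}} N
  (touch : Fin N → Fin R → Bool) (bad : Vec S N → Fin R → Bool) (c : Fin R → Bool) (A : Vec S N → ℕ) (Z : ℕ) →
  (∀ i v v′ j → touch i j ≡ false → OffBy i v v′ → bad v j ≡ bad v′ j) →
  (∀ i v j → touch i j ≡ true → ∃[ v′ ] (OffBy i v v′ × bad v′ j ≡ true)) →
  (∀ i → ∑ (fins R) (⟦_⟧ ∘ touch i) ≤ E) →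
  (∀ j → c j ≡ true → ∑ (fins N) (λ i → ⟦ touch i j ⟧) ≤ D) →
  (∀ v → A v * 2 ^ ∑ (fins R) (λ j → ⟦ c j ∧ bad v j ⟧) ≤ Z) →
  ∀ h → h * (E * D) ≤ ∑ (fins N) (λ i → ∑ (fins R) (λ j → ⟦ c j ∧ touch i j ⟧)) →
  ∑ (vecs xs N) A * suc p ^ h ≤ Z * ∣ xs ∣ ^ N * p ^ h
bounded-parts {S} xs s₀ complete p 2q {R} E D = go
  where
  open ≤-Reasoning
  q = ∣ xs ∣
  go : ∀ N (touch : Fin N → Fin R → Bool) (bad : Vec S N → Fin R → Bool) (c : Fin R → Bool) (A : Vec S N → ℕ) (Z : ℕ) →
    (∀ i v v′ j → touch i j ≡ false → OffBy i v v′ → bad v j ≡ bad v′ j) →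
    (∀ i v j → touch i j ≡ true → ∃[ v′ ] (OffBy i v v′ × bad v′ j ≡ true)) →
    (∀ i → ∑ (fins R) (⟦_⟧ ∘ touch i) ≤ E) →
    (∀ j → c j ≡ true → ∑ (fins N) (λ i → ⟦ touch i j ⟧) ≤ D) →
    (∀ v → A v * 2 ^ ∑ (fins R) (λ j → ⟦ c j ∧ bad v j ⟧) ≤ Z) →
    ∀ h → h * (E * D) ≤ ∑ (fins N) (λ i → ∑ (fins R) (λ j → ⟦ c j ∧ touch i j ⟧)) →
    ∑ (vecs xs N) A * suc p ^ h ≤ Z * q ^ N * p ^ h
  go zero touch bad c A Z loc hit sE sD bd zero hW = *-monoˡ-≤ 1 (begin
    A [] + 0                 ≡⟨ +-identityʳ (A []) ⟩
    A []                     ≤⟨ drop-2^ (A []) (∑ (fins R) (λ j → ⟦ c j ∧ bad [] j ⟧)) (bd []) ⟩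
    Z                        ≡⟨ *-identityʳ Z ⟨
    Z * 1                    ∎)
  go zero touch bad c A Z loc hit sE sD bd (suc h) hW =
    ⊥-elim (1+n≰n (≤-trans (>-nonZero⁻¹ (E * D) {{m*n≢0 E D}}) (≤-trans (m≤m+n (E * D) (h * (E * D))) hW)))
  go (suc N) touch bad c A Z loc hit sE sD bd h hW with Finₚ.any? (λ j → (c j ∧ touch zero j) Data.Bool.≟ true)
  ... | no none = begin
    ∑ (vecs xs (suc N)) A * suc p ^ h                          ≡⟨ cong (_* suc p ^ h) (∑-vecs xs N A) ⟩
    ∑ xs (λ s → ∑ (vecs xs N) (A ∘ (s ∷_))) * suc p ^ h        ≡⟨ ∑-*ʳ xs _ (suc p ^ h) ⟨
    ∑ xs (λ s → ∑ (vecs xs N) (A ∘ (s ∷_)) * suc p ^ h)        ≤⟨ ∑-mono xs rec ⟩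
    ∑ xs (λ s → Z * q ^ N * p ^ h)                             ≡⟨ ∑-const xs _ ⟩
    q * (Z * q ^ N * p ^ h)                                    ≡⟨ l₁ q Z (q ^ N) (p ^ h) ⟩
    Z * (q * q ^ N) * p ^ h                                    ∎
    where
    l₁ : ∀ q Z x y → q * (Z * x * y) ≡ Z * (q * x) * y
    l₁ = solve-∀
    none′ : ∀ j → c j ∧ touch zero j ≡ false
    none′ j with c j ∧ touch zero j in eq
    ... | true  = ⊥-elim (none (j , eq))
    ... | false = refl
    head0 : ∑ (fins R) (λ j → ⟦ c j ∧ touch zero j ⟧) ≡ 0
    head0 = trans (∑-cong (fins R) (λ j → cong ⟦_⟧ (none′ j))) (∑-zero (fins R))
    rec : ∀ s → ∑ (vecs xs N) (A ∘ (s ∷_)) * suc p ^ h ≤ Z * q ^ N * p ^ h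
    rec s = go N (touch ∘ suc) (bad ∘ (s ∷_)) c (A ∘ (s ∷_)) Z
      (λ i v v′ j t o → loc (suc i) (s ∷ v) (s ∷ v′) j t (offBy-∷ o))
      (λ i v j t → tailHit s i v j t)
      (sE ∘ suc)
      (λ j cj → ≤-trans (≤-trans (m≤n+m _ ⟦ touch zero j ⟧) (≤-reflexive (sym (∑-fins N (λ i → ⟦ touch i j ⟧))))) (sD j cj))
      (λ v → bd (s ∷ v)) h
      (≤-trans hW (≤-reflexive (∑-fins-tail (λ i → ∑ (fins R) (λ j → ⟦ c j ∧ touch i j ⟧)) head0)))
      where
      tailHit : ∀ s i v j → touch (suc i) j ≡ true → ∃[ v′ ] (OffBy i v v′ × bad (s ∷ v′) j ≡ true)
      tailHit s i v j t with hit (suc i) (s ∷ v) j t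
      ... | (s′ ∷ v′) , o , b with o zero (λ ())
      ...   | refl = v′ , (λ i′ ne → o (suc i′) (ne ∘ Finₚ.suc-injective)) , b
  go (suc N) touch bad c A Z loc hit sE sD bd zero hW | yes (j₀ , fresh) =
    *-monoˡ-≤ 1 (begin
      ∑ (vecs xs (suc N)) A                     ≤⟨ ∑-mono (vecs xs (suc N)) (λ v → drop-2^ (A v) (∑ (fins R) (λ j → ⟦ c j ∧ bad v j ⟧)) (bd v)) ⟩
      ∑ (vecs xs (suc N)) (λ _ → Z)             ≡⟨ ∑-const (vecs xs (suc N)) Z ⟩
      ∣ vecs xs (suc N) ∣ * Z                   ≡⟨ cong (_* Z) (∣vecs∣ xs (suc N)) ⟩
      q ^ suc N * Z                             ≡⟨ *-comm (q ^ suc N) Z ⟩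
      Z * q ^ suc N                             ∎)
  go (suc N) touch bad c A Z loc hit sE sD bd (suc h) hW | yes (j₀ , fresh) = begin
    ∑ (vecs xs (suc N)) A * (suc p * suc p ^ h)                       ≡⟨ cong (_* (suc p * suc p ^ h)) (∑-vecs xs N A) ⟩
    ∑ xs (λ s → ∑ (vecs xs N) (A ∘ (s ∷_))) * (suc p * suc p ^ h)     ≡⟨ cong (_* (suc p * suc p ^ h)) (∑-swap xs (vecs xs N) (λ s v → A (s ∷ v))) ⟩
    X * (suc p * suc p ^ h)                                           ≡⟨ cong (λ z → X * (z * suc p ^ h)) (sym 2q) ⟩
    X * (2 * q * suc p ^ h)                                           ≡⟨ l₁ X q (suc p ^ h) ⟩
    q * (X * 2 * suc p ^ h)                                           ≡⟨ cong (λ z → q * (z * suc p ^ h)) (∑-*ʳ (vecs xs N) _ 2) ⟨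
    q * (∑ (vecs xs N) A′ * suc p ^ h)                                ≤⟨ *-monoʳ-≤ q rec ⟩
    q * (Z * p * q ^ N * p ^ h)                                       ≡⟨ l₂ q Z p (q ^ N) (p ^ h) ⟩
    Z * (q * q ^ N) * (p * p ^ h)                                     ∎
    where
    X = ∑ (vecs xs N) (λ v → ∑ xs (λ s → A (s ∷ v)))
    -- The sum over the choices of the exposed block is the new `A`. It is doubled so that the `q`
    -- choices count as `2 * q = suc p`, and the new bound is `Z * p`.
    A′ : Vec S N → ℕ
    A′ v = ∑ xs (λ s → A (s ∷ v)) * 2
    c′ : Fin R → Bool
    c′ j = c j ∧ not (touch zero j)
    l₁ : ∀ x q y → x * (2 * q * y) ≡ q * (x * 2 * y)
    l₁ = solve-∀
    l₂ : ∀ q Z p x y → q * (Z * p * x * y) ≡ Z * (q * x) * (p * y)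
    l₂ = solve-∀
    tj₀ : touch zero j₀ ≡ true
    tj₀ = ∧-trueʳ (c j₀) fresh
    c⇐c′ : ∀ j → c′ j ≡ true → c j ≡ true
    c⇐c′ j e = ∧-trueˡ (c j) e
    φ′ : Vec S N → ℕ
    φ′ v = ∑ (fins R) (λ j → ⟦ c′ j ∧ bad (s₀ ∷ v) j ⟧)
    same : ∀ s v j → ⟦ c′ j ∧ bad (s₀ ∷ v) j ⟧ ≡ ⟦ c′ j ∧ bad (s ∷ v) j ⟧
    same s v j with c j | touch zero j in t
    ... | false | _     = refl
    ... | true  | true  = refl
    ... | true  | false = cong ⟦_⟧ (loc zero (s₀ ∷ v) (s ∷ v) j t (offBy-head s₀ s v))
    φ′≤ : ∀ s v → φ′ v ≤ ∑ (fins R) (λ j → ⟦ c j ∧ bad (s ∷ v) j ⟧)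
    φ′≤ s v = ∑-mono (fins R) (λ j → ≤-trans (≤-reflexive (same s v j)) (weaken (c j) (not (touch zero j)) (bad (s ∷ v) j)))
      where
      weaken : ∀ a b d → ⟦ (a ∧ b) ∧ d ⟧ ≤ ⟦ a ∧ d ⟧
      weaken true  b d = ⟦⟧-∧-≤ʳ b d
      weaken false b d = z≤n
    φ′< : ∀ s v → bad (s ∷ v) j₀ ≡ true → suc (φ′ v) ≤ ∑ (fins R) (λ j → ⟦ c j ∧ bad (s ∷ v) j ⟧)
    φ′< s v b = begin
      suc (φ′ v)                                                      ≡⟨ +-comm 1 (φ′ v) ⟩
      φ′ v + 1                                                        ≤⟨ +-monoʳ-≤ (φ′ v) one ⟩
      φ′ v + ∑ (fins R) (λ j → ⟦ (c j ∧ touch zero j) ∧ bad (s ∷ v) j ⟧) ≡⟨ ∑-+ (fins R) _ _ ⟨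
      ∑ (fins R) (λ j → ⟦ c′ j ∧ bad (s₀ ∷ v) j ⟧ + ⟦ (c j ∧ touch zero j) ∧ bad (s ∷ v) j ⟧)
        ≤⟨ ∑-mono (fins R) (λ j → ≤-trans (≤-reflexive (cong (_+ _) (same s v j))) (split (c j) (touch zero j) (bad (s ∷ v) j))) ⟩
      ∑ (fins R) (λ j → ⟦ c j ∧ bad (s ∷ v) j ⟧)                      ∎
      where
      split : ∀ a b d → ⟦ (a ∧ not b) ∧ d ⟧ + ⟦ (a ∧ b) ∧ d ⟧ ≤ ⟦ a ∧ d ⟧
      split false _     _ = z≤n
      split true  true  _ = ≤-refl
      split true  false d = ≤-reflexive (+-identityʳ ⟦ d ⟧)
      one : 1 ≤ ∑ (fins R) (λ j → ⟦ (c j ∧ touch zero j) ∧ bad (s ∷ v) j ⟧)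
      one = ≤-trans (≤-reflexive (sym (cong ⟦_⟧ (trans (cong₂ _∧_ fresh b) refl)))) (≤∑-fins (λ j → ⟦ (c j ∧ touch zero j) ∧ bad (s ∷ v) j ⟧) j₀)
    -- Each choice obeys the old bound with the smaller deficiency `φ′`, and the choice `s₁` that
    -- makes `j₀` bad beats it by a factor 2; the total is `2qZ - Z = pZ`.
    bd′ : ∀ v → A′ v * 2 ^ φ′ v ≤ Z * p
    bd′ v with hit zero (s₀ ∷ v) j₀ tj₀
    ... | (s₁ ∷ v₁) , o , b = +-cancelʳ-≤ Z _ _ (begin
      A′ v * 2 ^ φ′ v + Z                         ≡⟨ cong (_+ Z) (trans (*-assoc (∑ xs (λ s → A (s ∷ v))) 2 (2 ^ φ′ v)) (sym (∑-*ʳ xs (λ s → A (s ∷ v)) (2 * 2 ^ φ′ v)))) ⟩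
      ∑ xs (λ s → A (s ∷ v) * (2 * 2 ^ φ′ v)) + Z ≤⟨ complement-sum xs complete _ Z s₁ all one ⟩
      q * (2 * Z)                                 ≡⟨ l₃ q Z ⟩
      2 * q * Z                                   ≡⟨ cong (_* Z) 2q ⟩
      suc p * Z                                   ≡⟨ l₄ p Z ⟩
      Z * p + Z                                   ∎)
      where
      l₃ : ∀ q Z → q * (2 * Z) ≡ 2 * q * Z
      l₃ = solve-∀
      l₄ : ∀ p Z → suc p * Z ≡ Z * p + Z
      l₄ = solve-∀
      l₅ : ∀ a x → a * (2 * x) ≡ 2 * (a * x)
      l₅ = solve-∀
      all : ∀ s → A (s ∷ v) * (2 * 2 ^ φ′ v) ≤ 2 * Z
      all s = ≤-trans (≤-reflexive (l₅ (A (s ∷ v)) (2 ^ φ′ v)))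
                (*-monoʳ-≤ 2 (≤-trans (*-monoʳ-≤ (A (s ∷ v)) (^-monoʳ-≤ 2 (φ′≤ s v))) (bd (s ∷ v))))
      v₁≡v : v₁ ≡ v
      v₁≡v = sym (trans (sym (Vecₚ.tabulate∘lookup v)) (trans (Vecₚ.tabulate-cong (λ i → o (suc i) (λ ()))) (Vecₚ.tabulate∘lookup v₁)))
      one : A (s₁ ∷ v) * (2 * 2 ^ φ′ v) ≤ Z
      one = ≤-trans (*-monoʳ-≤ (A (s₁ ∷ v)) (^-monoʳ-≤ 2 (φ′< s₁ v (subst (λ w → bad (s₁ ∷ w) j₀ ≡ true) v₁≡v b)))) (bd (s₁ ∷ v))
    tailHit : ∀ i v j → touch (suc i) j ≡ true → ∃[ v′ ] (OffBy i v v′ × bad (s₀ ∷ v′) j ≡ true)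
    tailHit i v j t with hit (suc i) (s₀ ∷ v) j t
    ... | (s′ ∷ v′) , o , b with o zero (λ ())
    ...   | refl = v′ , (λ i′ ne → o (suc i′) (ne ∘ Finₚ.suc-injective)) , b
    rowsum : Fin R → ℕ
    rowsum j = ∑ (fins (suc N)) (λ i → ⟦ touch i j ⟧)
    -- The exposed block touches at most `E` parts, each of those in `c` meeting at most `D` blocks:
    -- the lost incidences number at most `E * D`.
    W≤ : ∑ (fins (suc N)) (λ i → ∑ (fins R) (λ j → ⟦ c j ∧ touch i j ⟧)) ≤
         E * D + ∑ (fins N) (λ i → ∑ (fins R) (λ j → ⟦ c′ j ∧ touch (suc i) j ⟧))
    W≤ = begin
      ∑ (fins (suc N)) (λ i → ∑ (fins R) (λ j → ⟦ c j ∧ touch i j ⟧))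
        ≤⟨ ∑-mono (fins (suc N)) (λ i → ≤-trans (∑-mono (fins R) (λ j → split (c j) (touch zero j) (touch i j))) (≤-reflexive (∑-+ (fins R) _ _))) ⟩
      ∑ (fins (suc N)) (λ i → ∑ (fins R) (λ j → ⟦ c j ∧ touch zero j ⟧ * ⟦ touch i j ⟧) + ∑ (fins R) (λ j → ⟦ c′ j ∧ touch i j ⟧))
        ≡⟨ ∑-+ (fins (suc N)) (λ i → ∑ (fins R) (λ j → ⟦ c j ∧ touch zero j ⟧ * ⟦ touch i j ⟧)) (λ i → ∑ (fins R) (λ j → ⟦ c′ j ∧ touch i j ⟧)) ⟩
      ∑ (fins (suc N)) (λ i → ∑ (fins R) (λ j → ⟦ c j ∧ touch zero j ⟧ * ⟦ touch i j ⟧)) + Wc′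
        ≤⟨ +-mono-≤ first (≤-reflexive (∑-fins-tail (λ i → ∑ (fins R) (λ j → ⟦ c′ j ∧ touch i j ⟧)) (trans (∑-cong (fins R) (λ j → zero₁ (c j) (touch zero j))) (∑-zero (fins R))))) ⟩
      E * D + ∑ (fins N) (λ i → ∑ (fins R) (λ j → ⟦ c′ j ∧ touch (suc i) j ⟧)) ∎
      where
      Wc′ = ∑ (fins (suc N)) (λ i → ∑ (fins R) (λ j → ⟦ c′ j ∧ touch i j ⟧))
      split : ∀ a b d → ⟦ a ∧ d ⟧ ≤ ⟦ a ∧ b ⟧ * ⟦ d ⟧ + ⟦ (a ∧ not b) ∧ d ⟧
      split false _     _     = z≤n
      split true  true  true  = ≤-refl
      split true  true  false = z≤n
      split true  false d     = ≤-refl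
      zero₁ : ∀ a b → ⟦ (a ∧ not b) ∧ b ⟧ ≡ 0
      zero₁ false _     = refl
      zero₁ true  true  = refl
      zero₁ true  false = refl
      first : ∑ (fins (suc N)) (λ i → ∑ (fins R) (λ j → ⟦ c j ∧ touch zero j ⟧ * ⟦ touch i j ⟧)) ≤ E * D
      first = begin
        ∑ (fins (suc N)) (λ i → ∑ (fins R) (λ j → ⟦ c j ∧ touch zero j ⟧ * ⟦ touch i j ⟧)) ≡⟨ ∑-swap (fins (suc N)) (fins R) _ ⟩
        ∑ (fins R) (λ j → ∑ (fins (suc N)) (λ i → ⟦ c j ∧ touch zero j ⟧ * ⟦ touch i j ⟧)) ≡⟨ ∑-cong (fins R) (λ j → ∑-*ˡ (fins (suc N)) ⟦ c j ∧ touch zero j ⟧ (λ i → ⟦ touch i j ⟧)) ⟩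
        ∑ (fins R) (λ j → ⟦ c j ∧ touch zero j ⟧ * rowsum j)       ≤⟨ m≤∑* (λ j → c j ∧ touch zero j) rowsum D (λ j e → sD j (∧-trueˡ (c j) e)) ⟩
        ∑ (fins R) (λ j → ⟦ c j ∧ touch zero j ⟧) * D              ≤⟨ *-monoˡ-≤ D (≤-trans (∑-mono (fins R) (λ j → ⟦⟧-∧-≤ʳ (c j) (touch zero j))) (sE zero)) ⟩
        E * D                                                      ∎
    rec : ∑ (vecs xs N) A′ * suc p ^ h ≤ Z * p * q ^ N * p ^ h
    rec = go N (touch ∘ suc) (bad ∘ (s₀ ∷_)) c′ A′ (Z * p)
      (λ i v v′ j t o → loc (suc i) (s₀ ∷ v) (s₀ ∷ v′) j t (offBy-∷ o))
      tailHit
      (sE ∘ suc)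
      (λ j cj → ≤-trans (≤-trans (m≤n+m _ ⟦ touch zero j ⟧) (≤-reflexive (sym (∑-fins N (λ i → ⟦ touch i j ⟧))))) (sD j (c⇐c′ j cj)))
      bd′ h (+-cancelˡ-≤ (E * D) _ _ (≤-trans hW W≤))

-- Random blocks, and the deficiency caused by small parts.

data Kind : Set where
  split left right : Kind

kinds : List Kind
kinds = split ∷ left ∷ right ∷ []

bools : List Bool
bools = true ∷ false ∷ []

-- A full product, so that the three kinds are equally likely and independent of the coin and of the
-- two leaves.
Top : Set → Set
Top L = Kind × Bool × L × L

tops : {L : Set} → List L → List (Top L)
tops ls = pairs kinds (pairs bools (pairs ls ls))

∑-tops : {L : Set} (ls : List L) (f : Top L → ℕ) →
  ∑ (tops ls) f ≡ ∑ kinds (λ κ → ∑ ls (λ y → ∑ ls (λ z → f (κ , true , y , z) + f (κ , false , y , z))))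
∑-tops ls f = trans (∑-pairs kinds (pairs bools (pairs ls ls)) f) (∑-cong kinds inner)
  where
  inner : ∀ κ → ∑ (pairs bools (pairs ls ls)) (λ p → f (κ , p)) ≡ ∑ ls (λ y → ∑ ls (λ z → f (κ , true , y , z) + f (κ , false , y , z)))
  inner κ = trans (∑-pairs bools (pairs ls ls) (λ p → f (κ , p))) (trans
    (cong₂ _+_ (∑-pairs ls ls (h true)) (trans (+-identityʳ _) (∑-pairs ls ls (h false))))
    (trans (sym (∑-+ ls (λ y → ∑ ls (λ z → h true (y , z))) (λ y → ∑ ls (λ z → h false (y , z)))))
           (∑-cong ls (λ y → sym (∑-+ ls (λ z → h true (y , z)) (λ z → h false (y , z)))))))
    where
    h : Bool → _ → ℕ
    h b p = f (κ , b , p)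

∣tops∣ : {L : Set} (ls : List L) → ∣ tops ls ∣ ≡ 6 * (∣ ls ∣ * ∣ ls ∣)
∣tops∣ ls = trans (∑-tops ls (λ _ → 1)) (trans (∑³-const kinds ls ls 2) (e ∣ ls ∣))
  where e : ∀ n → 3 * (n * (n * 2)) ≡ 6 * (n * n)
        e = solve-∀

_==_ : ∀ {R} → Fin R → Fin R → Bool
i == j = does (i Fin.≟ j)

==-refl : ∀ {R} (i : Fin R) → (i == i) ≡ true
==-refl i = dec-true (i Fin.≟ i) refl

==⇒≡ : ∀ {R} (i j : Fin R) → (i == j) ≡ true → i ≡ j
==⇒≡ i j e with i Fin.≟ j
... | yes p = p

==⇒≢ : ∀ {R} (i j : Fin R) → (i == j) ≡ false → i ≢ j
==⇒≢ i j e refl with trans (sym e) (==-refl i)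
... | ()

not-true⇒false : ∀ {b} → not b ≡ true → b ≡ false
not-true⇒false {false} _ = refl

∨-true⇒⊎ : ∀ a {b} → a ∨ b ≡ true → a ≡ true ⊎ b ≡ true
∨-true⇒⊎ true  _ = inj₁ refl
∨-true⇒⊎ false e = inj₂ e

-- Bernoulli's inequality `(1 - 1/G)^e ≥ 1 - e/G` with `G = suc g`, multiplied by `G^(e+1)`.
one-minus-bound : ∀ g e → suc g ^ e * suc g ≤ g ^ e * suc g + e * suc g ^ e
one-minus-bound g zero    = m≤m+n _ 0
one-minus-bound g (suc e) = begin
  suc g * G * suc g                                        ≡⟨ l₁ g G ⟩
  g * (G * suc g) + G * suc g                              ≤⟨ +-monoˡ-≤ (G * suc g) (*-monoʳ-≤ g (one-minus-bound g e)) ⟩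
  g * (g ^ e * suc g + e * G) + G * suc g                  ≤⟨ m≤m+n _ (e * G) ⟩
  g * (g ^ e * suc g + e * G) + G * suc g + e * G          ≡⟨ l₂ g (g ^ e) e G ⟩
  g * g ^ e * suc g + suc e * (suc g * G)                  ∎
  where
  open ≤-Reasoning
  G = suc g ^ e
  l₁ : ∀ g G → suc g * G * suc g ≡ g * (G * suc g) + G * suc g
  l₁ = solve-∀
  l₂ : ∀ g p e G → g * (p * suc g + e * G) + G * suc g + e * G ≡ g * p * suc g + suc e * (suc g * G)
  l₂ = solve-∀

half-sum : ∀ a b n → 2 * a ≤ n → 2 * b ≤ n → a + b ≤ n
half-sum a b n p q = *-cancelˡ-≤ {a + b} {n} 2 (≤-trans (≤-reflexive (*-distribˡ-+ 2 a b)) (≤-trans (+-mono-≤ p q) (≤-reflexive (cong (n +_) (sym (+-identityʳ n))))))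

pos-factor : ∀ n {g} → suc g ≡ 96 * n → NonZero n
pos-factor (suc n) _ = _

module SmallParts {L : Set} (ls : List L) (g : ℕ) (G≡ : suc g ≡ 96 * ∣ ls ∣) where

  open ≤-Reasoning

  private
    n = ∣ ls ∣
    G = suc g

  weight : ∀ {N R} → (Fin N → Bool → L → Fin R) → (Fin R → Bool) → Fin N → ℕ
  weight lab c i = ∑ bools (λ s → ∑ ls (λ l → ⟦ c (lab i s l) ⟧))

  -- The effect of the coin of a `split` block on parities of parts: it decides whether exactly `y`
  -- and `z` are free, so the parities of their two labels flip if the labels differ, and no other
  -- parity changes.
  Flips : ∀ {N R} → (Fin N → Bool → L → Fin R) → (Vec (Top L) N → Fin R → Bool) → (Fin R → Bool) → Set
  Flips lab par c = ∀ i v v′ y z → OffBy i v v′ → lookup v i ≡ (split , true , y , z) → lookup v′ i ≡ (split , false , y , z) →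
    (∀ j → j ≢ lab i true y → j ≢ lab i false z → par v j ≡ par v′ j) ×
    (lab i true y ≢ lab i false z → ∀ j → (j ≡ lab i true y ⊎ j ≡ lab i false z) → c j ≡ true → par v j ≡ not (par v′ j))

  private
    flips-tail : ∀ {N R} {lab : Fin (suc N) → Bool → L → Fin R} {par c} t → Flips lab par c → Flips (lab ∘ suc) (par ∘ (t ∷_)) c
    flips-tail t fl i v v′ y z o e e′ = fl (suc i) (t ∷ v) (t ∷ v′) y z (offBy-∷ o) e e′

    -- Two dropped parts weigh at most `n` together. Giving up that much of the exponent costs at
    -- most `(G/g)^n ≤ 96/95 ≤ 7/6`, since `G = 96 n`.
    6G≤7g : ∀ e → e ≤ n → 6 * G ^ e ≤ 7 * g ^ e
    6G≤7g e e≤n = *-cancelʳ-≤ _ _ (95 * n) {{m*n≢0 95 n {{_}} {{nz}}}} (begin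
      6 * G ^ e * (95 * n)                   ≡⟨ l₁ (G ^ e) n ⟩
      6 * (G ^ e * (95 * n))                 ≤⟨ *-monoʳ-≤ 6 lem ⟩
      6 * (g ^ e * (96 * n))                 ≤⟨ m≤m+n _ (89 * (g ^ e * n)) ⟩
      6 * (g ^ e * (96 * n)) + 89 * (g ^ e * n) ≡⟨ l₂ (g ^ e) n ⟩
      7 * g ^ e * (95 * n)                   ∎)
      where
      nz : NonZero n
      nz = pos-factor n G≡
      l₁ : ∀ x n → 6 * x * (95 * n) ≡ 6 * (x * (95 * n))
      l₁ = solve-∀
      l₂ : ∀ x n → 6 * (x * (96 * n)) + 89 * (x * n) ≡ 7 * x * (95 * n)
      l₂ = solve-∀
      l₃ : ∀ x n → x * (95 * n) + n * x ≡ x * (96 * n)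
      l₃ = solve-∀
      lem : G ^ e * (95 * n) ≤ g ^ e * (96 * n)
      lem = +-cancelʳ-≤ (n * G ^ e) _ _ (begin
        G ^ e * (95 * n) + n * G ^ e         ≡⟨ l₃ (G ^ e) n ⟩
        G ^ e * (96 * n)                     ≡⟨ cong (G ^ e *_) G≡ ⟨
        G ^ e * G                            ≤⟨ one-minus-bound g e ⟩
        g ^ e * G + e * G ^ e                ≤⟨ +-mono-≤ (≤-reflexive (cong (g ^ e *_) G≡)) (*-monoˡ-≤ (G ^ e) e≤n) ⟩
        g ^ e * (96 * n) + n * G ^ e         ∎)

    -- If the label of `y` lies in `c`, at most half of the `z` share it, so at least `n / 2` of the
    -- `z` have a different label; the same holds with the roles exchanged. A pair can be counted
    -- from both sides, hence 4 and not 2.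
    fresh-count : ∀ {R} (a b : L → Fin R) (c : Fin R → Bool) →
      (∀ j → c j ≡ true → 2 * ∑ ls (λ l → ⟦ a l == j ⟧) ≤ n) →
      (∀ j → c j ≡ true → 2 * ∑ ls (λ l → ⟦ b l == j ⟧) ≤ n) →
      (∑ ls (λ l → ⟦ c (a l) ⟧) + ∑ ls (λ l → ⟦ c (b l) ⟧)) * n ≤
      4 * ∑ ls (λ y → ∑ ls (λ z → ⟦ (c (a y) ∨ c (b z)) ∧ not (a y == b z) ⟧))
    fresh-count a b c sa sb = begin
      (wa + wb) * n              ≡⟨ *-distribʳ-+ n wa wb ⟩
      wa * n + wb * n            ≤⟨ +-mono-≤ (side a b sb f (λ y z → ineq₁ (c (a y)) (c (b z)) (a y == b z)))
                                             (≤-trans (side b a sa f′ (λ z y → ≤-trans (≤-reflexive (cong (λ e → ⟦ c (b z) ⟧ * ⟦ not e ⟧) (==-sym (b z) (a y)))) (ineq₂ (c (a y)) (c (b z)) (a y == b z))))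
                                                      (≤-reflexive (cong (2 *_) (∑-swap ls ls f′)))) ⟩
      2 * F + 2 * F              ≡⟨ l F ⟩
      4 * F                      ∎
      where
      wa = ∑ ls (λ l → ⟦ c (a l) ⟧)
      wb = ∑ ls (λ l → ⟦ c (b l) ⟧)
      f : L → L → ℕ
      f y z = ⟦ (c (a y) ∨ c (b z)) ∧ not (a y == b z) ⟧
      f′ : L → L → ℕ
      f′ z y = f y z
      F = ∑ ls (λ y → ∑ ls (f y))
      l : ∀ F → 2 * F + 2 * F ≡ 4 * F
      l = solve-∀
      ==-sym : ∀ {R} (i j : Fin R) → (i == j) ≡ (j == i)
      ==-sym i j with i Fin.≟ j | j Fin.≟ i
      ... | yes _ | yes _ = refl
      ... | no _  | no _  = refl
      ... | yes p | no q  = ⊥-elim (q (sym p))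
      ... | no p  | yes q = ⊥-elim (p (sym q))
      ineq₁ : ∀ p q r → ⟦ p ⟧ * ⟦ not r ⟧ ≤ ⟦ (p ∨ q) ∧ not r ⟧
      ineq₁ true  q r = ≤-reflexive (+-identityʳ ⟦ not r ⟧)
      ineq₁ false q r = z≤n
      ineq₂ : ∀ p q r → ⟦ q ⟧ * ⟦ not r ⟧ ≤ ⟦ (p ∨ q) ∧ not r ⟧
      ineq₂ true  true  r = ≤-reflexive (+-identityʳ ⟦ not r ⟧)
      ineq₂ false true  r = ≤-reflexive (+-identityʳ ⟦ not r ⟧)
      ineq₂ p     false r = z≤n
      side : ∀ a b → (∀ j → c j ≡ true → 2 * ∑ ls (λ l → ⟦ b l == j ⟧) ≤ n) → (f : L → L → ℕ) →
             (∀ y z → ⟦ c (a y) ⟧ * ⟦ not (a y == b z) ⟧ ≤ f y z) →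
             ∑ ls (λ l → ⟦ c (a l) ⟧) * n ≤ 2 * ∑ ls (λ y → ∑ ls (f y))
      side a b sb f hf = begin
        ∑ ls (λ l → ⟦ c (a l) ⟧) * n                    ≡⟨ ∑-*ʳ ls _ n ⟨
        ∑ ls (λ y → ⟦ c (a y) ⟧ * n)                    ≤⟨ ∑-mono ls (λ y → ≤-trans (pt y (c (a y)) refl) (*-monoʳ-≤ 2 (∑-mono ls (hf y)))) ⟩
        ∑ ls (λ y → 2 * ∑ ls (f y))                     ≡⟨ ∑-*ˡ ls 2 _ ⟩
        2 * ∑ ls (λ y → ∑ ls (f y))                     ∎
        where
        both : ∀ r → ⟦ r ⟧ + ⟦ not r ⟧ ≡ 1
        both true  = refl
        both false = refl
        pt : ∀ y v → c (a y) ≡ v → ⟦ v ⟧ * n ≤ 2 * ∑ ls (λ z → ⟦ v ⟧ * ⟦ not (a y == b z) ⟧)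
        pt y false e = z≤n
        pt y true  e = +-cancelʳ-≤ n _ _ (begin
          1 * n + n                                       ≡⟨ l₁ n ⟩
          2 * n                                           ≡⟨ cong (2 *_) (∑-cong ls (λ z → both (a y == b z))) ⟨
          2 * ∑ ls (λ z → ⟦ a y == b z ⟧ + ⟦ not (a y == b z) ⟧) ≡⟨ cong (2 *_) (∑-+ ls _ _) ⟩
          2 * (E + X)                                     ≡⟨ *-distribˡ-+ 2 E X ⟩
          2 * E + 2 * X                                   ≤⟨ +-monoˡ-≤ (2 * X) (≤-trans (≤-reflexive (cong (2 *_) (∑-cong ls (λ z → cong ⟦_⟧ (==-sym (a y) (b z)))))) (sb (a y) e)) ⟩
          n + 2 * X                                       ≡⟨ +-comm n (2 * X) ⟩
          2 * X + n                                       ≡⟨ cong (λ z → 2 * z + n) (∑-cong ls (λ z → sym (*-identityˡ ⟦ not (a y == b z) ⟧))) ⟩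
          2 * ∑ ls (λ z → 1 * ⟦ not (a y == b z) ⟧) + n   ∎)
          where
          E = ∑ ls (λ z → ⟦ a y == b z ⟧)
          X = ∑ ls (λ z → ⟦ not (a y == b z) ⟧)
          l₁ : ∀ n → 1 * n + n ≡ 2 * n
          l₁ = solve-∀

  -- The first block is `split` with probability 1/3, its two leaves are then fresh with probability
  -- at least `w / 4n`, and in that case averaging over the coin saves 1/8. The product of the three
  -- is `w / 96n`, which is the origin of `G = 96 n`; Bernoulli replaces `1 - w/G` by `(1 - 1/G)^w`.
  small-parts : ∀ {R} N (lab : Fin N → Bool → L → Fin R) (par : Vec (Top L) N → Fin R → Bool) (c : Fin R → Bool)
    (A : Vec (Top L) N → ℕ) (Z : ℕ) →
    Flips lab par c →
    (∀ j → c j ≡ true → 2 * ∑ (fins N) (weight lab (_== j)) ≤ n) →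
    (∀ v → A v * 2 ^ ∑ (fins R) (λ j → ⟦ c j ∧ par v j ⟧) ≤ Z) →
    ∀ F → F ≤ ∑ (fins N) (weight lab c) →
    ∑ (vecs (tops ls) N) A * G ^ F ≤ Z * ∣ tops ls ∣ ^ N * g ^ F
  small-parts zero lab par c A Z fl sm bd zero hF = *-monoˡ-≤ 1 (begin
    A [] + 0                 ≡⟨ +-identityʳ (A []) ⟩
    A []                     ≤⟨ drop-2^ (A []) (∑ (fins _) (λ j → ⟦ c j ∧ par [] j ⟧)) (bd []) ⟩
    Z                        ≡⟨ *-identityʳ Z ⟨
    Z * 1                    ∎)
  small-parts {R} (suc N) lab par c A Z fl sm bd F hF =
    subst (λ F → ∑ (vecs (tops ls) (suc N)) A * G ^ F ≤ Z * ∣ tops ls ∣ ^ suc N * g ^ F) (m+[n∸m]≡n (m∸n≤m F w))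
     (*-cancelˡ-≤ 16 (+-cancelʳ-≤ (4 * f * X * G ^ e) _ _ (begin
      16 * (∑ (vecs (tops ls) (suc N)) A * G ^ (a + e)) + 4 * f * X * G ^ e  ≡⟨ cong (λ z → 16 * z + 4 * f * X * G ^ e) (cong₂ _*_ (∑-vecs (tops ls) N A) (^-distribˡ-+-* G a e)) ⟩
      16 * (S * (G ^ a * G ^ e)) + 4 * f * X * G ^ e   ≡⟨ l₁ S (G ^ a) (G ^ e) f X ⟩
      4 * (4 * S * G ^ a + f * X) * G ^ e              ≤⟨ *-monoˡ-≤ (G ^ e) (*-monoʳ-≤ 4 total) ⟩
      4 * (24 * (n * n) * X) * G ^ e                   ≡⟨ l₂ n X (G ^ e) ⟩
      n * X * (G ^ e * (96 * n))                       ≡⟨ cong (λ z → n * X * (G ^ e * z)) G≡ ⟨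
      n * X * (G ^ e * G)                              ≤⟨ *-monoʳ-≤ (n * X) (one-minus-bound g e) ⟩
      n * X * (g ^ e * G + e * G ^ e)                  ≡⟨ cong (λ z → n * X * (g ^ e * z + e * G ^ e)) G≡ ⟩
      n * X * (g ^ e * (96 * n) + e * G ^ e)           ≡⟨ l₃ n X (g ^ e) e (G ^ e) ⟩
      16 * (6 * (n * n) * X * g ^ e) + e * n * X * G ^ e ≤⟨ +-monoʳ-≤ (16 * (6 * (n * n) * X * g ^ e)) (*-monoˡ-≤ (G ^ e) (*-monoˡ-≤ X (≤-trans (*-monoˡ-≤ n e≤w) 4f≥))) ⟩
      16 * (6 * (n * n) * X * g ^ e) + 4 * f * X * G ^ e ≡⟨ cong (λ z → 16 * z + 4 * f * X * G ^ e) X≡ ⟩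
      16 * (Z * ∣ tops ls ∣ ^ suc N * g ^ (a + e)) + 4 * f * X * G ^ e ∎)))
    where
    Ts = tops ls
    B = ∣ Ts ∣ ^ N
    w = weight lab c zero
    -- The exponent `F` is shared: the first block pays for `e`, at most its weight `w`, and the
    -- remaining blocks for `a`.
    a = F ∸ w
    e = F ∸ a
    X = Z * B * g ^ a
    fresh : L → L → Bool
    fresh y z = (c (lab zero true y) ∨ c (lab zero false z)) ∧ not (lab zero true y == lab zero false z)
    f = ∑ ls (λ y → ∑ ls (λ z → ⟦ fresh y z ⟧))
    S = ∑ Ts (λ t → ∑ (vecs Ts N) (A ∘ (t ∷_)))
    e≤w : e ≤ w
    e≤w = (m≤n+o⇒m∸n≤o F a (≤-trans (m≤n+m∸n F w) (≤-reflexive (+-comm w a))))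
    a≤ : a ≤ ∑ (fins N) (weight (lab ∘ suc) c)
    a≤ = m≤n+o⇒m∸n≤o F w (≤-trans hF (≤-reflexive (∑-fins N (weight lab c))))
    X≡ : 6 * (n * n) * X * g ^ e ≡ Z * ∣ Ts ∣ ^ suc N * g ^ (a + e)
    X≡ = begin-equality
      6 * (n * n) * X * g ^ e             ≡⟨ l (6 * (n * n)) Z B (g ^ a) (g ^ e) ⟩
      Z * (6 * (n * n) * B) * (g ^ a * g ^ e) ≡⟨ cong₂ (λ p q → Z * (p * B) * q) (sym (∣tops∣ ls)) (sym (^-distribˡ-+-* g a e)) ⟩
      Z * ∣ Ts ∣ ^ suc N * g ^ (a + e)    ∎
      where
      l : ∀ m Z B p q → m * (Z * B * p) * q ≡ Z * (m * B) * (p * q)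
      l = solve-∀
    l₁ : ∀ S p q f X → 16 * (S * (p * q)) + 4 * f * X * q ≡ 4 * (4 * S * p + f * X) * q
    l₁ = solve-∀
    l₂ : ∀ n X q → 4 * (24 * (n * n) * X) * q ≡ n * X * (q * (96 * n))
    l₂ = solve-∀
    l₃ : ∀ n X p e q → n * X * (p * (96 * n) + e * q) ≡ 16 * (6 * (n * n) * X * p) + e * n * X * q
    l₃ = solve-∀
    single : ∀ j → c j ≡ true → 2 * (∑ ls (λ l → ⟦ lab zero true l == j ⟧) + ∑ ls (λ l → ⟦ lab zero false l == j ⟧)) ≤ n
    single j cj = ≤-trans (*-monoʳ-≤ 2 (≤-trans (≤-reflexive (cong (∑ ls (λ l → ⟦ lab zero true l == j ⟧) +_) (sym (+-identityʳ _)))) (≤∑-fins (weight lab (_== j)) zero))) (sm j cj)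
    4f≥ : w * n ≤ 4 * f
    4f≥ = ≤-trans (≤-reflexive (cong (_* n) (cong (∑ ls (λ l → ⟦ c (lab zero true l) ⟧) +_) (+-identityʳ _))))
      (fresh-count (lab zero true) (lab zero false) c
        (λ j cj → ≤-trans (*-monoʳ-≤ 2 (m≤m+n (∑ ls (λ l → ⟦ lab zero true l == j ⟧)) (∑ ls (λ l → ⟦ lab zero false l == j ⟧)))) (single j cj))
        (λ j cj → ≤-trans (*-monoʳ-≤ 2 (m≤n+m (∑ ls (λ l → ⟦ lab zero false l == j ⟧)) (∑ ls (λ l → ⟦ lab zero true l == j ⟧)))) (single j cj)))
    sm-tail : ∀ j → c j ≡ true → 2 * ∑ (fins N) (weight (lab ∘ suc) (_== j)) ≤ n
    sm-tail j cj = ≤-trans (*-monoʳ-≤ 2 (≤-trans (m≤n+m _ (weight lab (_== j) zero)) (≤-reflexive (sym (∑-fins N (weight lab (_== j))))))) (sm j cj)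
    plain : ∀ t → ∑ (vecs Ts N) (A ∘ (t ∷_)) * G ^ a ≤ X
    plain t = small-parts N (lab ∘ suc) (par ∘ (t ∷_)) c (A ∘ (t ∷_)) Z (flips-tail {lab = lab} {par} t fl) sm-tail (λ v → bd (t ∷ v)) a a≤
    two : Kind → L → L → ℕ
    two κ y z = ∑ (vecs Ts N) (A ∘ ((κ , true , y , z) ∷_)) + ∑ (vecs Ts N) (A ∘ ((κ , false , y , z) ∷_))
    two-plain : ∀ κ y z → 4 * two κ y z * G ^ a ≤ 8 * X
    two-plain κ y z = begin
      4 * (p + q) * G ^ a              ≡⟨ l p q (G ^ a) ⟩
      4 * (p * G ^ a + q * G ^ a)      ≤⟨ *-monoʳ-≤ 4 (+-mono-≤ (plain _) (plain _)) ⟩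
      4 * (X + X)                      ≡⟨ l′ X ⟩
      8 * X                            ∎
      where
      p = ∑ (vecs Ts N) (A ∘ ((κ , true , y , z) ∷_))
      q = ∑ (vecs Ts N) (A ∘ ((κ , false , y , z) ∷_))
      l : ∀ p q x → 4 * (p + q) * x ≡ 4 * (p * x + q * x)
      l = solve-∀
      l′ : ∀ X → 4 * (X + X) ≡ 8 * X
      l′ = solve-∀
    -- One of the two coins makes the parity of a label in `c` odd, so the two outcomes cost `3/2`
    -- instead of `2`. Both labels are then dropped from `c` for the remaining blocks at the price
    -- `7/6`, which leaves `7/4`.
    two-fresh : ∀ y z → fresh y z ≡ true → 4 * two split y z * G ^ a ≤ 7 * X
    two-fresh y z fr = begin
      4 * (p + q) * G ^ a                           ≡⟨ cong (λ x → 4 * (p + q) * G ^ x) (m+[n∸m]≡n (m∸n≤m a n)) ⟨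
      4 * (p + q) * G ^ (F′ + e′)                   ≡⟨ cong (4 * (p + q) *_) (^-distribˡ-+-* G F′ e′) ⟩
      4 * (p + q) * (G ^ F′ * G ^ e′)               ≡⟨ l (p + q) (G ^ F′) (G ^ e′) ⟩
      2 * (((p + q) * 2) * G ^ F′) * G ^ e′         ≡⟨ cong (λ x → 2 * (x * G ^ F′) * G ^ e′) (trans (∑-*ʳ (vecs Ts N) _ 2) (cong (_* 2) (∑-+ (vecs Ts N) _ _))) ⟨
      2 * (∑ (vecs Ts N) A′ * G ^ F′) * G ^ e′      ≤⟨ *-monoˡ-≤ (G ^ e′) (*-monoʳ-≤ 2 rec) ⟩
      2 * (3 * Z * B * g ^ F′) * G ^ e′             ≡⟨ l′ Z B (g ^ F′) (G ^ e′) ⟩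
      Z * B * g ^ F′ * (6 * G ^ e′)                 ≤⟨ *-monoʳ-≤ (Z * B * g ^ F′) (6G≤7g e′ (m≤n+o⇒m∸n≤o a F′ (≤-trans (m≤n+m∸n a n) (≤-reflexive (+-comm n F′))))) ⟩
      Z * B * g ^ F′ * (7 * g ^ e′)                 ≡⟨ l″ (Z * B) (g ^ F′) (g ^ e′) ⟩
      7 * (Z * B * (g ^ F′ * g ^ e′))               ≡⟨ cong (λ x → 7 * (Z * B * x)) (^-distribˡ-+-* g F′ e′) ⟨
      7 * (Z * B * g ^ (F′ + e′))                   ≡⟨ cong (λ x → 7 * (Z * B * g ^ x)) (m+[n∸m]≡n (m∸n≤m a n)) ⟩
      7 * X                                         ∎
      where
      p = ∑ (vecs Ts N) (A ∘ ((split , true , y , z) ∷_))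
      q = ∑ (vecs Ts N) (A ∘ ((split , false , y , z) ∷_))
      F′ = a ∸ n
      e′ = a ∸ F′
      l : ∀ s x y → 4 * s * (x * y) ≡ 2 * ((s * 2) * x) * y
      l = solve-∀
      l′ : ∀ Z B x y → 2 * (3 * Z * B * x) * y ≡ Z * B * x * (6 * y)
      l′ = solve-∀
      l″ : ∀ Z x y → Z * x * (7 * y) ≡ 7 * (Z * (x * y))
      l″ = solve-∀
      j₁ = lab zero true y
      j₂ = lab zero false z
      t₁ t₀ : Top L
      t₁ = split , true , y , z
      t₀ = split , false , y , z
      c′ : Fin R → Bool
      c′ j = c j ∧ not (j == j₁) ∧ not (j == j₂)
      A′ : Vec (Top L) N → ℕ
      A′ v = (A (t₁ ∷ v) + A (t₀ ∷ v)) * 2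
      j₁≢j₂ : j₁ ≢ j₂
      j₁≢j₂ = ==⇒≢ j₁ j₂ (not-true⇒false (∧-trueʳ (c j₁ ∨ c j₂) fr))
      some : Σ (Fin R) λ j → (j ≡ j₁ ⊎ j ≡ j₂) × c j ≡ true
      some = [ (λ e → j₁ , inj₁ refl , e) , (λ e → j₂ , inj₂ refl , e) ]′ (∨-true⇒⊎ (c j₁) (∧-trueˡ (c j₁ ∨ c j₂) fr))
      φ : Top L → Vec (Top L) N → ℕ
      φ t v = ∑ (fins R) (λ j → ⟦ c j ∧ par (t ∷ v) j ⟧)
      φ′ : Vec (Top L) N → ℕ
      φ′ v = ∑ (fins R) (λ j → ⟦ c′ j ∧ par (t₁ ∷ v) j ⟧)
      pf = λ v → fl zero (t₁ ∷ v) (t₀ ∷ v) y z (offBy-head t₁ t₀ v) refl refl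
      same : ∀ v j → ⟦ c′ j ∧ par (t₁ ∷ v) j ⟧ ≡ ⟦ c′ j ∧ par (t₀ ∷ v) j ⟧
      same v j with c j | j == j₁ in e₁ | j == j₂ in e₂
      ... | false | _     | _     = refl
      ... | true  | true  | _     = refl
      ... | true  | false | true  = refl
      ... | true  | false | false = cong ⟦_⟧ (proj₁ (pf v) j (==⇒≢ j j₁ e₁) (==⇒≢ j j₂ e₂))
      weaken : ∀ a b d → ⟦ (a ∧ b) ∧ d ⟧ ≤ ⟦ a ∧ d ⟧
      weaken true  b d = ⟦⟧-∧-≤ʳ b d
      weaken false b d = z≤n
      φ′≤₁ : ∀ v → φ′ v ≤ φ t₁ v
      φ′≤₁ v = ∑-mono (fins R) (λ j → weaken (c j) _ (par (t₁ ∷ v) j))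
      φ′≤₀ : ∀ v → φ′ v ≤ φ t₀ v
      φ′≤₀ v = ∑-mono (fins R) (λ j → ≤-trans (≤-reflexive (same v j)) (weaken (c j) _ (par (t₀ ∷ v) j)))
      φ′< : ∀ t v (j : Fin R) → (j ≡ j₁ ⊎ j ≡ j₂) → c j ≡ true → par (t ∷ v) j ≡ true →
            (∀ i → ⟦ c′ i ∧ par (t₁ ∷ v) i ⟧ ≡ ⟦ c′ i ∧ par (t ∷ v) i ⟧) → suc (φ′ v) ≤ φ t v
      φ′< t v j hj cj pj sm′ = begin
        suc (φ′ v)                                                    ≡⟨ +-comm 1 (φ′ v) ⟩
        φ′ v + 1                                                      ≤⟨ +-monoʳ-≤ (φ′ v) (≤-trans one (≤∑-fins h j)) ⟩
        φ′ v + ∑ (fins R) h                                           ≡⟨ ∑-+ (fins R) _ h ⟨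
        ∑ (fins R) (λ i → ⟦ c′ i ∧ par (t₁ ∷ v) i ⟧ + h i)            ≤⟨ ∑-mono (fins R) (λ i → ≤-trans (≤-reflexive (cong (_+ h i) (sm′ i))) (spl (c i) (not (i == j₁) ∧ not (i == j₂)) (par (t ∷ v) i))) ⟩
        φ t v                                                         ∎
        where
        h : Fin R → ℕ
        h i = ⟦ (c i ∧ not (not (i == j₁) ∧ not (i == j₂))) ∧ par (t ∷ v) i ⟧
        spl : ∀ a b d → ⟦ (a ∧ b) ∧ d ⟧ + ⟦ (a ∧ not b) ∧ d ⟧ ≤ ⟦ a ∧ d ⟧
        spl false _     _ = z≤n
        spl true  true  d = ≤-reflexive (+-identityʳ ⟦ d ⟧)
        spl true  false d = ≤-refl
        one′ : ∀ j → (j ≡ j₁ ⊎ j ≡ j₂) → c j ≡ true → par (t ∷ v) j ≡ true → 1 ≤ h j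
        one′ j (inj₁ refl) cj pj rewrite cj | ==-refl j₁ | pj = ≤-refl
        one′ j (inj₂ refl) cj pj rewrite cj | ==-refl j₂ | pj | Boolₚ.∧-zeroʳ (not (j₂ == j₁)) = ≤-refl
        one = one′ j hj cj pj
      bd′ : ∀ v → A′ v * 2 ^ φ′ v ≤ 3 * Z
      bd′ v with some
      ... | j , hj , cj with par (t₁ ∷ v) j in e₁ | par (t₀ ∷ v) j in e₀ | proj₂ (pf v) j₁≢j₂ j hj cj
      ...   | true  | false | _ = begin
        (A (t₁ ∷ v) + A (t₀ ∷ v)) * 2 * 2 ^ φ′ v             ≡⟨ l₄ (A (t₁ ∷ v)) (A (t₀ ∷ v)) (2 ^ φ′ v) ⟩
        A (t₁ ∷ v) * 2 ^ suc (φ′ v) + 2 * (A (t₀ ∷ v) * 2 ^ φ′ v)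
          ≤⟨ +-mono-≤ (≤-trans (*-monoʳ-≤ (A (t₁ ∷ v)) (^-monoʳ-≤ 2 (φ′< t₁ v j hj cj e₁ (λ _ → refl)))) (bd (t₁ ∷ v)))
                      (*-monoʳ-≤ 2 (≤-trans (*-monoʳ-≤ (A (t₀ ∷ v)) (^-monoʳ-≤ 2 (φ′≤₀ v))) (bd (t₀ ∷ v)))) ⟩
        3 * Z                                                 ∎
        where
        l₄ : ∀ a b x → (a + b) * 2 * x ≡ a * (2 * x) + 2 * (b * x)
        l₄ = solve-∀
      ...   | false | true  | _ = begin
        (A (t₁ ∷ v) + A (t₀ ∷ v)) * 2 * 2 ^ φ′ v             ≡⟨ l₄ (A (t₁ ∷ v)) (A (t₀ ∷ v)) (2 ^ φ′ v) ⟩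
        A (t₀ ∷ v) * 2 ^ suc (φ′ v) + 2 * (A (t₁ ∷ v) * 2 ^ φ′ v)
          ≤⟨ +-mono-≤ (≤-trans (*-monoʳ-≤ (A (t₀ ∷ v)) (^-monoʳ-≤ 2 (φ′< t₀ v j hj cj e₀ (same v)))) (bd (t₀ ∷ v)))
                      (*-monoʳ-≤ 2 (≤-trans (*-monoʳ-≤ (A (t₁ ∷ v)) (^-monoʳ-≤ 2 (φ′≤₁ v))) (bd (t₁ ∷ v)))) ⟩
        3 * Z                                                 ∎
        where
        l₄ : ∀ a b x → (a + b) * 2 * x ≡ b * (2 * x) + 2 * (a * x)
        l₄ = solve-∀
      lost : Fin R → ℕ
      lost j = ⟦ c j ⟧ * ∑ (fins N) (weight (lab ∘ suc) (_== j))
      2lost≤ : ∀ j → 2 * lost j ≤ n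
      2lost≤ j with c j in cj
      ... | false = z≤n
      ... | true  = ≤-trans (≤-reflexive (cong (2 *_) (+-identityʳ (∑ (fins N) (weight (lab ∘ suc) (_== j)))))) (sm-tail j cj)
      F′≤ : F′ ≤ ∑ (fins N) (weight (lab ∘ suc) c′)
      F′≤ = m≤n+o⇒m∸n≤o a n (≤-trans a≤ (begin
        ∑ (fins N) (weight (lab ∘ suc) c)                     ≤⟨ pointwise ⟩
        lost j₁ + lost j₂ + ∑ (fins N) (weight (lab ∘ suc) c′) ≤⟨ +-monoˡ-≤ _ (half-sum (lost j₁) (lost j₂) n (2lost≤ j₁) (2lost≤ j₂)) ⟩
        n + ∑ (fins N) (weight (lab ∘ suc) c′)                ∎))
        where
        _∘lab : (Fin R → ℕ) → Fin N → Bool → L → ℕ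
        (h ∘lab) i s l = h (lab (suc i) s l)
        ∑ˡ : (Fin R → ℕ) → ℕ
        ∑ˡ h = ∑³ (fins N) bools ls (h ∘lab)
        ∑ˡ-+ : ∀ h h′ → ∑ˡ (λ j → h j + h′ j) ≡ ∑ˡ h + ∑ˡ h′
        ∑ˡ-+ h h′ = ∑³-+ (fins N) bools ls (h ∘lab) (h′ ∘lab)
        ∑ˡ-* : ∀ k h → ∑ˡ (λ j → k * h j) ≡ k * ∑ˡ h
        ∑ˡ-* k h = trans (∑³-cong (fins N) bools ls (λ i s l → *-comm k (h (lab (suc i) s l)))) (trans (∑³-*ʳ (fins N) bools ls (h ∘lab) k) (*-comm (∑ˡ h) k))
        e₁ e₂ : Fin R → ℕ
        e₁ j = ⟦ j == j₁ ⟧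
        e₂ j = ⟦ j == j₂ ⟧
        pt : ∀ j → ⟦ c j ⟧ ≤ ⟦ c j₁ ⟧ * ⟦ j == j₁ ⟧ + ⟦ c j₂ ⟧ * ⟦ j == j₂ ⟧ + ⟦ c′ j ⟧
        pt j with j == j₁ in e₁ | j == j₂ in e₂
        ... | true  | _ rewrite ==⇒≡ j j₁ e₁ = ≤-trans (≤-reflexive (sym (*-identityʳ _))) (≤-trans (m≤m+n _ _) (m≤m+n _ _))
        ... | false | true rewrite ==⇒≡ j j₂ e₂ = ≤-trans (≤-reflexive (sym (*-identityʳ _))) (≤-trans (m≤n+m _ (⟦ c j₁ ⟧ * 0)) (m≤m+n _ _))
        ... | false | false rewrite Boolₚ.∧-identityʳ (c j) = m≤n+m _ _
        pointwise : ∑ˡ (λ j → ⟦ c j ⟧) ≤ lost j₁ + lost j₂ + ∑ˡ (λ j → ⟦ c′ j ⟧)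
        pointwise = ≤-trans (∑³-mono (fins N) bools ls (λ i s l → pt (lab (suc i) s l)))
          (≤-reflexive (trans (∑ˡ-+ (λ j → ⟦ c j₁ ⟧ * e₁ j + ⟦ c j₂ ⟧ * e₂ j) (λ j → ⟦ c′ j ⟧)) (cong (_+ ∑ˡ (λ j → ⟦ c′ j ⟧))
          (trans (∑ˡ-+ (λ j → ⟦ c j₁ ⟧ * e₁ j) (λ j → ⟦ c j₂ ⟧ * e₂ j)) (cong₂ _+_ (∑ˡ-* ⟦ c j₁ ⟧ e₁) (∑ˡ-* ⟦ c j₂ ⟧ e₂))))))
      c′⇒c : ∀ j → c′ j ≡ true → c j ≡ true
      c′⇒c j = ∧-trueˡ (c j)
      rec : ∑ (vecs Ts N) A′ * G ^ F′ ≤ 3 * Z * B * g ^ F′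
      rec = small-parts N (lab ∘ suc) (par ∘ (t₁ ∷_)) c′ A′ (3 * Z) (λ i v v′ y z o e e′ → let (a , b) = flips-tail {lab = lab} {par} t₁ fl i v v′ y z o e e′ in a , λ ne j hj cj → b ne j hj (c′⇒c j cj))
              (λ j cj → sm-tail j (c′⇒c j cj)) bd′ F′ F′≤
    gain : Kind → L → L → ℕ
    gain split y z = ⟦ fresh y z ⟧
    gain _     y z = 0
    pair : ∀ κ y z → 4 * two κ y z * G ^ a + gain κ y z * X ≤ 8 * X
    pair split y z with fresh y z in fr
    ... | true  = ≤-trans (+-monoˡ-≤ (1 * X) (two-fresh y z fr)) (≤-reflexive (l X))
      where l : ∀ X → 7 * X + 1 * X ≡ 8 * X
            l = solve-∀
    ... | false = ≤-trans (≤-reflexive (+-identityʳ _)) (two-plain split y z)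
    pair left  y z = ≤-trans (≤-reflexive (+-identityʳ _)) (two-plain left y z)
    pair right y z = ≤-trans (≤-reflexive (+-identityʳ _)) (two-plain right y z)
    total : 4 * S * G ^ a + f * X ≤ 24 * (n * n) * X
    total = begin
      4 * S * G ^ a + f * X                 ≡⟨ cong₂ _+_ lhs₁ lhs₂ ⟩
      ∑∑∑ (λ κ y z → 4 * two κ y z * G ^ a) + ∑∑∑ (λ κ y z → gain κ y z * X)
                                            ≡⟨ ∑³-+ kinds ls ls (λ κ y z → 4 * two κ y z * G ^ a) (λ κ y z → gain κ y z * X) ⟨
      ∑∑∑ (λ κ y z → 4 * two κ y z * G ^ a + gain κ y z * X)
                                            ≤⟨ ∑³-mono kinds ls ls pair ⟩
      ∑∑∑ (λ κ y z → 8 * X)                 ≡⟨ ∑³-const kinds ls ls (8 * X) ⟩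
      3 * (n * (n * (8 * X)))               ≡⟨ l n X ⟩
      24 * (n * n) * X                      ∎
      where
      ∑∑∑ = ∑³ kinds ls ls
      l : ∀ n X → 3 * (n * (n * (8 * X))) ≡ 24 * (n * n) * X
      l = solve-∀
      lhs₁ : 4 * S * G ^ a ≡ ∑∑∑ (λ κ y z → 4 * two κ y z * G ^ a)
      lhs₁ = begin-equality
        4 * S * G ^ a                             ≡⟨ cong (λ x → 4 * x * G ^ a) (∑-tops ls (λ t → ∑ (vecs Ts N) (A ∘ (t ∷_)))) ⟩
        4 * ∑∑∑ two * G ^ a                       ≡⟨ l′ (∑∑∑ two) (G ^ a) ⟩
        ∑∑∑ two * (4 * G ^ a)                     ≡⟨ ∑³-*ʳ kinds ls ls two (4 * G ^ a) ⟨
        ∑∑∑ (λ κ y z → two κ y z * (4 * G ^ a))   ≡⟨ ∑³-cong kinds ls ls (λ κ y z → sym (l′ (two κ y z) (G ^ a))) ⟩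
        ∑∑∑ (λ κ y z → 4 * two κ y z * G ^ a)     ∎
        where
        l′ : ∀ s x → 4 * s * x ≡ s * (4 * x)
        l′ = solve-∀
      lhs₂ : f * X ≡ ∑∑∑ (λ κ y z → gain κ y z * X)
      lhs₂ = begin-equality
        f * X                                                                                  ≡⟨ cong (_* X) (sym (trans (cong (f +_) (cong₂ _+_ zz (cong (_+ 0) zz))) (+-identityʳ f))) ⟩
        ∑∑∑ (λ κ y z → gain κ y z) * X                      ≡⟨ ∑³-*ʳ kinds ls ls gain X ⟨
        ∑∑∑ (λ κ y z → gain κ y z * X)                    ∎
        where
        zz : ∑ ls (λ y → ∑ ls (λ z → 0)) ≡ 0
        zz = trans (∑-cong ls (λ _ → ∑-zero ls)) (∑-zero ls)

-- Boolean assignments, classical case distinctions, and orders on monomials.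

count : ∀ {n} → (Fin n → Bool) → ℕ
count {n} U = ∑ (fins n) (⟦_⟧ ∘ U)

tail : ∀ {n} → (Fin (suc n) → Bool) → Fin n → Bool
tail a x = a (suc x)

cons : ∀ {n} → Bool → (Fin n → Bool) → Fin (suc n) → Bool
cons b a zero    = b
cons b a (suc x) = a x

-- One representative for each assignment of `U`; they select the rows and columns of a submatrix to
-- which `diagonal-rank` applies.
record Points {n} (U : Fin n → Bool) (N : ℕ) : Set where
  field
    point    : Fin N → Fin n → Bool
    distinct : ∀ i j → i ≢ j → ∃[ x ] (U x ≡ true × point i x ≢ point j x)

points : ∀ {n} (U : Fin n → Bool) → Points U (2 ^ count U)
points {zero}  U = record { point = λ _ () ; distinct = λ { zero zero ne → ⊥-elim (ne refl) } }
points {suc n} U rewrite ∑-fins n (⟦_⟧ ∘ U) with U zero in U0 | points (U ∘ suc)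
... | false | P = record
  { point    = λ i → cons false (Points.point P i)
  ; distinct = λ i j ne → let (x , Ux , ne′) = Points.distinct P i j ne in suc x , Ux , ne′ }
... | true | P = record { point = pt ; distinct = dist }
  where
  N = 2 ^ count (U ∘ suc)
  half : Fin N ⊎ Fin (N + 0) → Fin (suc n) → Bool
  half (inj₁ i) = cons true (Points.point P i)
  half (inj₂ i) = cons false (Points.point P (subst Fin (+-identityʳ N) i))
  pt : Fin (N + (N + 0)) → Fin (suc n) → Bool
  pt i = half (splitAt N i)
  halves : ∀ s t → s ≢ t → ∃[ x ] (U x ≡ true × half s x ≢ half t x)
  halves (inj₁ i) (inj₂ j) ne = zero , U0 , λ ()
  halves (inj₂ i) (inj₁ j) ne = zero , U0 , λ ()
  halves (inj₁ i) (inj₁ j) ne = let (x , Ux , ne′) = Points.distinct P i j (ne ∘ cong inj₁) in suc x , Ux , ne′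
  halves (inj₂ i) (inj₂ j) ne =
    let (x , Ux , ne′) = Points.distinct P _ _ (λ e → ne (cong inj₂ (subst-inj e))) in suc x , Ux , ne′
    where
    subst-inj : ∀ {M K} {p : M ≡ K} {i j : Fin M} → subst Fin p i ≡ subst Fin p j → i ≡ j
    subst-inj {p = refl} e = e
  dist : ∀ i j → i ≢ j → ∃[ x ] (U x ≡ true × pt i x ≢ pt j x)
  dist i j ne = halves (splitAt N i) (splitAt N j) (λ e → ne
    (trans (sym (Finₚ.join-splitAt N (N + 0) i)) (trans (cong (Fin.join N (N + 0)) e) (Finₚ.join-splitAt N (N + 0) j))))

-- Excluded middle over a finite range. It serves predicates such as vanishing in the field, and the
-- double negation disappears in front of a decidable goal.
¬¬-search : ∀ {p} n (P : Fin n → Set p) → ¬ ¬ ((∃[ i ] ¬ P i) ⊎ (∀ i → P i))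
¬¬-search zero    P k = k (inj₂ λ ())
¬¬-search (suc n) P k = ¬¬-search n (P ∘ suc) λ where
  (inj₁ (i , ¬p)) → k (inj₁ (suc i , ¬p))
  (inj₂ all)      → k (inj₁ (zero , λ p → k (inj₂ λ { zero → p ; (suc i) → all i })))

_≺_ : ∀ {n} → Vec ℕ n → Vec ℕ n → Set
[]      ≺ []      = ⊥
(a ∷ e) ≺ (b ∷ f) = a < b ⊎ (a ≡ b × e ≺ f)

_⊞_ : ∀ {n} → Vec ℕ n → Vec ℕ n → Vec ℕ n
_⊞_ = Vec.zipWith _+_

≺-irrefl : ∀ {n} (e : Vec ℕ n) → ¬ (e ≺ e)
≺-irrefl (a ∷ e) (inj₁ a<a)       = <-irrefl refl a<a
≺-irrefl (a ∷ e) (inj₂ (_ , e≺e)) = ≺-irrefl e e≺e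

≺-trans : ∀ {n} (e f g : Vec ℕ n) → e ≺ f → f ≺ g → e ≺ g
≺-trans []      []      []      ()
≺-trans (a ∷ e) (b ∷ f) (c ∷ g) (inj₁ p)          (inj₁ q)          = inj₁ (<-trans p q)
≺-trans (a ∷ e) (b ∷ f) (c ∷ g) (inj₁ p)          (inj₂ (refl , _)) = inj₁ p
≺-trans (a ∷ e) (b ∷ f) (c ∷ g) (inj₂ (refl , _)) (inj₁ q)          = inj₁ q
≺-trans (a ∷ e) (b ∷ f) (c ∷ g) (inj₂ (refl , p)) (inj₂ (refl , q)) = inj₂ (refl , ≺-trans e f g p q)

≺-tri : ∀ {n} (e f : Vec ℕ n) → e ≺ f ⊎ e ≡ f ⊎ f ≺ e
≺-tri []      []      = inj₂ (inj₁ refl)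
≺-tri (a ∷ e) (b ∷ f) with <-cmp a b
... | Tri.tri< a<b _ _ = inj₁ (inj₁ a<b)
... | Tri.tri> _ _ b<a = inj₂ (inj₂ (inj₁ b<a))
... | Tri.tri≈ _ refl _ with ≺-tri e f
...   | inj₁ e≺f        = inj₁ (inj₂ (refl , e≺f))
...   | inj₂ (inj₁ refl) = inj₂ (inj₁ refl)
...   | inj₂ (inj₂ f≺e) = inj₂ (inj₂ (inj₂ (refl , f≺e)))

⊞-monoˡ-≺ : ∀ {n} (e e′ f : Vec ℕ n) → e ≺ e′ → (e ⊞ f) ≺ (e′ ⊞ f)
⊞-monoˡ-≺ []      []       []      ()
⊞-monoˡ-≺ (a ∷ e) (b ∷ e′) (c ∷ f) (inj₁ p)          = inj₁ (+-monoˡ-< c p)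
⊞-monoˡ-≺ (a ∷ e) (b ∷ e′) (c ∷ f) (inj₂ (refl , p)) = inj₂ (refl , ⊞-monoˡ-≺ e e′ f p)

⊞-monoʳ-≺ : ∀ {n} (f e e′ : Vec ℕ n) → e ≺ e′ → (f ⊞ e) ≺ (f ⊞ e′)
⊞-monoʳ-≺ []      []      []       ()
⊞-monoʳ-≺ (c ∷ f) (a ∷ e) (b ∷ e′) (inj₁ p)          = inj₁ (+-monoʳ-< c p)
⊞-monoʳ-≺ (c ∷ f) (a ∷ e) (b ∷ e′) (inj₂ (refl , p)) = inj₂ (refl , ⊞-monoʳ-≺ f e e′ p)

⊞-cancelˡ : ∀ {n} (e f g : Vec ℕ n) → e ⊞ f ≡ e ⊞ g → f ≡ g
⊞-cancelˡ []      []      []      _ = refl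
⊞-cancelˡ (a ∷ e) (b ∷ f) (c ∷ g) p =
  cong₂ _∷_ (+-cancelˡ-≡ a b c (cong Vec.head p)) (⊞-cancelˡ e f g (cong Vec.tail p))

-- Compares the degrees in x first.
key : ∀ {n} → Fin n → Vec ℕ n → Vec ℕ (suc n)
key x e = lookup e x ∷ e

key-⊞ : ∀ {n} (x : Fin n) e f → key x (e ⊞ f) ≡ key x e ⊞ key x f
key-⊞ x e f = cong (_∷ (e ⊞ f)) (Vecₚ.lookup-zipWith _+_ x e f)

mul-lt : ∀ {n} (x : Fin n) e e′ f f′ → (e ≡ e′ ⊎ key x e ≺ key x e′) → key x f ≺ key x f′ → key x (e ⊞ f) ≺ key x (e′ ⊞ f′)
mul-lt x e e′ f f′ (inj₁ refl) q = subst₂ _≺_ (sym (key-⊞ x e f)) (sym (key-⊞ x e f′)) (⊞-monoʳ-≺ (key x e) (key x f) (key x f′) q)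
mul-lt x e e′ f f′ (inj₂ p) q = subst₂ _≺_ (sym (key-⊞ x e f)) (sym (key-⊞ x e′ f′))
  (≺-trans _ _ _ (⊞-monoˡ-≺ (key x e) (key x e′) (key x f) p) (⊞-monoʳ-≺ (key x e′) (key x f) (key x f′) q))

mul-ltˡ : ∀ {n} (x : Fin n) e e′ f f′ → key x e ≺ key x e′ → (f ≡ f′ ⊎ key x f ≺ key x f′) → key x (e ⊞ f) ≺ key x (e′ ⊞ f′)
mul-ltˡ x e e′ f f′ p (inj₁ refl) = subst₂ _≺_ (sym (key-⊞ x e f)) (sym (key-⊞ x e′ f)) (⊞-monoˡ-≺ (key x e) (key x e′) (key x f) p)
mul-ltˡ x e e′ f f′ p (inj₂ q) = mul-lt x e e′ f f′ (inj₂ p) q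

_≟M_ : ∀ {n} (e f : Vec ℕ n) → Dec (e ≡ f)
_≟M_ = Vecₚ.≡-dec _≟_

fin-search : ∀ {a b} n {A : Fin n → Set a} {B : Fin n → Set b} → (∀ i → A i ⊎ B i) → (∃[ i ] A i) ⊎ (∀ i → B i)
fin-search zero    h = inj₂ λ ()
fin-search (suc n) h with h zero | fin-search n (h ∘ suc)
... | inj₁ a | _              = inj₁ (zero , a)
... | inj₂ b | inj₁ (i , a)   = inj₁ (suc i , a)
... | inj₂ b | inj₂ all       = inj₂ λ { zero → b ; (suc i) → all i }

∑≤1-unique : ∀ {n} (f : Fin n → ℕ) → ∑ (fins n) f ≤ 1 → ∀ i j → 1 ≤ f i → 1 ≤ f j → i ≡ j
∑≤1-unique {suc n} f h i j fi fj rewrite ∑-fins n f = go i j fi fj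
  where
  tight : 1 ≤ f zero → ∀ i → 1 ≤ f (suc i) → ⊥
  tight f0 i fi = <⇒≱ (s≤s (s≤s z≤n)) (≤-trans (+-mono-≤ f0 (≤-trans fi (≤∑-fins (f ∘ suc) i))) h)
  go : ∀ i j → 1 ≤ f i → 1 ≤ f j → i ≡ j
  go zero    zero    _  _  = refl
  go zero    (suc j) fi fj = ⊥-elim (tight fi j fj)
  go (suc i) zero    fi fj = ⊥-elim (tight fj i fi)
  go (suc i) (suc j) fi fj = cong suc (∑≤1-unique (f ∘ suc) (≤-trans (m≤n+m _ (f zero)) h) i j fi fj)

-- Random restrictions of the variables.

-- A variable becomes 0 or 1, or stays free as a `y`, governed by the row assignment, or as a `z`,
-- governed by the column assignment.
data Status : Set where
  S0 S1 SY SZ : Status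

isY isZ alive : Status → Bool
isY SY = true
isY _  = false
isZ SZ = true
isZ _  = false
alive s = isY s ∨ isZ s

swapYZ : Status → Status
swapYZ SY = SZ
swapYZ SZ = SY
swapYZ s  = s

same : Bool → Bool → Bool
same true  b = b
same false b = not b

same-refl : ∀ b → same b b ≡ true
same-refl true  = refl
same-refl false = refl

same⇒≡ : ∀ a b → same a b ≡ true → a ≡ b
same⇒≡ true  true  _ = refl
same⇒≡ false false _ = refl

module Restrictions (m : ℕ) where

  -- A variable of P^(0) is x_{i,j} with i = 2 half + group; one of P^(d+1) is a copy index, a side and a variable of P^(d).
  Leaf : ℕ → Set
  Leaf zero    = Bool × Bool × Bool
  Leaf (suc d) = Fin m × Bool × Leaf d

  leaves : ∀ d → List (Leaf d)
  leaves zero    = pairs bools (pairs bools bools)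
  leaves (suc d) = pairs (fins m) (pairs bools (leaves d))

  -- Restrictions of the variables under which P^(d) becomes 1, respectively the variable y.
  oneSt : ∀ d → Leaf d → Status
  oneSt zero    (h , g , j) = if g then S0 else S1
  oneSt (suc d) (i , c , l) = if c then oneSt d l else S0

  leafSt : ∀ d → Status → Leaf d → Leaf d → Status
  leafSt zero    s (h , g , j) (h′ , g′ , j′) =
    if same h h′ then (if same g g′ then (if same j j′ then s else S1) else S0) else (if g′ then S0 else S1)
  leafSt (suc d) s (i , c , y) (i′ , c′ , l) =
    if i == i′ then (if same c c′ then leafSt d s y l else S0) else (if c′ then oneSt d l else S0)

  oneSt-fixed : ∀ d l → alive (oneSt d l) ≡ false
  oneSt-fixed zero    (h , true  , j) = refl
  oneSt-fixed zero    (h , false , j) = refl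
  oneSt-fixed (suc d) (i , true  , l) = oneSt-fixed d l
  oneSt-fixed (suc d) (i , false , l) = refl

  leafSt-self : ∀ d s y → leafSt d s y y ≡ s
  leafSt-self zero    s (h , g , j) rewrite same-refl h | same-refl g | same-refl j = refl
  leafSt-self (suc d) s (i , c , y) rewrite ==-refl i | same-refl c = leafSt-self d s y

  leafSt-alive : ∀ d s y l → alive (leafSt d s y l) ≡ true → l ≡ y
  leafSt-alive zero s (h , g , j) (h′ , g′ , j′) a with same h h′ in eh
  ... | false with trans (sym a) (oneSt-fixed 0 (h′ , g′ , j′))
  ...   | ()
  leafSt-alive zero s (h , g , j) (h′ , g′ , j′) a | true with same g g′ in eg | same j j′ in ej
  ...   | true | true = sym (cong₂ _,_ (same⇒≡ h h′ eh) (cong₂ _,_ (same⇒≡ g g′ eg) (same⇒≡ j j′ ej)))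
  leafSt-alive (suc d) s (i , c , y) (i′ , c′ , l) a with i == i′ in ei
  ... | false with trans (sym a) (oneSt-fixed (suc d) (i′ , c′ , l))
  ...   | ()
  leafSt-alive (suc d) s (i , c , y) (i′ , c′ , l) a | true with same c c′ in ec
  ...   | true = sym (cong₂ _,_ (==⇒≡ i i′ ei) (cong₂ _,_ (same⇒≡ c c′ ec) (sym (leafSt-alive d s y l a))))

  data Blk : Set where
    fixed quad : Blk
    pair      : Leaf 0 → Leaf 0 → Blk

  blks : List Blk
  blks = fixed ∷ quad ∷ map (uncurry pair) (pairs (leaves 0) (leaves 0))

  -- P^(0) has the form (x x' + x'' x''')(...): in each monomial the second variable becomes 1 and
  -- the first one stays free, which gives a product of two terms `y + z` inside a single copy.
  quadSt : Leaf 0 → Status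
  quadSt (h , g , j) = if j then S1 else if g then SZ else SY

  blkSt : Blk → Bool → Leaf 0 → Status
  blkSt fixed       c l = if c then oneSt 0 l else S0
  blkSt quad       c l = if c then quadSt l else S0
  blkSt (pair y z) c l = if c then leafSt 0 SY y l else leafSt 0 SZ z l

  -- Choices for N blocks, a block of level d being a pair of copies of X^(d). A split block becomes y + z or the
  -- constant 1 according to its coin; in a left or right block one copy vanishes and the other one is a product of
  -- m blocks of the next lower level.
  Seeds : ℕ → ℕ → Set
  Seeds zero    N = Vec Blk N
  Seeds (suc d) N = Vec (Top (Leaf (suc d))) N × Seeds d (N * m)

  seeds : ∀ d N → List (Seeds d N)
  seeds zero    N = vecs blks N
  seeds (suc d) N = pairs (vecs (tops (leaves (suc d))) N) (seeds d (N * m))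

  Position : ℕ → ℕ → Set
  Position N d = Status ⊎ (Fin N × Bool × Leaf d)

  -- One level of restriction: a leaf is settled at once, or it becomes a leaf of block
  -- `combine i i′`, one of the `m` blocks inside the surviving copy.
  lowPos : ∀ {N} d → Top (Leaf (suc d)) → Fin N → Bool → Leaf (suc d) → Position (N * m) d
  lowPos d (split , true  , y , z) i true  l = inj₁ (leafSt (suc d) SY y l)
  lowPos d (split , true  , y , z) i false l = inj₁ (leafSt (suc d) SZ z l)
  lowPos d (split , false , y , z) i true  l = inj₁ (oneSt (suc d) l)
  lowPos d (split , false , y , z) i false l = inj₁ S0
  lowPos d (left  , _) i true  (i′ , c , l) = inj₂ (combine i i′ , c , l)
  lowPos d (left  , _) i false _            = inj₁ S0
  lowPos d (right , _) i true  _            = inj₁ S0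
  lowPos d (right , _) i false (i′ , c , l) = inj₂ (combine i i′ , c , l)

  st : ∀ d {N} → Seeds d N → Fin N → Bool → Leaf d → Status
  at : ∀ d {N} → Seeds d N → Position N d → Status
  st zero    ω       i c l = blkSt (lookup ω i) c l
  st (suc d) (τ , ω) i c l = at d ω (lowPos d (lookup τ i) i c l)
  at d ω (inj₁ s)           = s
  at d ω (inj₂ (i , c , l)) = st d ω i c l

  -- The variable with which an unfixed variable is added in the restriction of P^(d).
  partner : ∀ d {N} → Seeds d N → Fin N → Bool × Leaf d → Bool × Leaf d
  partner zero ω i (c , l) with lookup ω i
  ... | fixed     = c , l
  ... | quad     = c , (proj₁ l , not (proj₁ (proj₂ l)) , proj₂ (proj₂ l))
  ... | pair y z = not c , (if c then z else y)
  partner (suc d) (τ , ω) i (c , l) with lookup τ i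
  ... | split , true  , y , z = not c , (if c then z else y)
  ... | split , false , y , z = c , l
  ... | left  , _ = c , (proj₁ l , partner d ω (combine i (proj₁ l)) (proj₂ l))
  ... | right , _ = c , (proj₁ l , partner d ω (combine i (proj₁ l)) (proj₂ l))

  -- On free variables `partner` is an involution that exchanges `y` and `z`. This is what makes the
  -- restriction of P^(d) a product of terms `y + z` over disjoint pairs.
  record Paired {N} d (ω : Seeds d N) (i : Fin N) (c : Bool) (l : Leaf d) : Set where
    constructor paired
    field
      swaps : let (c′ , l′) = partner d ω i (c , l) in st d ω i c′ l′ ≡ swapYZ (st d ω i c l)
      invol : partner d ω i (partner d ω i (c , l)) ≡ (c , l)

  pair-partner : ∀ d {N} (ω : Seeds d N) i c l → alive (st d ω i c l) ≡ true → Paired d ω i c l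
  pair-partner zero ω i c l a = paired (sw c l a) (iv c l a)
    where
    sw : ∀ c l → alive (st zero ω i c l) ≡ true → let (c′ , l′) = partner zero ω i (c , l) in st zero ω i c′ l′ ≡ swapYZ (st zero ω i c l)
    sw c l a with lookup ω i
    sw true  l a | fixed with trans (sym a) (oneSt-fixed 0 l)
    ... | ()
    sw true (h , false , false) a | quad = refl
    sw true (h , true  , false) a | quad = refl
    sw true  l a | pair y z with leafSt-alive 0 SY y l a
    ... | refl = trans (leafSt-self 0 SZ z) (cong swapYZ (sym (leafSt-self 0 SY y)))
    sw false l a | pair y z with leafSt-alive 0 SZ z l a
    ... | refl = trans (leafSt-self 0 SY y) (cong swapYZ (sym (leafSt-self 0 SZ z)))
    iv : ∀ c l → alive (st zero ω i c l) ≡ true → partner zero ω i (partner zero ω i (c , l)) ≡ (c , l)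
    iv c l a with lookup ω i
    iv c l a | fixed = refl
    iv c (h , true  , j) a | quad = refl
    iv c (h , false , j) a | quad = refl
    iv true  l a | pair y z = cong (true ,_) (sym (leafSt-alive 0 SY y l a))
    iv false l a | pair y z = cong (false ,_) (sym (leafSt-alive 0 SZ z l a))
  pair-partner (suc d) (τ , ω) i c l a = paired (sw c l a) (iv c l a)
    where
    sw : ∀ c l → alive (st (suc d) (τ , ω) i c l) ≡ true →
         let (c′ , l′) = partner (suc d) (τ , ω) i (c , l) in st (suc d) (τ , ω) i c′ l′ ≡ swapYZ (st (suc d) (τ , ω) i c l)
    sw c l a with lookup τ i
    sw true  l a | split , true , y , z with leafSt-alive (suc d) SY y l a
    ... | refl = trans (leafSt-self (suc d) SZ z) (cong swapYZ (sym (leafSt-self (suc d) SY y)))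
    sw false l a | split , true , y , z with leafSt-alive (suc d) SZ z l a
    ... | refl = trans (leafSt-self (suc d) SY y) (cong swapYZ (sym (leafSt-self (suc d) SZ z)))
    sw true  l a | split , false , y , z with trans (sym a) (oneSt-fixed (suc d) l)
    ... | ()
    sw true  (i′ , c , l) a | left  , _ = Paired.swaps (pair-partner d ω (combine i i′) c l a)
    sw false (i′ , c , l) a | right , _ = Paired.swaps (pair-partner d ω (combine i i′) c l a)
    iv : ∀ c l → alive (st (suc d) (τ , ω) i c l) ≡ true → partner (suc d) (τ , ω) i (partner (suc d) (τ , ω) i (c , l)) ≡ (c , l)
    iv c l a with lookup τ i
    iv true  l a | split , true , y , z = cong (true ,_) (sym (leafSt-alive (suc d) SY y l a))
    iv false l a | split , true , y , z = cong (false ,_) (sym (leafSt-alive (suc d) SZ z l a))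
    iv c     l a | split , false , y , z = refl
    iv true  (i′ , c , l) a | left  , _ = cong (λ p → true , i′ , p) (Paired.invol (pair-partner d ω (combine i i′) c l a))
    iv false (i′ , c , l) a | right , _ = cong (λ p → false , i′ , p) (Paired.invol (pair-partner d ω (combine i i′) c l a))

  -- N disjoint blocks of level d inside n variables, possibly with some of the blocks or leaves missing; the other
  -- variables are fixed.
  record Family (n N d : ℕ) : Set where
    field
      pos     : Fin n → Position N d
      inv     : Fin N → Bool → Leaf d → Maybe (Fin n)
      inv-pos : ∀ {i c l x} → inv i c l ≡ just x → pos x ≡ inj₂ (i , c , l)
      pos-inv : ∀ {i c l x} → pos x ≡ inj₂ (i , c , l) → inv i c l ≡ just x

    status : Seeds d N → Fin n → Status
    status ω x = at d ω (pos x)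

  open Family

  module _ {n N d} (fam : Family n N (suc d)) (τ : Vec (Top (Leaf (suc d))) N) where

    lowAt : Position N (suc d) → Position (N * m) d
    lowAt (inj₁ s)           = inj₁ s
    lowAt (inj₂ (i , c , l)) = lowPos d (lookup τ i) i c l

    -- The next level always has `N * m` block indices, independently of `τ`; those below a `split`
    -- block carry no variable. This is why the inverse takes values in `Maybe`.
    lowInv : Fin N → Fin m → Bool → Leaf d → Maybe (Fin n)
    lowInv i i′ c l with lookup τ i
    ... | split , _ = nothing
    ... | left  , _ = inv fam i true (i′ , c , l)
    ... | right , _ = inv fam i false (i′ , c , l)

    lowInv-pos : ∀ i i′ c l x → lowInv i i′ c l ≡ just x → lowAt (pos fam x) ≡ inj₂ (combine i i′ , c , l)
    lowInv-pos i i′ c l x e with lookup τ i in eq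
    ... | left  , _ rewrite inv-pos fam e | eq = refl
    ... | right , _ rewrite inv-pos fam e | eq = refl

    pos-lowInv : ∀ i i′ c l x → lowAt (pos fam x) ≡ inj₂ (combine i i′ , c , l) → lowInv i i′ c l ≡ just x
    pos-lowInv i i′ c l x e with pos fam x in px
    ... | inj₂ (j , c₀ , l₀) with lookup τ j in eq
    pos-lowInv i i′ c l x () | inj₂ (j , true  , l₀) | split , true  , _
    pos-lowInv i i′ c l x () | inj₂ (j , false , l₀) | split , true  , _
    pos-lowInv i i′ c l x () | inj₂ (j , true  , l₀) | split , false , _
    pos-lowInv i i′ c l x () | inj₂ (j , false , l₀) | split , false , _
    pos-lowInv i i′ c l x e | inj₂ (j , true  , (j′ , c₁ , l₁)) | left , _
      with Finₚ.combine-injective j j′ i i′ (cong proj₁ (inj₂-injective e)) | cong proj₂ (inj₂-injective e)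
    ...   | refl , refl | refl rewrite eq = pos-inv fam px
    pos-lowInv i i′ c l x e | inj₂ (j , false , (j′ , c₁ , l₁)) | right , _
      with Finₚ.combine-injective j j′ i i′ (cong proj₁ (inj₂-injective e)) | cong proj₂ (inj₂-injective e)
    ...   | refl , refl | refl rewrite eq = pos-inv fam px

    lower : Family n (N * m) d
    lower = record
      { pos = λ x → lowAt (pos fam x)
      ; inv = λ k c l → let (i , i′) = remQuot m k in lowInv i i′ c l
      ; inv-pos = λ {k} {c} {l} {x} e → trans (lowInv-pos _ _ c l x e) (cong (λ k → inj₂ (k , c , l)) (Finₚ.combine-remQuot {N} m k))
      ; pos-inv = λ {k} {c} {l} {x} e → pos-lowInv _ _ c l x (trans e (cong (λ k → inj₂ (k , c , l)) (sym (Finₚ.combine-remQuot {N} m k)))) }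

    lower-status : ∀ ω x → status lower ω x ≡ status fam (τ , ω) x
    lower-status ω x with pos fam x
    ... | inj₁ s           = refl
    ... | inj₂ (i , c , l) = refl

-- Parities, and products of squared ranks.

not≢ : ∀ {a b} → a ≢ b → not b ≡ a
not≢ {true}  {true}  ne = ⊥-elim (ne refl)
not≢ {true}  {false} ne = refl
not≢ {false} {true}  ne = refl
not≢ {false} {false} ne = ⊥-elim (ne refl)

≢not : ∀ a → a ≢ not a
≢not true  ()
≢not false ()

isY⇒≡ : ∀ {s} → isY s ≡ true → s ≡ SY
isY⇒≡ {SY} _ = refl

isZ⇒≡ : ∀ {s} → isZ s ≡ true → s ≡ SZ
isZ⇒≡ {SZ} _ = refl

parity : ∀ {n} → (Fin n → Bool) → Bool
parity {zero}  U = false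
parity {suc n} U = U zero xor parity (U ∘ suc)

parity-cong : ∀ {n} (U W : Fin n → Bool) → (∀ x → U x ≡ W x) → parity U ≡ parity W
parity-cong {zero}  U W h = refl
parity-cong {suc n} U W h = cong₂ _xor_ (h zero) (parity-cong (U ∘ suc) (W ∘ suc) (h ∘ suc))

parity-flip : ∀ {n} (U W : Fin n → Bool) x → U x ≡ not (W x) → (∀ y → y ≢ x → U y ≡ W y) → parity U ≡ not (parity W)
parity-flip U W zero ux h = trans (cong₂ _xor_ ux (parity-cong (U ∘ suc) (W ∘ suc) (λ y → h (suc y) λ ()))) (e (W zero) _)
  where
  e : ∀ a b → not a xor b ≡ not (a xor b)
  e true  true  = refl
  e true  false = refl
  e false b     = refl
parity-flip U W (suc x) ux h = trans (cong₂ _xor_ (h zero λ ()) (parity-flip (U ∘ suc) (W ∘ suc) x ux (λ y ne → h (suc y) (ne ∘ Finₚ.suc-injective)))) (e (W zero) _)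
  where
  e : ∀ a b → a xor not b ≡ not (a xor b)
  e true  b = refl
  e false b = refl

odd : ℕ → Bool
odd zero    = false
odd (suc k) = not (odd k)

odd-+ : ∀ a b → odd (a + b) ≡ odd a xor odd b
odd-+ zero    b = refl
odd-+ (suc a) b rewrite odd-+ a b with odd a
... | true  = Boolₚ.not-involutive (odd b)
... | false = refl

odd-double : ∀ a → odd (a + a) ≡ false
odd-double a rewrite odd-+ a a with odd a
... | true  = refl
... | false = refl

parity-odd : ∀ {n} (U : Fin n → Bool) → parity U ≡ odd (count U)
parity-odd {zero}  U = refl
parity-odd {suc n} U rewrite ∑-fins n (⟦_⟧ ∘ U) | parity-odd (U ∘ suc) with U zero
... | true  = refl
... | false = refl

∑≤1 : ∀ {n} (P : Fin n → Bool) → (∀ i j → P i ≡ true → P j ≡ true → i ≡ j) → ∑ (fins n) (⟦_⟧ ∘ P) ≤ 1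
∑≤1 {zero}  P h = z≤n
∑≤1 {suc n} P h rewrite ∑-fins n (⟦_⟧ ∘ P) with P zero in P0
... | false = ∑≤1 (P ∘ suc) (λ i j p q → Finₚ.suc-injective (h (suc i) (suc j) p q))
... | true  = s≤s (≤-reflexive (trans (∑-cong (fins n) (λ j → cong ⟦_⟧ (none j))) (∑-zero (fins n))))
  where
  none : ∀ j → P (suc j) ≡ false
  none j with P (suc j) in Pj
  ... | false = refl
  ... | true with h zero (suc j) P0 Pj
  ...   | ()

count-cong : ∀ {n} {U W : Fin n → Bool} → (∀ x → U x ≡ W x) → count U ≡ count W
count-cong {n} h = ∑-cong (fins n) (cong ⟦_⟧ ∘ h)

three≤count : ∀ {n} (U : Fin n → Bool) x y z → x ≢ y → x ≢ z → y ≢ z → U x ≡ true → U y ≡ true → U z ≡ true → 3 ≤ count U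
three≤count {n} U x y z x≢y x≢z y≢z ux uy uz = begin
  1 + (1 + 1)                                              ≤⟨ +-mono-≤ (one x) (+-mono-≤ (one y) (one z)) ⟩
  ∑ (fins n) (δ x) + (∑ (fins n) (δ y) + ∑ (fins n) (δ z)) ≡⟨ cong (∑ (fins n) (δ x) +_) (∑-+ (fins n) (δ y) (δ z)) ⟨
  ∑ (fins n) (δ x) + ∑ (fins n) (λ w → δ y w + δ z w)      ≡⟨ ∑-+ (fins n) (δ x) (λ w → δ y w + δ z w) ⟨
  ∑ (fins n) (λ w → δ x w + (δ y w + δ z w))               ≤⟨ ∑-mono (fins n) pt ⟩
  count U                                                  ∎
  where
  open ≤-Reasoning
  δ : Fin n → Fin n → ℕ
  δ x w = ⟦ x == w ⟧
  one : ∀ x → 1 ≤ ∑ (fins n) (δ x)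
  one x = ≤-trans (≤-reflexive (sym (cong ⟦_⟧ (==-refl x)))) (≤∑-fins (δ x) x)
  pt : ∀ w → δ x w + (δ y w + δ z w) ≤ ⟦ U w ⟧
  pt w with x Fin.≟ w | y Fin.≟ w | z Fin.≟ w
  ... | yes refl | yes refl | _        = ⊥-elim (x≢y refl)
  ... | yes refl | no _     | yes refl = ⊥-elim (x≢z refl)
  ... | no _     | yes refl | yes refl = ⊥-elim (y≢z refl)
  ... | yes refl | no _     | no _     rewrite ux = ≤-refl
  ... | no _     | yes refl | no _     rewrite uy = ≤-refl
  ... | no _     | no _     | yes refl rewrite uz = ≤-refl
  ... | no _     | no _     | no _     = z≤n

-- (1 - 1/G)^(kG) ≤ 2^(-k).
halving : ∀ g .{{_ : NonZero g}} k S Z → S * suc g ^ (k * suc g) ≤ Z * g ^ (k * suc g) → S * 2 ^ k ≤ Z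
halving g k S Z h = *-cancelʳ-≤ _ _ (g ^ (k * suc g)) {{m^n≢0 g (k * suc g)}} (begin
  S * 2 ^ k * g ^ (k * G)         ≡⟨ *-assoc S (2 ^ k) _ ⟩
  S * (2 ^ k * g ^ (k * G))       ≡⟨ cong (λ z → S * (2 ^ k * z)) (trans (cong (g ^_) (*-comm k G)) (sym (^-*-assoc g G k))) ⟩
  S * (2 ^ k * (g ^ G) ^ k)       ≡⟨ cong (S *_) (^-distribʳ-* 2 (g ^ G) k) ⟨
  S * (2 * g ^ G) ^ k             ≤⟨ *-monoʳ-≤ S (^-monoˡ-≤ k (2*pred^n≤n^n g)) ⟩
  S * (G ^ G) ^ k                 ≡⟨ cong (S *_) (trans (^-*-assoc G G k) (cong (G ^_) (*-comm G k))) ⟩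
  S * G ^ (k * G)                 ≤⟨ h ⟩
  Z * g ^ (k * G)                 ∎)
  where
  open ≤-Reasoning
  G = suc g

-- Ranks multiply over the parts, so the exponents `e j` by which single factors miss their trivial
-- bounds add up.
∏² : ∀ R (r e L : Fin R → ℕ) → (∀ j → r j * r j * 2 ^ e j ≤ 2 ^ L j) →
     ∏ R r * ∏ R r * 2 ^ ∑ (fins R) e ≤ 2 ^ ∑ (fins R) L
∏² zero    r e L h = ≤-refl
∏² (suc R) r e L h rewrite ∑-fins R e | ∑-fins R L = begin
  (a * p) * (a * p) * 2 ^ (x + y)       ≡⟨ cong ((a * p) * (a * p) *_) (^-distribˡ-+-* 2 x y) ⟩
  (a * p) * (a * p) * (2 ^ x * 2 ^ y)   ≡⟨ l a p (2 ^ x) (2 ^ y) ⟩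
  (a * a * 2 ^ x) * (p * p * 2 ^ y)     ≤⟨ *-mono-≤ (h zero) (∏² R (r ∘ suc) (e ∘ suc) (L ∘ suc) (h ∘ suc)) ⟩
  2 ^ L zero * 2 ^ ∑ (fins R) (L ∘ suc) ≡⟨ ^-distribˡ-+-* 2 (L zero) _ ⟨
  2 ^ (L zero + ∑ (fins R) (L ∘ suc))   ∎
  where
  open ≤-Reasoning
  a = r zero
  p = ∏ R (r ∘ suc)
  x = e zero
  y = ∑ (fins R) (e ∘ suc)
  l : ∀ a p x y → (a * p) * (a * p) * (x * y) ≡ (a * a * x) * (p * p * y)
  l = solve-∀

-- When the other factors meet only their trivial bounds, the product still inherits the whole
-- deficiency of factor `j`.
∏²-one : ∀ R (r L : Fin R → ℕ) j → (∀ j′ → j′ ≢ j → r j′ * r j′ ≤ 2 ^ L j′) →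
         ∏ R r * ∏ R r * 2 ^ L j ≤ r j * r j * 2 ^ ∑ (fins R) L
∏²-one (suc R) r L zero h rewrite ∑-fins R L = begin
  (a * p) * (a * p) * 2 ^ L zero                      ≡⟨ l a p (2 ^ L zero) ⟩
  a * a * (2 ^ L zero * (p * p * 1))                  ≤⟨ *-monoʳ-≤ (a * a) (*-monoʳ-≤ (2 ^ L zero) rest) ⟩
  a * a * (2 ^ L zero * 2 ^ ∑ (fins R) (L ∘ suc))     ≡⟨ cong (a * a *_) (^-distribˡ-+-* 2 (L zero) _) ⟨
  a * a * 2 ^ (L zero + ∑ (fins R) (L ∘ suc))         ∎
  where
  open ≤-Reasoning
  a = r zero
  p = ∏ R (r ∘ suc)
  l : ∀ a p x → (a * p) * (a * p) * x ≡ a * a * (x * (p * p * 1))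
  l = solve-∀
  rest : p * p * 1 ≤ 2 ^ ∑ (fins R) (L ∘ suc)
  rest = subst (λ z → p * p * 2 ^ z ≤ 2 ^ ∑ (fins R) (L ∘ suc)) (∑-zero (fins R))
    (∏² R (r ∘ suc) (λ _ → 0) (L ∘ suc) (λ j → ≤-trans (≤-reflexive (*-identityʳ _)) (h (suc j) λ ())))
∏²-one (suc R) r L (suc j) h rewrite ∑-fins R L = begin
  (a * p) * (a * p) * 2 ^ L (suc j)                               ≡⟨ l a p (2 ^ L (suc j)) ⟩
  a * a * (p * p * 2 ^ L (suc j))                                 ≤⟨ *-mono-≤ (h zero λ ()) (∏²-one R (r ∘ suc) (L ∘ suc) j (λ j′ ne → h (suc j′) (ne ∘ Finₚ.suc-injective))) ⟩
  2 ^ L zero * (r (suc j) * r (suc j) * 2 ^ ∑ (fins R) (L ∘ suc)) ≡⟨ l′ (2 ^ L zero) (r (suc j) * r (suc j)) _ ⟩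
  r (suc j) * r (suc j) * (2 ^ L zero * 2 ^ ∑ (fins R) (L ∘ suc)) ≡⟨ cong (r (suc j) * r (suc j) *_) (^-distribˡ-+-* 2 (L zero) _) ⟨
  r (suc j) * r (suc j) * 2 ^ (L zero + ∑ (fins R) (L ∘ suc))     ∎
  where
  open ≤-Reasoning
  a = r zero
  p = ∏ R (r ∘ suc)
  l : ∀ a p x → (a * p) * (a * p) * x ≡ a * a * (p * p * x)
  l = solve-∀
  l′ : ∀ x y z → x * (y * z) ≡ y * (x * z)
  l′ = solve-∀

-- Large parts keep much of their mass in the recursion.

-- The share of a block that is passed on to the next level: nothing if it is `split`, otherwise the
-- copy that does not vanish.
side-of : Kind → (Bool → ℕ) → ℕ
side-of split a = 0
side-of left  a = a true
side-of right a = a false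

∑-side-of : {L : Set} (ls : List L) (a : Bool → ℕ) →
  ∑ (tops ls) (λ t → side-of (proj₁ t) a) ≡ 2 * (∣ ls ∣ * ∣ ls ∣) * (a true + a false)
∑-side-of ls a = trans (∑-tops ls (λ t → side-of (proj₁ t) a)) (trans
  (∑-cong kinds (λ κ → trans (∑-cong ls (λ _ → ∑-const ls (side-of κ a + side-of κ a))) (∑-const ls (∣ ls ∣ * (side-of κ a + side-of κ a)))))
  (e ∣ ls ∣ (a true) (a false)))
  where
  e : ∀ n x y → n * (n * 0) + (n * (n * (x + x)) + (n * (n * (y + y)) + 0)) ≡ 2 * (n * n) * (x + y)
  e = solve-∀

-- Each copy survives with probability 1/3, so `lower-tail` applies with `q` equal to the number
-- `2 * (∣ ls ∣ * ∣ ls ∣)` of choices of one kind.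
kinds-lower-tail : {L : Set} (ls : List L) .{{_ : NonZero ∣ ls ∣}} → ∀ N T .{{_ : NonZero T}} (σ : Fin N → Bool → ℕ) →
  (∀ i s → σ i s ≤ T) → ∀ k → suc k * (6 * T) ≤ ∑ (fins N) (λ i → σ i true + σ i false) →
  (bad : Vec (Top L) N → Bool) → (∀ τ → bad τ ≡ true → ∑ (fins N) (λ i → side-of (proj₁ (lookup τ i)) (σ i)) < T) →
  ∑ (vecs (tops ls) N) (⟦_⟧ ∘ bad) * 2 ^ k ≤ ∣ tops ls ∣ ^ N
kinds-lower-tail ls N T σ σ≤T k big bad isbad = lower-tail (tops ls) q {{nzq}} six N T
    (λ i t → side-of (proj₁ t) (σ i)) (λ i → σ i true + σ i false) (λ i t → cap (proj₁ t) i) (λ i → ∑-side-of ls (σ i)) k big bad isbad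
  where
  q = 2 * (∣ ls ∣ * ∣ ls ∣)
  nzq : NonZero q
  nzq = m*n≢0 2 (∣ ls ∣ * ∣ ls ∣) {{_}} {{m*n≢0 ∣ ls ∣ ∣ ls ∣}}
  six : ∣ tops ls ∣ ≡ q * 3
  six = trans (∣tops∣ ls) (e (∣ ls ∣ * ∣ ls ∣))
    where e : ∀ x → 6 * x ≡ 2 * x * 3
          e = solve-∀
  cap : ∀ κ i → side-of κ (σ i) ≤ T
  cap split i = z≤n
  cap left  i = σ≤T i true
  cap right i = σ≤T i false

-- Either one part has mass 6(k+1)T in cells truncated at T, or at least 6(k+1) cells contain a mass T of some part.
large-parts : {L : Set} (ls : List L) .{{_ : NonZero ∣ ls ∣}} → ∀ N R T .{{_ : NonZero T}} k
  (a : Fin N → Bool → Fin R → ℕ) (large : Fin R → Bool) →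
  let n = ∣ ls ∣
      mass = λ j → ∑ (fins N) (λ i → a i true j + a i false j) in
  (∀ i s → ∑ (fins R) (a i s) ≤ n) →
  (∀ j → large j ≡ true → n ≤ 2 * mass j) →
  12 * suc k * n ≤ ∑ (fins R) (λ j → ⟦ large j ⟧ * mass j) →
  24 * suc k * T ≤ n →
  (bad : Vec (Top L) N → Bool) →
  (∀ τ → bad τ ≡ true → ∀ j → ∑ (fins N) (λ i → side-of (proj₁ (lookup τ i)) (λ s → a i s j)) < T) →
  ∑ (vecs (tops ls) N) (⟦_⟧ ∘ bad) * 2 ^ k ≤ ∣ tops ls ∣ ^ N
large-parts {L} ls N R T@(suc _) k a large row big total T≤ bad isbad with Finₚ.any? (λ j → suc k * (6 * T) ≤? ∑ (fins N) (λ i → a i true j ⊓ T + a i false j ⊓ T))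
... | yes (j , h) = kinds-lower-tail ls N T (λ i s → a i s j ⊓ T) (λ i s → m⊓n≤n (a i s j) T) k h bad
      (λ τ b → ≤-<-trans (∑-mono (fins N) (λ i → trunc (proj₁ (lookup τ i)) i)) (isbad τ b j))
  where
  trunc : ∀ κ i → side-of κ (λ s → a i s j ⊓ T) ≤ side-of κ (λ s → a i s j)
  trunc split i = z≤n
  trunc left  i = m⊓n≤m _ T
  trunc right i = m⊓n≤m _ T
... | no none = kinds-lower-tail ls N T h cap k enough bad zero-sum
  where
  open ≤-Reasoning
  n = ∣ ls ∣
  heavy? : ∀ i s → Dec (∃[ j ] T ≤ a i s j)
  heavy? i s = Finₚ.any? (λ j → T ≤? a i s j)
  heavy : Fin N → Bool → Bool
  heavy i s = does (heavy? i s)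
  -- A copy that contains a mass `T` of a single part scores `T`, and any other copy scores 0: one
  -- surviving heavy copy already makes `τ` good.
  h : Fin N → Bool → ℕ
  h i s = ⟦ heavy i s ⟧ * T
  cap : ∀ i s → h i s ≤ T
  cap i s = ≤-trans (*-monoˡ-≤ T (⟦⟧-≤1 (heavy i s))) (≤-reflexive (+-identityʳ T))
  zero-sum : ∀ τ → bad τ ≡ true → ∑ (fins N) (λ i → side-of (proj₁ (lookup τ i)) (h i)) < T
  zero-sum τ b = s≤s (≤-trans (≤-reflexive (trans (∑-cong (fins N) none-heavy) (∑-zero (fins N)))) z≤n)
    where
    cell : ∀ i s → (∀ j → a i s j < T) → h i s ≡ 0
    cell i s lt rewrite dec-false (heavy? i s) (λ { (j , ge) → <⇒≱ (lt j) ge }) = refl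
    via : ∀ i κ → proj₁ (lookup τ i) ≡ κ → ∀ j → side-of κ (λ s → a i s j) < T
    via i κ refl j = ≤-<-trans (≤∑-fins (λ i → side-of (proj₁ (lookup τ i)) (λ s → a i s j)) i) (isbad τ b j)
    none-heavy : ∀ i → side-of (proj₁ (lookup τ i)) (h i) ≡ 0
    none-heavy i with proj₁ (lookup τ i) in e
    ... | split = refl
    ... | left  = cell i true (via i left e)
    ... | right = cell i false (via i right e)
  mass truncated heavymass : Fin R → ℕ
  mass j = ∑ (fins N) (λ i → a i true j + a i false j)
  truncated j = ∑ (fins N) (λ i → a i true j ⊓ T + a i false j ⊓ T)
  hm : Fin N → Bool → Fin R → ℕ
  hm i s j = ⟦ T ≤ᵇ a i s j ⟧ * a i s j
  heavymass j = ∑ (fins N) (λ i → hm i true j + hm i false j)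
  cell-split : ∀ x → x ≤ x ⊓ T + ⟦ T ≤ᵇ x ⟧ * x
  cell-split x with T ≤ᵇ x in e
  ... | true  = ≤-trans (≤-reflexive (sym (+-identityʳ x))) (m≤n+m _ (x ⊓ T))
  ... | false = ≤-trans (≤-reflexive (sym (m≤n⇒m⊓n≡m (<⇒≤ (≰⇒> λ T≤x → subst Data.Bool.T e (≤⇒≤ᵇ T≤x)))))) (m≤m+n _ 0)
  mass≤ : ∀ j → mass j ≤ truncated j + heavymass j
  mass≤ j = ≤-trans (∑-mono (fins N) (λ i → ≤-trans (+-mono-≤ (cell-split (a i true j)) (cell-split (a i false j)))
      (≤-reflexive (l (a i true j ⊓ T) (hm i true j) (a i false j ⊓ T) (hm i false j)))))
    (≤-reflexive (∑-+ (fins N) (λ i → a i true j ⊓ T + a i false j ⊓ T) (λ i → hm i true j + hm i false j)))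
    where l : ∀ p q r s → p + q + (r + s) ≡ p + r + (q + s)
          l = solve-∀
  -- A large part has truncated mass below `6(k+1)T ≤ n/4`, at most half of its mass, so the other
  -- half lies in heavy cells.
  large-heavy : ∀ j → ⟦ large j ⟧ * mass j ≤ 2 * heavymass j
  large-heavy j with large j in lj
  ... | false = z≤n
  ... | true  = +-cancelʳ-≤ (mass j) _ _ (begin
    1 * mass j + mass j                          ≤⟨ +-mono-≤ (≤-reflexive (+-identityʳ (mass j))) ≤-refl ⟩
    mass j + mass j                              ≡⟨ l₁ (mass j) ⟩
    2 * mass j                                   ≤⟨ *-monoʳ-≤ 2 (mass≤ j) ⟩
    2 * (truncated j + heavymass j)              ≡⟨ l₂ (truncated j) (heavymass j) ⟩
    2 * heavymass j + 2 * truncated j            ≤⟨ +-monoʳ-≤ (2 * heavymass j) (*-cancelˡ-≤ 2 (begin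
      2 * (2 * truncated j)                          ≡⟨ l₃ (truncated j) ⟩
      4 * truncated j                                ≤⟨ *-monoʳ-≤ 4 (<⇒≤ (≰⇒> (λ ge → none (j , ge)))) ⟩
      4 * (suc k * (6 * T))                          ≡⟨ l₄ (suc k) T ⟩
      24 * suc k * T                                 ≤⟨ T≤ ⟩
      n                                              ≤⟨ big j lj ⟩
      2 * mass j                                     ∎)) ⟩
    2 * heavymass j + mass j                     ∎)
    where
    l₁ : ∀ x → x + x ≡ 2 * x
    l₁ = solve-∀
    l₂ : ∀ x y → 2 * (x + y) ≡ 2 * y + 2 * x
    l₂ = solve-∀
    l₃ : ∀ x → 2 * (2 * x) ≡ 4 * x
    l₃ = solve-∀
    l₄ : ∀ k T → 4 * (k * (6 * T)) ≡ 24 * k * T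
    l₄ = solve-∀
  H = ∑ (fins N) (λ i → ⟦ heavy i true ⟧ + ⟦ heavy i false ⟧)
  cell-heavy : ∀ i s → ∑ (fins R) (hm i s) ≤ ⟦ heavy i s ⟧ * n
  cell-heavy i s with heavy? i s
  ... | yes _ = ≤-trans (∑-mono (fins R) (λ j → ≤-trans (*-monoˡ-≤ (a i s j) (⟦⟧-≤1 (T ≤ᵇ a i s j))) (≤-reflexive (+-identityʳ _)))) (≤-trans (row i s) (≤-reflexive (sym (+-identityʳ n))))
  ... | no ¬h = ≤-reflexive (trans (∑-cong (fins R) light) (∑-zero (fins R)))
    where
    light : ∀ j → hm i s j ≡ 0
    light j with T ≤ᵇ a i s j in e
    ... | false = refl
    ... | true  = ⊥-elim (¬h (j , ≤ᵇ⇒≤ T _ (subst Data.Bool.T (sym e) tt)))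
  ∑heavy≤ : ∑ (fins R) heavymass ≤ H * n
  ∑heavy≤ = begin
    ∑ (fins R) heavymass                                                   ≡⟨ ∑-swap (fins R) (fins N) (λ j i → hm i true j + hm i false j) ⟩
    ∑ (fins N) (λ i → ∑ (fins R) (λ j → hm i true j + hm i false j))       ≡⟨ ∑-cong (fins N) (λ i → ∑-+ (fins R) (hm i true) (hm i false)) ⟩
    ∑ (fins N) (λ i → ∑ (fins R) (hm i true) + ∑ (fins R) (hm i false))    ≤⟨ ∑-mono (fins N) (λ i → ≤-trans (+-mono-≤ (cell-heavy i true) (cell-heavy i false)) (≤-reflexive (sym (*-distribʳ-+ n ⟦ heavy i true ⟧ ⟦ heavy i false ⟧)))) ⟩
    ∑ (fins N) (λ i → (⟦ heavy i true ⟧ + ⟦ heavy i false ⟧) * n)          ≡⟨ ∑-*ʳ (fins N) (λ i → ⟦ heavy i true ⟧ + ⟦ heavy i false ⟧) n ⟩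
    H * n                                                                  ∎
  -- At least `6(k+1)n` of the mass of the large parts lies in heavy cells, and a cell holds at most
  -- `n`, so there are at least `6(k+1)` of them.
  H≥ : 6 * suc k ≤ H
  H≥ = *-cancelʳ-≤ _ _ n (*-cancelˡ-≤ 2 (begin
    2 * (6 * suc k * n)                        ≡⟨ l (suc k) n ⟩
    12 * suc k * n                             ≤⟨ total ⟩
    ∑ (fins R) (λ j → ⟦ large j ⟧ * mass j)    ≤⟨ ∑-mono (fins R) large-heavy ⟩
    ∑ (fins R) (λ j → 2 * heavymass j)         ≡⟨ ∑-*ˡ (fins R) 2 heavymass ⟩
    2 * ∑ (fins R) heavymass                   ≤⟨ *-monoʳ-≤ 2 ∑heavy≤ ⟩
    2 * (H * n)                                ∎))
    where l : ∀ k n → 2 * (6 * k * n) ≡ 12 * k * n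
          l = solve-∀
  enough : suc k * (6 * T) ≤ ∑ (fins N) (λ i → h i true + h i false)
  enough = begin
    suc k * (6 * T)                            ≡⟨ l (suc k) T ⟩
    6 * suc k * T                              ≤⟨ *-monoˡ-≤ T H≥ ⟩
    H * T                                      ≡⟨ ∑-*ʳ (fins N) (λ i → ⟦ heavy i true ⟧ + ⟦ heavy i false ⟧) T ⟨
    ∑ (fins N) (λ i → (⟦ heavy i true ⟧ + ⟦ heavy i false ⟧) * T) ≡⟨ ∑-cong (fins N) (λ i → *-distribʳ-+ T ⟦ heavy i true ⟧ ⟦ heavy i false ⟧) ⟩
    ∑ (fins N) (λ i → h i true + h i false)    ∎
    where l : ∀ k T → k * (6 * T) ≡ 6 * k * T
          l = solve-∀

-- Labels of leaves and searches over Boolean indices.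

∑-indicator : ∀ {R} (i : Fin R) w → ∑ (fins R) (λ j → ⟦ i == j ⟧ * w) ≡ w
∑-indicator {suc R} zero    w = trans (∑-fins R (λ j → ⟦ zero == j ⟧ * w)) (trans (cong (1 * w +_) (∑-zero (fins R))) (trans (+-identityʳ _) (+-identityʳ w)))
∑-indicator {suc R} (suc i) w = trans (∑-fins R (λ j → ⟦ suc i == j ⟧ * w)) (∑-indicator i w)

∑-class : ∀ {R} v a (i : Fin R) → ∑ (fins R) (λ j → ⟦ (v ∧ (i == j)) ∧ a ⟧) ≡ ⟦ v ∧ a ⟧
∑-class {R} v a i = trans (∑-cong (fins R) (λ j → pt v (i == j) a)) (∑-indicator i ⟦ v ∧ a ⟧)
  where
  pt : ∀ v e a → ⟦ (v ∧ e) ∧ a ⟧ ≡ ⟦ e ⟧ * ⟦ v ∧ a ⟧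
  pt true  true  a = sym (+-identityʳ ⟦ a ⟧)
  pt true  false a = refl
  pt false true  a = refl
  pt false false a = refl

holds : ∀ {A : Set} → (A → Bool) → Maybe A → Bool
holds V (just x) = V x
holds V nothing  = false

-- Label `zero` collects the leaves that are missing or lie outside `V`; the parts are shifted by
-- one.
tagged : ∀ {A : Set} {R} → (A → Bool) → (A → Fin R) → Maybe A → Fin (suc R)
tagged V part (just x) = if V x then suc (part x) else zero
tagged V part nothing  = zero

holds-tagged : ∀ {A : Set} {R} (V : A → Bool) (part : A → Fin R) x j → (tagged V part x == suc j) ≡ holds (λ x → V x ∧ (part x == j)) x
holds-tagged V part nothing  j = refl
holds-tagged V part (just x) j with V x
... | true  = refl
... | false = refl

tagged-suc : ∀ {A : Set} {R} (V : A → Bool) (part : A → Fin R) x j → tagged V part x ≡ suc j →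
             ∃[ y ] (x ≡ just y × (V y ∧ (part y == j)) ≡ true)
tagged-suc V part (just x) j e with V x in Vx | e
... | true | refl = x , refl , trans (cong (_∧ (part x == part x)) Vx) (==-refl (part x))

∑-holds : ∀ {A : Set} {R} (V : A → Bool) (part : A → Fin R) x → ∑ (fins R) (λ j → ⟦ holds (λ x → V x ∧ (part x == j)) x ⟧) ≡ ⟦ holds V x ⟧
∑-holds {R = R} V part nothing  = ∑-zero (fins R)
∑-holds {R = R} V part (just x) = trans (∑-cong (fins R) (λ j → cong ⟦_⟧ (sym (Boolₚ.∧-identityʳ (V x ∧ (part x == j))))))
  (trans (∑-class (V x) true (part x)) (cong ⟦_⟧ (Boolₚ.∧-identityʳ (V x))))

record Complete {A : Set} (xs : List A) : Set where
  constructor complete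
  field
    term≤∑ : ∀ (f : A → ℕ) x → f x ≤ ∑ xs f

open Complete

complete-bools : Complete bools
complete-bools = complete λ where
  f true  → m≤m+n (f true) (f false + 0)
  f false → ≤-trans (m≤m+n (f false) 0) (m≤n+m (f false + 0) (f true))

complete-pairs : {A B : Set} {xs : List A} {ys : List B} → Complete xs → Complete ys → Complete (pairs xs ys)
complete-pairs {xs = xs} {ys} cx cy = complete λ { f (x , y) → ≤-trans (term≤∑ cy (λ y → f (x , y)) y)
  (≤-trans (term≤∑ cx (λ x → ∑ ys (λ y → f (x , y))) x) (≤-reflexive (sym (∑-pairs xs ys f)))) }

∑-positive : {A : Set} (xs : List A) (P : A → Bool) → 1 ≤ ∑ xs (⟦_⟧ ∘ P) → ∃[ x ] P x ≡ true
∑-positive (x ∷ xs) P h with P x in Px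
... | true  = x , Px
... | false = ∑-positive xs P h

search-bool : (P : Bool → Bool) → (∀ b → P b ≡ true) ⊎ (∃[ b ] P b ≡ false)
search-bool P with P true in t | P false in f
... | true  | true  = inj₁ λ { true → t ; false → f }
... | false | _     = inj₂ (true , t)
... | true  | false = inj₂ (false , f)

search-bool³ : (P : Bool × Bool × Bool → Bool) → (∀ b → P b ≡ true) ⊎ (∃[ b ] P b ≡ false)
search-bool³ P with search-bool (λ a → all a)
  where
  all : Bool → Bool
  all a = (P (a , true , true) ∧ P (a , true , false)) ∧ (P (a , false , true) ∧ P (a , false , false))
... | inj₁ h = inj₁ λ where
        (a , true  , true ) → ∧-trueˡ (P (a , true , true)) (∧-trueˡ _ (h a))
        (a , true  , false) → ∧-trueʳ (P (a , true , true)) (∧-trueˡ _ (h a))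
        (a , false , true ) → ∧-trueˡ (P (a , false , true)) (∧-trueʳ (P (a , true , true) ∧ P (a , true , false)) (h a))
        (a , false , false) → ∧-trueʳ (P (a , false , true)) (∧-trueʳ (P (a , true , true) ∧ P (a , true , false)) (h a))
... | inj₂ (a , h) with P (a , true , true) in e₁ | P (a , true , false) in e₂ | P (a , false , true) in e₃ | P (a , false , false) in e₄
...   | false | _     | _     | _     = inj₂ (_ , e₁)
...   | true  | false | _     | _     = inj₂ (_ , e₂)
...   | true  | true  | false | _     = inj₂ (_ , e₃)
...   | true  | true  | true  | false = inj₂ (_ , e₄)

-- An affine factor has rank at most 2, which is less than the trivial bound unless it has 0 or 2 live variables.
lossy : ℕ → Bool
lossy 0 = false
lossy 1 = true
lossy 2 = false
lossy _ = true

odd⇒lossy : ∀ L → odd L ≡ true → lossy L ≡ true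
odd⇒lossy (suc zero)          _ = refl
odd⇒lossy (suc (suc (suc L))) _ = refl

3≤⇒lossy : ∀ {L} → 3 ≤ L → lossy L ≡ true
3≤⇒lossy (s≤s (s≤s (s≤s _))) = refl

¬¬-all : ∀ {p} n {P : Fin n → Set p} → (∀ i → ¬ ¬ P i) → ¬ ¬ (∀ i → P i)
¬¬-all zero    h k = k λ ()
¬¬-all (suc n) h k = h zero λ p → ¬¬-all n (h ∘ suc) λ ps → k λ { zero → p ; (suc i) → ps i }

-- D separates the small parts from the large ones at the lowest level, and mass K times the size of a copy forces a
-- rank deficiency of 2^k. The numbers are kept abstract because unfolding them would be infeasible; 2 * 66 is
-- twice the number of restrictions of a block of level 0.
record Thresholds (k : ℕ) : Set where
  field
    p D K     : ℕ
    p≢0       : NonZero p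
    D≢0       : NonZero D
    K≢0       : NonZero K
    2blks     : 2 * 66 ≡ suc p
    D-large   : (2 + k) * suc p * 16 ≤ D
    K-base    : k * suc p * (16 * D) * 16 ≤ K * 8
    K-step    : 108 * suc k ≤ K

-- Choice of the numerical parameters.

-- A block of level 0 has 16 variables, so it meets at most 16 parts and a mass spans at least 1/16
-- as many incidences. With `D` of order `k`, the product required in `K-base` is of order `k²`;
-- this gives the quadratic `K` and the bound on `c₀`.
thresholds : ∀ p c₀ → NonZero p → 2 * 66 ≡ suc p → suc p * suc p * (16 * 16 * 16) ≤ c₀ * 8 → 108 ≤ c₀ → ∀ k → Thresholds k
thresholds p c₀ nz 2blks big 108≤ k = record
  { p = p ; D = (2 + k) * suc p * 16 ; K = (2 + k) * (2 + k) * c₀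
  ; p≢0 = nz ; D≢0 = m*n≢0 ((2 + k) * suc p) 16 {{m*n≢0 (2 + k) (suc p)}}
  ; K≢0 = m*n≢0 ((2 + k) * (2 + k)) c₀ {{m*n≢0 (2 + k) (2 + k)}} {{>-nonZero (≤-trans (s≤s z≤n) 108≤)}}
  ; 2blks = 2blks ; D-large = ≤-refl ; K-base = base ; K-step = step }
  where
  open ≤-Reasoning
  l : ∀ k a b → k * a * (b * ((2 + k) * a * b)) * b ≡ k * (2 + k) * (a * a * (b * b * b))
  l = solve-∀
  base : k * suc p * (16 * ((2 + k) * suc p * 16)) * 16 ≤ (2 + k) * (2 + k) * c₀ * 8
  base = begin
    k * suc p * (16 * ((2 + k) * suc p * 16)) * 16      ≡⟨ l k (suc p) 16 ⟩
    k * (2 + k) * (suc p * suc p * (16 * 16 * 16))      ≤⟨ *-mono-≤ (*-monoˡ-≤ (2 + k) (m≤n+m k 2)) big ⟩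
    (2 + k) * (2 + k) * (c₀ * 8)                        ≡⟨ *-assoc ((2 + k) * (2 + k)) c₀ 8 ⟨
    (2 + k) * (2 + k) * c₀ * 8                          ∎
  step : 108 * suc k ≤ (2 + k) * (2 + k) * c₀
  step = begin
    108 * suc k                 ≡⟨ *-comm 108 (suc k) ⟩
    suc k * 108                 ≤⟨ *-mono-≤ (≤-trans (n≤1+n (suc k)) (m≤m*n (2 + k) (2 + k))) 108≤ ⟩
    (2 + k) * (2 + k) * c₀      ∎

-- Since `2 + k ≤ 6κΔ` and `K` is quadratic in `k`, the left side is at most a constant `a` times
-- `(κΔ)³`. Allowing `a` and `(κΔ)³` at most `√m` each, and `κ³` and `Δ³` at most `m^(1/4)` each,
-- leads to the exponent 12.
parameters : ∀ c₀ κ d m → 1 ≤ κ → κ ^ 12 ≤ m → suc d ^ 12 ≤ m → 12 * c₀ * 216 * (12 * c₀ * 216) ≤ m →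
  let k = suc ((2 * κ + 1) * suc d) in 12 * ((2 + k) * (2 + k) * c₀) * suc k ≤ m
parameters c₀ κ d m 1≤κ κ≤m D≤m a≤m = begin
  12 * ((2 + k) * (2 + k) * c₀) * suc k      ≤⟨ *-monoʳ-≤ (12 * ((2 + k) * (2 + k) * c₀)) (n≤1+n (suc k)) ⟩
  12 * ((2 + k) * (2 + k) * c₀) * (2 + k)    ≡⟨ l₁ (2 + k) c₀ ⟩
  12 * c₀ * ((2 + k) * (2 + k) * (2 + k))    ≤⟨ *-monoʳ-≤ (12 * c₀) (*-mono-≤ (*-mono-≤ k≤ k≤) k≤) ⟩
  12 * c₀ * (6 * p * (6 * p) * (6 * p))      ≡⟨ l₂ c₀ p ⟩
  a * x                                      ≤⟨ root² (a * x) m (begin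
    a * x * (a * x)                              ≡⟨ l₃ a x ⟩
    a * a * (x * x)                              ≤⟨ *-mono-≤ a≤m (root² (x * x) m (begin
      x * x * (x * x)                                ≡⟨ trans (l₄ p) (^-distribʳ-* κ D 12) ⟩
      κ ^ 12 * D ^ 12                                ≤⟨ *-mono-≤ κ≤m D≤m ⟩
      m * m                                          ∎)) ⟩
    m * m                                        ∎) ⟩
  m                                          ∎
  where
  open ≤-Reasoning
  D = suc d
  k = suc ((2 * κ + 1) * D)
  p = κ * D
  x = p * (p * p)
  a = 12 * c₀ * 216
  l₁ : ∀ q c → 12 * (q * q * c) * q ≡ 12 * c * (q * q * q)
  l₁ = solve-∀
  l₂ : ∀ c p → 12 * c * (6 * p * (6 * p) * (6 * p)) ≡ 12 * c * 216 * (p * (p * p))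
  l₂ = solve-∀
  l₃ : ∀ a x → a * x * (a * x) ≡ a * a * (x * x)
  l₃ = solve-∀
  l₄ : ∀ p → p * (p * p) * (p * (p * p)) * (p * (p * p) * (p * (p * p))) ≡ p * (p * (p * (p * (p * (p * (p * (p * (p * (p * (p * (p * 1)))))))))))
  l₄ = solve-∀
  root² : ∀ a b → a * a ≤ b * b → a ≤ b
  root² a b h = ^-cancelˡ-≤ 1 (≤-trans (≤-reflexive (cong (a *_) (*-identityʳ a))) (≤-trans h (≤-reflexive (cong (b *_) (sym (*-identityʳ b))))))
  k≤ : 2 + k ≤ 6 * p
  k≤ = begin
    3 + (2 * κ + 1) * D         ≤⟨ +-mono-≤ (*-monoʳ-≤ 3 (*-mono-≤ 1≤κ (s≤s (z≤n {d})))) (*-monoˡ-≤ D (+-monoʳ-≤ (2 * κ) 1≤κ)) ⟩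
    3 * p + (2 * κ + κ) * D     ≡⟨ l κ D ⟩
    6 * p                       ∎
    where l : ∀ κ D → 3 * (κ * D) + (2 * κ + κ) * D ≡ 6 * (κ * D)
          l = solve-∀

module Bounds {c ℓ} (F : Field c ℓ) where

  -- Rank of matrices over the field.

  module Rank where

    open Field F public using (Carrier; _≈_; 0#; 1#; 0≉1; inverse; setoid; +-cong; *-cong; commutativeRing; commutativeSemiring)
      renaming (_+_ to _⊕_; _*_ to _⊗_; -_ to ⊖_; refl to ≈refl; sym to ≈sym; trans to ≈trans; reflexive to ≈reflexive;
                +-identityˡ to ⊕-identityˡ; +-identityʳ to ⊕-identityʳ; *-identityˡ to ⊗-identityˡ; *-identityʳ to ⊗-identityʳ;
                +-comm to ⊕-comm; +-assoc to ⊕-assoc; *-comm to ⊗-comm; *-assoc to ⊗-assoc; distribˡ to ⊗-distribˡ; distribʳ to ⊗-distribʳ;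
                zeroˡ to ⊗-zeroˡ; zeroʳ to ⊗-zeroʳ; -‿inverseʳ to ⊖-inverseʳ; -‿inverseˡ to ⊖-inverseˡ)
    open import Algebra.Solver.Ring.NaturalCoefficients.Default commutativeSemiring public
      using (solve; _:=_; _:+_; _:*_; con)
    open import Relation.Binary.Reasoning.Setoid setoid

    ⊕-congˡ : ∀ {x y z} → y ≈ z → x ⊕ y ≈ x ⊕ z
    ⊕-congˡ = +-cong ≈refl

    ⊕-congʳ : ∀ {x y z} → y ≈ z → y ⊕ x ≈ z ⊕ x
    ⊕-congʳ e = +-cong e ≈refl

    ⊗-congˡ : ∀ {x y z} → y ≈ z → x ⊗ y ≈ x ⊗ z
    ⊗-congˡ = *-cong ≈refl

    ⊗-congʳ : ∀ {x y z} → y ≈ z → y ⊗ x ≈ z ⊗ x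
    ⊗-congʳ e = *-cong e ≈refl

    nonzero-* : ∀ {x y} → ¬ (x ≈ 0#) → ¬ (y ≈ 0#) → ¬ (x ⊗ y ≈ 0#)
    nonzero-* {x} {y} x≉0 y≉0 xy≈0 with inverse x x≉0
    ... | i , xi≈1 = y≉0 (begin
      y                ≈⟨ ⊗-identityˡ y ⟨
      1# ⊗ y           ≈⟨ ⊗-congʳ xi≈1 ⟨
      x ⊗ i ⊗ y        ≈⟨ solve 3 (λ x i y → x :* i :* y := i :* (x :* y)) ≈refl x i y ⟩
      i ⊗ (x ⊗ y)      ≈⟨ ⊗-congˡ xy≈0 ⟩
      i ⊗ 0#           ≈⟨ ⊗-zeroʳ i ⟩
      0#               ∎)

    ⨁ : ∀ {a} {A : Set a} → List A → (A → Carrier) → Carrier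
    ⨁ []       f = 0#
    ⨁ (x ∷ xs) f = f x ⊕ ⨁ xs f

    module _ {a} {A : Set a} where

      ⨁-cong : ∀ (xs : List A) {f g} → (∀ x → f x ≈ g x) → ⨁ xs f ≈ ⨁ xs g
      ⨁-cong []       h = ≈refl
      ⨁-cong (x ∷ xs) h = +-cong (h x) (⨁-cong xs h)

      ⨁-++ : ∀ (xs ys : List A) f → ⨁ (xs ++ ys) f ≈ ⨁ xs f ⊕ ⨁ ys f
      ⨁-++ []       ys f = ≈sym (⊕-identityˡ _)
      ⨁-++ (x ∷ xs) ys f = ≈trans (⊕-congˡ (⨁-++ xs ys f)) (≈sym (⊕-assoc _ _ _))

      ⨁-*ˡ : ∀ (xs : List A) k f → ⨁ xs (λ x → k ⊗ f x) ≈ k ⊗ ⨁ xs f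
      ⨁-*ˡ []       k f = ≈sym (⊗-zeroʳ k)
      ⨁-*ˡ (x ∷ xs) k f = ≈trans (⊕-congˡ (⨁-*ˡ xs k f)) (≈sym (⊗-distribˡ k _ _))

      ⨁-+ : ∀ (xs : List A) f g → ⨁ xs (λ x → f x ⊕ g x) ≈ ⨁ xs f ⊕ ⨁ xs g
      ⨁-+ []       f g = ≈sym (⊕-identityˡ 0#)
      ⨁-+ (x ∷ xs) f g = ≈trans (⊕-congˡ (⨁-+ xs f g))
        (solve 4 (λ a b p q → a :+ b :+ (p :+ q) := a :+ p :+ (b :+ q)) ≈refl (f x) (g x) (⨁ xs f) (⨁ xs g))

      ⨁-zero : ∀ (xs : List A) → ⨁ xs (λ _ → 0#) ≈ 0#
      ⨁-zero []       = ≈refl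
      ⨁-zero (x ∷ xs) = ≈trans (⊕-identityˡ _) (⨁-zero xs)

    ⨁-map : ∀ {a b} {A : Set a} {B : Set b} (h : A → B) (xs : List A) f → ⨁ (map h xs) f ≈ ⨁ xs (f ∘ h)
    ⨁-map h []       f = ≈refl
    ⨁-map h (x ∷ xs) f = ⊕-congˡ (⨁-map h xs f)

    ⨁-fins : ∀ n (f : Fin (suc n) → Carrier) → ⨁ (fins (suc n)) f ≈ f zero ⊕ ⨁ (fins n) (f ∘ suc)
    ⨁-fins n f = ⊕-congˡ (⨁-map suc (fins n) f)

    ⨂ : ∀ n → (Fin n → Carrier) → Carrier
    ⨂ zero    f = 1#
    ⨂ (suc n) f = f zero ⊗ ⨂ n (f ∘ suc)

    ⨂-cong : ∀ n {f g} → (∀ i → f i ≈ g i) → ⨂ n f ≈ ⨂ n g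
    ⨂-cong zero    h = ≈refl
    ⨂-cong (suc n) h = *-cong (h zero) (⨂-cong n (h ∘ suc))

    ⨂-zero : ∀ n {f} i → f i ≈ 0# → ⨂ n f ≈ 0#
    ⨂-zero (suc n) zero    e = ≈trans (⊗-congʳ e) (⊗-zeroˡ _)
    ⨂-zero (suc n) (suc i) e = ≈trans (⊗-congˡ (⨂-zero n i e)) (⊗-zeroʳ _)

    ⨂-nonzero : ∀ n {f} → (∀ i → ¬ (f i ≈ 0#)) → ¬ (⨂ n f ≈ 0#)
    ⨂-nonzero zero    h e = 0≉1 (≈sym e)
    ⨂-nonzero (suc n) h   = nonzero-* (h zero) (⨂-nonzero n (h ∘ suc))

    ⨂-one : ∀ n {f} → (∀ i → f i ≈ 1#) → ⨂ n f ≈ 1#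
    ⨂-one zero    h = ≈refl
    ⨂-one (suc n) h = ≈trans (*-cong (h zero) (⨂-one n (h ∘ suc))) (⊗-identityˡ 1#)

    Factors : Set → Set → Set c
    Factors A B = List ((A → Carrier) × (B → Carrier))

    outer : ∀ {A B : Set} → A → B → (A → Carrier) × (B → Carrier) → Carrier
    outer a b (u , w) = u a ⊗ w b

    -- The rank of G is at most r.
    record HasRank {A B : Set} (G : A → B → Carrier) (r : ℕ) : Set (c ⊔ ℓ) where
      constructor mkRank
      field
        factors : Factors A B
        #factors : length factors ≡ r
        sums : ∀ a b → G a b ≈ ⨁ factors (outer a b)

    module _ {A B : Set} where

      rank-cong : ∀ {G H : A → B → Carrier} {r} → (∀ a b → H a b ≈ G a b) → HasRank G r → HasRank H r
      rank-cong h (mkRank fs l s) = mkRank fs l (λ a b → ≈trans (h a b) (s a b))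

      rank-zero : HasRank {A} {B} (λ _ _ → 0#) 0
      rank-zero = mkRank [] refl (λ _ _ → ≈refl)

      rank-outer : ∀ (u : A → Carrier) (w : B → Carrier) → HasRank (λ a b → u a ⊗ w b) 1
      rank-outer u w = mkRank ((u , w) ∷ []) refl (λ _ _ → ≈sym (⊕-identityʳ _))

      rank-+ : ∀ {G H : A → B → Carrier} {r s} → HasRank G r → HasRank H s → HasRank (λ a b → G a b ⊕ H a b) (r + s)
      rank-+ (mkRank fs refl e) (mkRank gs refl e′) = mkRank (fs ++ gs) (Listₚ.length-++ fs)
        (λ a b → ≈trans (+-cong (e a b) (e′ a b)) (≈sym (⨁-++ fs gs (outer a b))))

      rank-*ˡ : ∀ {G : A → B → Carrier} {r} (k : A → Carrier) → HasRank G r → HasRank (λ a b → k a ⊗ G a b) r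
      rank-*ˡ k (mkRank fs refl e) = mkRank (map (λ { (u , w) → (λ a → k a ⊗ u a) , w }) fs) (Listₚ.length-map _ fs)
        (λ a b → ≈trans (⊗-congˡ (e a b)) (≈trans (≈sym (⨁-*ˡ fs (k a) (outer a b)))
          (≈trans (⨁-cong fs (λ _ → ≈sym (⊗-assoc _ _ _))) (≈sym (⨁-map _ fs (outer a b))))))

      rank-transpose : ∀ {G : A → B → Carrier} {r} → HasRank G r → HasRank (λ b a → G a b) r
      rank-transpose (mkRank fs refl e) = mkRank (map (λ { (u , w) → w , u }) fs) (Listₚ.length-map _ fs)
        (λ b a → ≈trans (e a b) (≈trans (⨁-cong fs (λ _ → ⊗-comm _ _)) (≈sym (⨁-map _ fs (outer b a)))))

      rank-∘ : ∀ {A′ B′ : Set} {G : A → B → Carrier} {r} (f : A′ → A) (g : B′ → B) →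
               HasRank G r → HasRank (λ a b → G (f a) (g b)) r
      rank-∘ f g (mkRank fs refl e) = mkRank (map (λ { (u , w) → u ∘ f , w ∘ g }) fs) (Listₚ.length-map _ fs)
        (λ a b → ≈trans (e (f a) (g b)) (≈sym (⨁-map _ fs (outer a b))))

    module _ {A B : Set} where

      -- The product is entrywise: multiplying `H` by one outer product only rescales its rows and
      -- its columns, so each outer product in `G` contributes `s`.
      rank-* : ∀ {G H : A → B → Carrier} {r s} → HasRank G r → HasRank H s → HasRank (λ a b → G a b ⊗ H a b) (r * s)
      rank-* {H = H} {s = s} (mkRank fs refl e) h = rank-cong (λ a b → ⊗-congʳ (e a b)) (go fs)
        where
        go : ∀ fs → HasRank (λ a b → ⨁ fs (outer a b) ⊗ H a b) (length fs * s)
        go []             = rank-cong (λ _ _ → ⊗-zeroˡ _) rank-zero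
        go ((u , w) ∷ fs) = rank-cong {r = s + length fs * s}
          (λ a b → ≈trans (⊗-distribʳ (H a b) (u a ⊗ w b) (⨁ fs (outer a b))) (⊕-congʳ (⊗-assoc (u a) (w b) (H a b))))
          (rank-+ (rank-*ˡ u (rank-transpose (rank-*ˡ w (rank-transpose h)))) (go fs))

      rank-affine : ∀ (u : A → Carrier) (w : B → Carrier) → HasRank (λ a b → u a ⊕ w b) 2
      rank-affine u w = rank-cong (λ a b → +-cong (≈sym (⊗-identityʳ (u a))) (≈sym (⊗-identityˡ (w b))))
        (rank-+ (rank-outer u (λ _ → 1#)) (rank-outer (λ _ → 1#) w))

      rank-⨁ : ∀ n {G : Fin n → A → B → Carrier} {r : Fin n → ℕ} → (∀ i → HasRank (G i) (r i)) →
               HasRank (λ a b → ⨁ (fins n) (λ i → G i a b)) (∑ (fins n) r)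
      rank-⨁ zero    h = rank-zero
      rank-⨁ (suc n) {G} {r} h = subst (HasRank _) (sym (∑-fins n r))
        (rank-cong (λ a b → ⨁-fins n (λ i → G i a b)) (rank-+ (h zero) (rank-⨁ n (h ∘ suc))))

      rank-⨂ : ∀ n {G : Fin n → A → B → Carrier} {r : Fin n → ℕ} → (∀ i → HasRank (G i) (r i)) →
               HasRank (λ a b → ⨂ n (λ i → G i a b)) (∏ n r)
      rank-⨂ zero    h = rank-cong (λ _ _ → ≈sym (⊗-identityˡ 1#)) (rank-outer (λ _ → 1#) (λ _ → 1#))
      rank-⨂ (suc n) h = rank-* (h zero) (rank-⨂ n (h ∘ suc))

    -- There are at most `2 ^ count U` distinct rows. Each coordinate in `U` is expanded by the two
    -- indicator functions of its value, which doubles the number of outer products.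
    rank-dep : ∀ {n} {B : Set} (U : Fin n → Bool) {G : (Fin n → Bool) → B → Carrier} →
               (∀ a a′ b → (∀ x → U x ≡ true → a x ≡ a′ x) → G a b ≈ G a′ b) → HasRank G (2 ^ count U)
    rank-dep {zero}  U {G} h = rank-cong (λ a b → ≈trans (h a (λ ()) b (λ ())) (≈sym (⊗-identityˡ _)))
                                         (rank-outer (λ _ → 1#) (λ b → G (λ ()) b))
    rank-dep {suc n} U {G} h rewrite ∑-fins n (⟦_⟧ ∘ U) with U zero in U0
    ... | false = rank-cong (λ a b → h a (cons false (tail a)) b (λ { zero e → case trans (sym U0) e of λ () ; (suc x) _ → refl }))
        (rank-∘ tail (λ b → b) (rank-dep (U ∘ suc) {λ a b → G (cons false a) b}
          (λ a a′ b e → h _ _ b (λ { zero _ → refl ; (suc x) → e x }))))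
    ... | true = rank-cong expand (rank-+ (piece true) (subst (HasRank _) (sym (+-identityʳ (2 ^ count (U ∘ suc)))) (piece false)))
      where
      ind : Bool → Bool → Carrier
      ind true  true  = 1#
      ind false false = 1#
      ind _     _     = 0#
      piece : ∀ v → HasRank (λ a b → ind v (a zero) ⊗ G (cons v (tail a)) b) (2 ^ count (U ∘ suc))
      piece v = rank-*ˡ (λ a → ind v (a zero)) (rank-∘ tail (λ b → b) (rank-dep (U ∘ suc) {λ a b → G (cons v a) b}
          (λ a a′ b e → h _ _ b (λ { zero _ → refl ; (suc x) → e x }))))
      η : ∀ a v → a zero ≡ v → ∀ b → G a b ≈ G (cons v (tail a)) b
      η a v e b = h a _ b (λ { zero _ → e ; (suc x) _ → refl })
      expand : ∀ a b → G a b ≈ ind true (a zero) ⊗ G (cons true (tail a)) b ⊕ ind false (a zero) ⊗ G (cons false (tail a)) b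
      expand a b with a zero in a0
      ... | true  = ≈trans (η a true a0 b) (≈sym (≈trans (+-cong (⊗-identityˡ _) (⊗-zeroˡ _)) (⊕-identityʳ _)))
      ... | false = ≈trans (η a false a0 b) (≈sym (≈trans (+-cong (⊗-zeroˡ _) (⊗-identityˡ _)) (⊕-identityˡ _)))

    -- If the first outer product has a nonzero entry `u p`, multiples of row `p` are subtracted to
    -- cancel it. Row `p` vanishes off the diagonal, so the minor without row and column `p` keeps
    -- its entries while one outer product disappears.
    diagonal-rank : ∀ r N {D : Fin N → Fin N → Carrier} → (∀ i → ¬ (D i i ≈ 0#)) → (∀ i j → i ≢ j → D i j ≈ 0#) →
                    HasRank D r → N ≤ r
    diagonal-rank zero    zero    _    _   _ = z≤n
    diagonal-rank zero    (suc N) diag off (mkRank [] refl e) = ⊥-elim (diag zero (e zero zero))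
    diagonal-rank (suc r) zero    _    _   _ = z≤n
    diagonal-rank (suc r) (suc N) {D} diag off (mkRank ((u , w) ∷ fs) len e) =
      decidable-stable (suc N ≤? suc r) λ ¬goal → ¬¬-search (suc N) (λ i → u i ≈ 0#) λ where
        (inj₂ u≈0) → ¬goal (m≤n⇒m≤1+n (diagonal-rank r (suc N) diag off
          (mkRank fs (suc-injective len) (λ i j → ≈trans (e i j) (≈trans (⊕-congʳ (≈trans (⊗-congʳ (u≈0 i)) (⊗-zeroˡ _))) (⊕-identityˡ _))))))
        (inj₁ (p , up≉0)) → ¬goal (s≤s (eliminate p up≉0))
      where
      -- Subtract from each row the multiple of row p that cancels the first factor.
      eliminate : ∀ p → ¬ (u p ≈ 0#) → N ≤ r
      eliminate p up≉0 with inverse (u p) up≉0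
      ... | y , up·y≈1 = diagonal-rank r N (λ i → diag (punchIn p i)) (λ i j ne → off _ _ (ne ∘ Finₚ.punchIn-injective p i j))
        (mkRank (map f′ fs) (trans (Listₚ.length-map f′ fs) (suc-injective len)) (λ i j → rep (punchIn p i) (punchIn p j) (off p (punchIn p j) (Finₚ.punchInᵢ≢i p j ∘ sym)) i j refl refl))
        where
        f′ : (Fin (suc N) → Carrier) × (Fin (suc N) → Carrier) → (Fin N → Carrier) × (Fin N → Carrier)
        f′ (v , x) = (λ i → v (punchIn p i) ⊕ (⊖ (u (punchIn p i) ⊗ y)) ⊗ v p) , x ∘ punchIn p
        rep : ∀ I J → D p J ≈ 0# → ∀ i j → I ≡ punchIn p i → J ≡ punchIn p j → D I J ≈ ⨁ (map f′ fs) (outer i j)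
        rep I J pJ i j refl refl = begin
          D I J                                        ≈⟨ e I J ⟩
          u I ⊗ w J ⊕ ⨁ fs (outer I J)                 ≈⟨ ⊕-congʳ first ⟩
          μ ⊗ ⨁ fs (outer p J) ⊕ ⨁ fs (outer I J)      ≈⟨ ⊕-congʳ (⨁-*ˡ fs μ (outer p J)) ⟨
          ⨁ fs (λ f → μ ⊗ outer p J f) ⊕ ⨁ fs (outer I J) ≈⟨ ⨁-+ fs _ _ ⟨
          ⨁ fs (λ f → μ ⊗ outer p J f ⊕ outer I J f)   ≈⟨ ⨁-cong fs (λ { (v , x) → solve 4 (λ μ a b k → μ :* (a :* b) :+ k :* b := (k :+ μ :* a) :* b) ≈refl μ (v p) (x J) (v I) }) ⟩
          ⨁ fs (outer i j ∘ f′)                        ≈⟨ ⨁-map f′ fs (outer i j) ⟨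
          ⨁ (map f′ fs) (outer i j)                    ∎
          where
          S = ⨁ fs (outer p J)
          κ = u I ⊗ y
          μ = ⊖ κ
          first : u I ⊗ w J ≈ μ ⊗ S
          first = begin
            u I ⊗ w J                                     ≈⟨ ⊗-identityʳ _ ⟨
            u I ⊗ w J ⊗ 1#                                ≈⟨ ⊗-congˡ up·y≈1 ⟨
            u I ⊗ w J ⊗ (u p ⊗ y)                         ≈⟨ solve 4 (λ a b c d → a :* b :* (c :* d) := a :* d :* (c :* b)) ≈refl (u I) (w J) (u p) y ⟩
            κ ⊗ (u p ⊗ w J)                               ≈⟨ ⊕-identityʳ _ ⟨
            κ ⊗ (u p ⊗ w J) ⊕ 0#                          ≈⟨ ⊕-congˡ (≈trans (⊗-congʳ (⊖-inverseʳ κ)) (⊗-zeroˡ S)) ⟨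
            κ ⊗ (u p ⊗ w J) ⊕ (κ ⊕ μ) ⊗ S                 ≈⟨ solve 4 (λ k t μ s → k :* t :+ (k :+ μ) :* s := k :* (t :+ s) :+ μ :* s) ≈refl κ (u p ⊗ w J) μ S ⟩
            κ ⊗ (u p ⊗ w J ⊕ S) ⊕ μ ⊗ S                   ≈⟨ ⊕-congʳ (⊗-congˡ (≈trans (≈sym (e p J)) pJ)) ⟩
            κ ⊗ 0# ⊕ μ ⊗ S                                ≈⟨ ⊕-congʳ (⊗-zeroʳ κ) ⟩
            0# ⊕ μ ⊗ S                                    ≈⟨ ⊕-identityˡ _ ⟩
            μ ⊗ S                                         ∎

    -- Restricted to the representatives `points U`, which differ pairwise on `U`, the matrix is
    -- diagonal with nonzero diagonal.
    rank-lower-bound : ∀ {n r} (U : Fin n → Bool) {D : (Fin n → Bool) → (Fin n → Bool) → Carrier} →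
      (∀ a → ¬ (D a a ≈ 0#)) → (∀ a a′ x → U x ≡ true → a x ≢ a′ x → D a a′ ≈ 0#) → HasRank D r → 2 ^ count U ≤ r
    rank-lower-bound U diag off h = diagonal-rank _ _ (λ i → diag (point i))
      (λ i j ne → let (x , Ux , ne′) = distinct i j ne in off _ _ x Ux ne′) (rank-∘ point point h)
      where open Points (points U)

  open Rank public

  -- Polynomials: functionals, evaluation and leading monomials.

  module Polys where

    open import Relation.Binary.Reasoning.Setoid setoid

    -- The linear functional with values `φ` on monomials. Evaluation and taking a coefficient are
    -- both of this form, so invariance and multiplication are treated once for both.
    lin : ∀ {n} → Poly F n → (Monomial n → Carrier) → Carrier
    lin p φ = ⨁ p (λ t → proj₁ t ⊗ φ (proj₂ t))

    mons : ∀ {n} → Poly F n → List (Monomial n)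
    mons = map proj₂

    δ : ∀ {n} → Carrier → Monomial n → Monomial n → Carrier
    δ a e′ e with e′ ≟M e
    ... | yes _ = a
    ... | no  _ = 0#

    δ-same : ∀ {n} a (e : Monomial n) → δ a e e ≈ a
    δ-same a e with e ≟M e
    ... | yes _ = ≈refl
    ... | no ne = ⊥-elim (ne refl)

    δ-diff : ∀ {n} a (e′ e : Monomial n) → e′ ≢ e → δ a e′ e ≈ 0#
    δ-diff a e′ e ne with e′ ≟M e
    ... | yes eq = ⊥-elim (ne eq)
    ... | no _   = ≈refl

    coeff-∷ : ∀ {n} a (e′ : Monomial n) p e → coeff F ((a , e′) ∷ p) e ≈ δ a e′ e ⊕ coeff F p e
    coeff-∷ a e′ p e with e′ ≟M e
    ... | yes _ = ≈refl
    ... | no  _ = ≈sym (⊕-identityˡ _)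

    coeff-∉ : ∀ {n} (p : Poly F n) e → ¬ (e ∈ mons p) → coeff F p e ≈ 0#
    coeff-∉ []             e _  = ≈refl
    coeff-∉ ((a , e′) ∷ p) e ∉p = ≈trans (coeff-∷ a e′ p e)
      (≈trans (+-cong (δ-diff a e′ e (λ eq → ∉p (here (sym eq)))) (coeff-∉ p e (∉p ∘ there))) (⊕-identityˡ 0#))

    ⨁-pick : ∀ {n} (L : List (Monomial n)) → Unique L → ∀ a e′ (φ : Monomial n → Carrier) → e′ ∈ L → ⨁ L (λ e → δ a e′ e ⊗ φ e) ≈ a ⊗ φ e′
    ⨁-pick (x ∷ L) (x∉ AllPairs.∷ u) a .x φ (here refl) =
      ≈trans (+-cong (⊗-congʳ (δ-same a x)) (rest L x∉)) (⊕-identityʳ _)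
      where
      rest : ∀ L → All (x ≢_) L → ⨁ L (λ e → δ a x e ⊗ φ e) ≈ 0#
      rest []      _          = ≈refl
      rest (y ∷ L) (x≢y All.∷ r) = ≈trans (+-cong (≈trans (⊗-congʳ (δ-diff a x y x≢y)) (⊗-zeroˡ _)) (rest L r)) (⊕-identityˡ 0#)
    ⨁-pick (x ∷ L) (x∉ AllPairs.∷ u) a e′ φ (there e′∈) =
      ≈trans (+-cong (≈trans (⊗-congʳ (δ-diff a e′ x (λ eq → All.lookup x∉ e′∈ (sym eq)))) (⊗-zeroˡ _)) (⨁-pick L u a e′ φ e′∈)) (⊕-identityˡ _)

    lin-coeff : ∀ {n} (L : List (Monomial n)) → Unique L → ∀ p φ → (∀ {e} → e ∈ mons p → e ∈ L) →
                lin p φ ≈ ⨁ L (λ e → coeff F p e ⊗ φ e)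
    lin-coeff L u []             φ sub = ≈sym (≈trans (⨁-cong L (λ e → ⊗-zeroˡ (φ e))) (⨁-zero L))
    lin-coeff L u ((a , e′) ∷ p) φ sub = begin
      a ⊗ φ e′ ⊕ lin p φ                                                     ≈⟨ +-cong (⨁-pick L u a e′ φ (sub (here refl))) (≈sym (lin-coeff L u p φ (sub ∘ there))) ⟨
      ⨁ L (λ e → δ a e′ e ⊗ φ e) ⊕ ⨁ L (λ e → coeff F p e ⊗ φ e)             ≈⟨ ⨁-+ L _ _ ⟨
      ⨁ L (λ e → δ a e′ e ⊗ φ e ⊕ coeff F p e ⊗ φ e)                         ≈⟨ ⨁-cong L (λ e → ⊗-distribʳ (φ e) _ _) ⟨
      ⨁ L (λ e → (δ a e′ e ⊕ coeff F p e) ⊗ φ e)                             ≈⟨ ⨁-cong L (λ e → ⊗-congʳ (coeff-∷ a e′ p e)) ⟨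
      ⨁ L (λ e → coeff F ((a , e′) ∷ p) e ⊗ φ e)                             ∎

    -- The list of terms may contain monomials whose coefficients cancel. Regrouping it by distinct
    -- monomials shows that the values of `φ` there are irrelevant.
    lin-cong : ∀ {n} (p : Poly F n) {φ ψ} → (∀ e → coeff F p e ≈ 0# ⊎ φ e ≈ ψ e) → lin p φ ≈ lin p ψ
    lin-cong p {φ} {ψ} h = ≈trans (lin-coeff L u p φ sub) (≈trans (⨁-cong L pt) (≈sym (lin-coeff L u p ψ sub)))
      where
      L = deduplicate _≟M_ (mons p)
      u = deduplicate-! _≟M_ (mons p)
      sub : ∀ {e} → e ∈ mons p → e ∈ L
      sub = ∈-deduplicate⁺ _≟M_
      pt : ∀ e → coeff F p e ⊗ φ e ≈ coeff F p e ⊗ ψ e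
      pt e with h e
      ... | inj₁ z = ≈trans (⊗-congʳ z) (≈trans (⊗-zeroˡ _) (≈sym (≈trans (⊗-congʳ z) (⊗-zeroˡ _))))
      ... | inj₂ q = ⊗-congˡ q

    lin-≈P : ∀ {n} (p q : Poly F n) φ → _≈P_ F p q → lin p φ ≈ lin q φ
    lin-≈P p q φ h = ≈trans (lin-coeff L u p φ (λ i → ∈-deduplicate⁺ _≟M_ (∈-++⁺ˡ i)))
      (≈trans (⨁-cong L (λ e → ⊗-congʳ (h e))) (≈sym (lin-coeff L u q φ (λ i → ∈-deduplicate⁺ _≟M_ (∈-++⁺ʳ (mons p) i)))))
      where
      L = deduplicate _≟M_ (mons p ++ mons q)
      u = deduplicate-! _≟M_ (mons p ++ mons q)

    lin-zero : ∀ {n} (p : Poly F n) → lin p (λ _ → 0#) ≈ 0#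
    lin-zero p = ≈trans (⨁-cong p (λ _ → ⊗-zeroʳ _)) (⨁-zero p)

    coeff-lin : ∀ {n} (p : Poly F n) e → coeff F p e ≈ lin p (λ e′ → δ 1# e′ e)
    coeff-lin []             e = ≈refl
    coeff-lin ((a , e′) ∷ p) e = ≈trans (coeff-∷ a e′ p e) (+-cong step (coeff-lin p e))
      where
      step : δ a e′ e ≈ a ⊗ δ 1# e′ e
      step with e′ ≟M e
      ... | yes _ = ≈sym (⊗-identityʳ a)
      ... | no  _ = ≈sym (⊗-zeroʳ a)

    lin-mul : ∀ {n} (p q : Poly F n) φ → lin (mulP F p q) φ ≈ lin p (λ e → lin q (λ f → φ (e ⊞ f)))
    lin-mul []            q φ = ≈refl
    lin-mul ((a , e) ∷ p) q φ = ≈trans (⨁-++ (map _ q) (mulP F p q) _) (+-cong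
      (≈trans (⨁-map _ q _) (≈trans (⨁-cong q (λ _ → ⊗-assoc _ _ _)) (⨁-*ˡ q a _))) (lin-mul p q φ))

    lin-⊗ : ∀ {n} (p : Poly F n) k φ → lin p (λ e → k ⊗ φ e) ≈ k ⊗ lin p φ
    lin-⊗ p k φ = ≈trans (⨁-cong p (λ t → solve 3 (λ a k f → a :* (k :* f) := k :* (a :* f)) ≈refl (proj₁ t) k (φ (proj₂ t)))) (⨁-*ˡ p k _)

    pow : Carrier → ℕ → Carrier
    pow a zero    = 1#
    pow a (suc k) = a ⊗ pow a k

    pow-+ : ∀ a k l → pow a (k + l) ≈ pow a k ⊗ pow a l
    pow-+ a zero    l = ≈sym (⊗-identityˡ _)
    pow-+ a (suc k) l = ≈trans (⊗-congˡ (pow-+ a k l)) (≈sym (⊗-assoc _ _ _))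

    pow-cong : ∀ {a b} k → a ≈ b → pow a k ≈ pow b k
    pow-cong zero    e = ≈refl
    pow-cong (suc k) e = *-cong e (pow-cong k e)

    Env : ℕ → Set c
    Env n = Fin n → Carrier

    Fn : ℕ → Set c
    Fn n = Env n → Carrier

    monEv : ∀ {n} → Env n → Monomial n → Carrier
    monEv v []      = 1#
    monEv v (k ∷ e) = pow (v zero) k ⊗ monEv (v ∘ suc) e

    monEv-⊞ : ∀ {n} (v : Env n) e f → monEv v (e ⊞ f) ≈ monEv v e ⊗ monEv v f
    monEv-⊞ v []      []      = ≈sym (⊗-identityˡ 1#)
    monEv-⊞ v (k ∷ e) (l ∷ f) = ≈trans (*-cong (pow-+ (v zero) k l) (monEv-⊞ (v ∘ suc) e f))
      (solve 4 (λ a b x y → a :* b :* (x :* y) := a :* x :* (b :* y)) ≈refl (pow (v zero) k) (pow (v zero) l) (monEv (v ∘ suc) e) (monEv (v ∘ suc) f))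

    monEv-0 : ∀ {n} (v : Env n) → monEv v (zeroMon F) ≈ 1#
    monEv-0 {zero}  v = ≈refl
    monEv-0 {suc n} v = ≈trans (⊗-identityˡ _) (monEv-0 (v ∘ suc))

    monEv-dep : ∀ {n} (v v′ : Env n) e → (∀ x → lookup e x ≡ 0 ⊎ v x ≈ v′ x) → monEv v e ≈ monEv v′ e
    monEv-dep v v′ []      h = ≈refl
    monEv-dep v v′ (k ∷ e) h = *-cong (first k (h zero)) (monEv-dep (v ∘ suc) (v′ ∘ suc) e (h ∘ suc))
      where
      first : ∀ k → k ≡ 0 ⊎ v zero ≈ v′ zero → pow (v zero) k ≈ pow (v′ zero) k
      first .0 (inj₁ refl) = ≈refl
      first k  (inj₂ q)    = pow-cong k q

    monEv-var : ∀ {n} (v : Env n) e x → lookup e x ≡ 1 → (∀ i → i ≢ x → lookup e i ≡ 0) → monEv v e ≈ v x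
    monEv-var v (k ∷ e) zero refl h = ≈trans (*-cong (⊗-identityʳ _) (tl (v ∘ suc) e (λ i → h (suc i) λ ()))) (⊗-identityʳ _)
      where
      tl : ∀ {n} (v : Env n) e → (∀ i → lookup e i ≡ 0) → monEv v e ≈ 1#
      tl v []      h = ≈refl
      tl v (k ∷ e) h rewrite h zero = ≈trans (⊗-identityˡ _) (tl (v ∘ suc) e (h ∘ suc))
    monEv-var v (k ∷ e) (suc x) e1 h rewrite h zero (λ ()) =
      ≈trans (⊗-identityˡ _) (monEv-var (v ∘ suc) e x e1 (λ i ne → h (suc i) (ne ∘ Finₚ.suc-injective)))

    eval : ∀ {n} → Poly F n → Fn n
    eval p v = lin p (monEv v)

    eval-mul : ∀ {n} (p q : Poly F n) v → eval (mulP F p q) v ≈ eval p v ⊗ eval q v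
    eval-mul p q v = begin
      eval (mulP F p q) v                                        ≈⟨ lin-mul p q (monEv v) ⟩
      lin p (λ e → lin q (λ f → monEv v (e ⊞ f)))                ≈⟨ lin-cong p (λ e → inj₂ (≈trans (lin-cong q (λ f → inj₂ (monEv-⊞ v e f))) (≈trans (lin-⊗ q (monEv v e) (monEv v)) (⊗-comm _ _)))) ⟩
      lin p (λ e → eval q v ⊗ monEv v e)                         ≈⟨ lin-⊗ p (eval q v) (monEv v) ⟩
      eval q v ⊗ eval p v                                        ≈⟨ ⊗-comm _ _ ⟩
      eval p v ⊗ eval q v                                        ∎

    eval-const : ∀ {n} a (v : Env n) → eval (constP F a) v ≈ a
    eval-const a v = ≈trans (⊕-identityʳ _) (≈trans (⊗-congˡ (monEv-0 v)) (⊗-identityʳ a))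

    eval-var : ∀ {n} x (v : Env n) → eval (varP F x) v ≈ v x
    eval-var {n} x v = ≈trans (⊕-identityʳ _) (≈trans (⊗-identityˡ _) (monEv-var v e x at-x at-i))
      where
      headMon : Poly F n → Monomial n
      headMon []            = zeroMon F
      headMon ((_ , e) ∷ _) = e
      e = headMon (varP F x)
      -- Recovers the anonymous exponent function inside varP by unification.
      exponents : (f : Fin n → ℕ) → e ≡ Vec.tabulate f → Fin n → ℕ
      exponents f _ = f
      unit = exponents _ refl
      self : unit x ≡ 1
      self with x Fin.≟ x
      ... | yes _ = refl
      ... | no ne = ⊥-elim (ne refl)
      other : ∀ i → i ≢ x → unit i ≡ 0
      other i ne with i Fin.≟ x
      ... | yes eq = ⊥-elim (ne eq)
      ... | no _ = refl
      at-x : lookup e x ≡ 1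
      at-x = trans (Vecₚ.lookup∘tabulate unit x) self
      at-i : ∀ i → i ≢ x → lookup e i ≡ 0
      at-i i ne = trans (Vecₚ.lookup∘tabulate unit i) (other i ne)

    eval-scale : ∀ {n} a (p : Poly F n) v → eval (scaleP F a p) v ≈ a ⊗ eval p v
    eval-scale a p v = ≈trans (⨁-map _ p _) (≈trans (⨁-cong p (λ _ → ⊗-assoc _ _ _)) (⨁-*ˡ p a _))

    -- Because degrees in `x` are compared first, the exponent of `x` in `lead` is the degree of `p`
    -- in `x`; later it is also the test for whether `x` occurs in `p`.
    record Lead {n} (x : Fin n) (p : Poly F n) : Set (c ⊔ ℓ) where
      field
        lead    : Monomial n
        nonzero : ¬ (coeff F p lead ≈ 0#)
        maximal : ∀ e → coeff F p e ≈ 0# ⊎ e ≡ lead ⊎ key x e ≺ key x lead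

    open Lead

    lead-one : ∀ {n} (x : Fin n) → Lead x (oneP F)
    lead-one {n} x = record
      { lead    = zeroMon F
      ; nonzero = λ z → 0≉1 (≈sym (≈trans (≈sym (≈trans (coeff-∷ 1# (zeroMon F {n}) [] (zeroMon F)) (≈trans (⊕-identityʳ _) (δ-same 1# (zeroMon F {n}))))) z))
      ; maximal = max }
      where
      max : ∀ e → coeff F (oneP F) e ≈ 0# ⊎ e ≡ zeroMon F ⊎ key x e ≺ key x (zeroMon F)
      max e with Vecₚ.≡-dec _≟_ (zeroMon F) e
      ... | yes eq = inj₂ (inj₁ (sym eq))
      ... | no  _  = inj₁ ≈refl

    -- By strict monotonicity of the order under `⊞`, no other pair of monomials with nonzero
    -- coefficients has the product `lead P ⊞ lead Q`.
    coeff-mul : ∀ {n} {x : Fin n} {p q : Poly F n} (P : Lead x p) (Q : Lead x q) →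
                coeff F (mulP F p q) (lead P ⊞ lead Q) ≈ coeff F p (lead P) ⊗ coeff F q (lead Q)
    coeff-mul {x = x} {p} {q} P Q = begin
      coeff F (mulP F p q) g                                 ≈⟨ coeff-lin (mulP F p q) g ⟩
      lin (mulP F p q) (λ h → δ 1# h g)                      ≈⟨ lin-mul p q _ ⟩
      lin p (λ e → lin q (λ f → δ 1# (e ⊞ f) g))             ≈⟨ lin-cong p pt ⟩
      lin p (λ e → coeff F q (lead Q) ⊗ δ 1# e (lead P))     ≈⟨ lin-⊗ p _ _ ⟩
      coeff F q (lead Q) ⊗ lin p (λ e → δ 1# e (lead P))     ≈⟨ ⊗-congˡ (coeff-lin p (lead P)) ⟨
      coeff F q (lead Q) ⊗ coeff F p (lead P)                ≈⟨ ⊗-comm _ _ ⟩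
      coeff F p (lead P) ⊗ coeff F q (lead Q)                ∎
      where
      g = lead P ⊞ lead Q
      pt : ∀ e → coeff F p e ≈ 0# ⊎ lin q (λ f → δ 1# (e ⊞ f) g) ≈ coeff F q (lead Q) ⊗ δ 1# e (lead P)
      pt e with maximal P e
      ... | inj₁ z = inj₁ z
      ... | inj₂ (inj₁ refl) = inj₂ (≈trans (lin-cong q (λ f → inj₂ (shift f))) (≈trans (≈sym (coeff-lin q (lead Q)))
          (≈sym (≈trans (⊗-congˡ (δ-same 1# (lead P))) (⊗-identityʳ _)))))
        where
        shift : ∀ f → δ 1# (lead P ⊞ f) g ≈ δ 1# f (lead Q)
        shift f with f ≟M lead Q
        ... | yes refl = δ-same 1# g
        ... | no ne    = δ-diff 1# _ g (ne ∘ ⊞-cancelˡ (lead P) f (lead Q))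
      ... | inj₂ (inj₂ e≺) = inj₂ (≈trans (lin-cong q {ψ = λ _ → 0#} none) (≈trans (lin-zero q)
          (≈sym (≈trans (⊗-congˡ (δ-diff 1# e (lead P) λ { refl → ≺-irrefl (key x e) e≺ })) (⊗-zeroʳ _)))))
        where
        none : ∀ f → coeff F q f ≈ 0# ⊎ δ 1# (e ⊞ f) g ≈ 0#
        none f with maximal Q f
        ... | inj₁ z = inj₁ z
        ... | inj₂ h = inj₂ (δ-diff 1# (e ⊞ f) g (λ eq → ≺-irrefl (key x g) (subst (λ z → key x z ≺ key x g) eq (mul-ltˡ x e (lead P) f (lead Q) e≺ h))))

    lead-mul : ∀ {n} {x : Fin n} {p q : Poly F n} → Lead x p → Lead x q → Lead x (mulP F p q)
    lead-mul {x = x} {p} {q} P Q = record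
      { lead    = g
      ; nonzero = λ z → nonzero-* (nonzero P) (nonzero Q) (≈trans (≈sym (coeff-mul P Q)) z)
      ; maximal = max }
      where
      g = lead P ⊞ lead Q
      max : ∀ h → coeff F (mulP F p q) h ≈ 0# ⊎ h ≡ g ⊎ key x h ≺ key x g
      max h with ≺-tri (key x h) (key x g)
      ... | inj₁ h≺g        = inj₂ (inj₂ h≺g)
      ... | inj₂ (inj₁ eq)  = inj₂ (inj₁ (cong Vec.tail eq))
      ... | inj₂ (inj₂ g≺h) = inj₁ (≈trans (coeff-lin (mulP F p q) h) (≈trans (lin-mul p q _)
          (≈trans (lin-cong p {ψ = λ _ → 0#} outside) (lin-zero p))))
        where
        outside : ∀ e → coeff F p e ≈ 0# ⊎ lin q (λ f → δ 1# (e ⊞ f) h) ≈ 0#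
        outside e with maximal P e
        ... | inj₁ z  = inj₁ z
        ... | inj₂ he = inj₂ (≈trans (lin-cong q {ψ = λ _ → 0#} inside) (lin-zero q))
          where
          below : ∀ f → f ≡ lead Q ⊎ key x f ≺ key x (lead Q) → e ⊞ f ≢ h
          below f hf refl = ≺-irrefl (key x g) (atMost he hf)
            where
            atMost : e ≡ lead P ⊎ key x e ≺ key x (lead P) → f ≡ lead Q ⊎ key x f ≺ key x (lead Q) → key x g ≺ key x g
            atMost (inj₁ refl) (inj₁ refl) = g≺h
            atMost (inj₂ e≺)   (inj₁ refl) = ≺-trans _ _ _ g≺h (mul-ltˡ x e (lead P) f f e≺ (inj₁ refl))
            atMost he          (inj₂ f≺)   = ≺-trans _ _ _ g≺h (mul-lt x e (lead P) f (lead Q) he f≺)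
          inside : ∀ f → coeff F q f ≈ 0# ⊎ δ 1# (e ⊞ f) h ≈ 0#
          inside f with maximal Q f
          ... | inj₁ z  = inj₁ z
          ... | inj₂ hf = inj₂ (δ-diff 1# (e ⊞ f) h (below f hf))

    Decided : ∀ {n} → Poly F n → Set ℓ
    Decided p = ∀ e → coeff F p e ≈ 0# ⊎ ¬ (coeff F p e ≈ 0#)

    -- Only the finitely many monomials listed in `p` need a decision; every other coefficient is
    -- zero.
    ¬¬-decided : ∀ {n} (p : Poly F n) → ¬ ¬ Decided p
    ¬¬-decided p k = on (mons p) λ d → k λ e → case Any.any? (e ≟M_) (mons p) of λ where
        (yes e∈) → d e∈
        (no e∉)  → inj₁ (coeff-∉ p e e∉)
      where
      on : ∀ L → ¬ ¬ (∀ {e} → e ∈ L → coeff F p e ≈ 0# ⊎ ¬ (coeff F p e ≈ 0#))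
      on []      k = k λ ()
      on (e ∷ L) k = on L λ d →
        let k′ = λ d₀ → k λ { (here refl) → d₀ ; (there i) → d i }
        in k′ (inj₂ (λ z → k′ (inj₁ z)))

    zero-or-lead : ∀ {n} (p : Poly F n) → Decided p → (∀ e → coeff F p e ≈ 0#) ⊎ (∀ x → Lead x p)
    zero-or-lead {n} p d with scan (mons p)
      where
      scan : ∀ L → (∀ {e} → e ∈ L → coeff F p e ≈ 0#) ⊎ ∃[ e ] ¬ (coeff F p e ≈ 0#)
      scan []      = inj₁ λ ()
      scan (e ∷ L) with d e | scan L
      ... | inj₂ nz | _      = inj₂ (e , nz)
      ... | inj₁ z  | inj₂ h = inj₂ h
      ... | inj₁ z  | inj₁ h = inj₁ λ { (here refl) → z ; (there i) → h i }
    ... | inj₁ z = inj₁ λ e → case Any.any? (e ≟M_) (mons p) of λ where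
        (yes e∈) → z e∈
        (no e∉)  → coeff-∉ p e e∉
    ... | inj₂ (e₀ , nz) = inj₂ λ x →
        let (m , m≉0 , max) = maxOver x (mons p) in record
          { lead = m ; nonzero = m≉0
          ; maximal = λ e → case Any.any? (e ≟M_) (mons p) of λ where
              (yes e∈) → max e∈
              (no e∉)  → inj₁ (coeff-∉ p e e∉) }
      where
      maxOver : ∀ x L → ∃[ m ] (¬ (coeff F p m ≈ 0#) × (∀ {e} → e ∈ L → coeff F p e ≈ 0# ⊎ e ≡ m ⊎ key x e ≺ key x m))
      maxOver x []      = e₀ , nz , λ ()
      maxOver x (e ∷ L) with maxOver x L | d e
      ... | m , m≉0 , max | inj₁ z  = m , m≉0 , λ { (here refl) → inj₁ z ; (there i) → max i }
      ... | m , m≉0 , max | inj₂ e≉0 with ≺-tri (key x e) (key x m)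
      ...   | inj₁ e≺m         = m , m≉0 , λ { (here refl) → inj₂ (inj₂ e≺m) ; (there i) → max i }
      ...   | inj₂ (inj₁ eq)   = m , m≉0 , λ { (here refl) → inj₂ (inj₁ (cong Vec.tail eq)) ; (there i) → max i }
      ...   | inj₂ (inj₂ m≺e)  = e , e≉0 , λ where
              (here refl) → inj₂ (inj₁ refl)
              (there i) → case max i of λ where
                (inj₁ z)           → inj₁ z
                (inj₂ (inj₁ refl)) → inj₂ (inj₂ m≺e)
                (inj₂ (inj₂ lt))   → inj₂ (inj₂ (≺-trans _ _ _ lt m≺e))

  open Polys public

  -- From multilinear circuits to layered formulas.

  module Circuits where

    open import Relation.Binary.Reasoning.Setoid setoid

    Span : ∀ {n K} → (Fin K → Fn n) → Fn n → Set (c ⊔ ℓ)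
    Span {n} {K} base f = Σ (Fin K → Carrier) λ k → (∀ v → f v ≈ ⨁ (fins K) (λ h → k h ⊗ base h v))

    module _ {n K} (base : Fin K → Fn n) where

      span-cong : ∀ f g → (∀ v → f v ≈ g v) → Span base g → Span base f
      span-cong f g h (k , e) = k , λ v → ≈trans (h v) (e v)

      span-zero : Span base (λ _ → 0#)
      span-zero = (λ _ → 0#) , λ v → ≈sym (≈trans (⨁-cong (fins K) (λ h → ⊗-zeroˡ (base h v))) (⨁-zero (fins K)))

      span-+ : ∀ f g → Span base f → Span base g → Span base (λ v → f v ⊕ g v)
      span-+ f g (k , e) (l , e′) = (λ h → k h ⊕ l h) , λ v → ≈trans (+-cong (e v) (e′ v))
        (≈trans (≈sym (⨁-+ (fins K) _ _)) (⨁-cong (fins K) (λ h → ≈sym (⊗-distribʳ (base h v) (k h) (l h)))))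

      span-scale : ∀ a f → Span base f → Span base (λ v → a ⊗ f v)
      span-scale a f (k , e) = (λ h → a ⊗ k h) , λ v → ≈trans (⊗-congˡ (e v))
        (≈trans (≈sym (⨁-*ˡ (fins K) a _)) (⨁-cong (fins K) (λ h → ≈sym (⊗-assoc a (k h) (base h v)))))

    span-base : ∀ {n K} (base : Fin K → Fn n) h → Span base (base h)
    span-base {n} {suc K} base zero = (λ { zero → 1# ; (suc _) → 0# }) , λ v → ≈sym (≈trans (⨁-fins K _)
      (≈trans (+-cong (⊗-identityˡ _) (≈trans (⨁-cong (fins K) (λ h → ⊗-zeroˡ (base (suc h) v))) (⨁-zero (fins K)))) (⊕-identityʳ _)))
    span-base {n} {suc K} base (suc h) with span-base (base ∘ suc) h
    ... | k , e = (λ { zero → 0# ; (suc i) → k i }) , λ v → ≈trans (e v) (≈sym (≈trans (⨁-fins K _)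
      (≈trans (⊕-congʳ (⊗-zeroˡ _)) (⊕-identityˡ _))))

    affineBase : ∀ {n} → Fin (suc n) → Fn n
    affineBase zero    v = 1#
    affineBase (suc x) v = v x

    Affine : ∀ {n} → Fn n → Set (c ⊔ ℓ)
    Affine = Span affineBase

    record Product {n} (𝒞 : Fn n → Set (c ⊔ ℓ)) (T : Fn n) : Set (c ⊔ ℓ) where
      field
        parts   : ℕ
        part    : Fin n → Fin parts
        factor  : Fin parts → Fn n
        product : ∀ v → T v ≈ ⨂ parts (λ j → factor j v)
        local   : ∀ j v v′ → (∀ x → part x ≡ j → v x ≈ v′ x) → factor j v ≈ factor j v′
        inClass : ∀ j → 𝒞 (factor j)

    -- ΣΠ…ΣΠΣ formulas with d product layers whose sums above the lowest level have s terms.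
    Cls : ∀ {n} → ℕ → ℕ → Fn n → Set (c ⊔ ℓ)
    Cls s zero    f = Affine f
    Cls {n} s (suc d) f = Σ (Fin s → Fn n) λ T → (∀ t → (∀ v → T t v ≈ 0#) ⊎ Product (Cls s d) (T t)) × Span T f

    -- Gates of smaller product-depth are padded by a product with one factor. The fan-in `suc s`
    -- provides the term that holds it; the other terms are zero.
    Cls-suc : ∀ {n} s d (f : Fn n) → Cls (suc s) d f → Cls (suc s) (suc d) f
    Cls-suc {n} s d f h = T , term , span-base T zero
      where
      T : Fin (suc s) → Fn n
      T zero    = f
      T (suc _) = λ _ → 0#
      term : ∀ t → (∀ v → T t v ≈ 0#) ⊎ Product (Cls (suc s) d) (T t)
      term (suc _) = inj₁ λ _ → ≈refl
      term zero    = inj₂ record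
        { parts = 1 ; part = λ _ → zero ; factor = λ _ → f ; product = λ v → ≈sym (⊗-identityʳ _)
        ; local = λ { zero v v′ e → Cls-ext d h v v′ (λ x → e x refl) } ; inClass = λ _ → h }
        where
        Cls-ext : ∀ d {f : Fn n} → Cls (suc s) d f → ∀ v v′ → (∀ x → v x ≈ v′ x) → f v ≈ f v′
        Cls-ext zero    (k , e) v v′ h = ≈trans (e v) (≈trans (⨁-cong (fins (suc n)) (λ { zero → ≈refl ; (suc x) → ⊗-congˡ (h x) })) (≈sym (e v′)))
        Cls-ext (suc d) (T , terms , k , e) v v′ h = ≈trans (e v) (≈trans (⨁-cong (fins (suc s)) (λ t → ⊗-congˡ (ext t (terms t)))) (≈sym (e v′)))
          where
          ext : ∀ t → (∀ v → T t v ≈ 0#) ⊎ Product (Cls (suc s) d) (T t) → T t v ≈ T t v′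
          ext t (inj₁ z) = ≈trans (z v) (≈sym (z v′))
          ext t (inj₂ P) = ≈trans (product v) (≈trans (⨂-cong parts (λ j → local j v v′ (λ x _ → h x))) (≈sym (product v′)))
            where open Product P

    Cls-one : ∀ {n} s d → Cls {n} (suc s) d (λ _ → 1#)
    Cls-one s zero    = span-base affineBase zero
    Cls-one s (suc d) = Cls-suc s d _ (Cls-one s d)

    prodPoly : ∀ {n} → List (Poly F n) → Poly F n
    prodPoly = foldr (mulP F) (oneP F)

    eval-prod : ∀ {n} (ps : List (Poly F n)) v → eval (prodPoly ps) v ≈ ⨂ (length ps) (λ i → eval (Data.List.lookup ps i) v)
    eval-prod []       v = eval-const 1# v
    eval-prod (p ∷ ps) v = ≈trans (eval-mul p (prodPoly ps) v) (⊗-congˡ (eval-prod ps v))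

    open Lead

    lead-prod : ∀ {n} (x : Fin n) (ps : List (Poly F n)) (L : ∀ i → Lead x (Data.List.lookup ps i)) →
      Σ (Lead x (prodPoly ps)) λ l → lookup (lead l) x ≡ ∑ (fins (length ps)) (λ i → lookup (lead (L i)) x)
    lead-prod x []       L = lead-one x , Vecₚ.lookup-replicate x 0
    lead-prod x (p ∷ ps) L with lead-prod x ps (L ∘ suc)
    ... | l , e = lead-mul (L zero) l , trans (Vecₚ.lookup-zipWith _+_ x (lead (L zero)) (lead l))
      (trans (cong (lookup (lead (L zero)) x +_) e) (sym (∑-fins (length ps) (λ i → lookup (lead (L i)) x))))

    -- For every variable `x` the factors are compared by the order that puts `x` first. The leading
    -- exponents of `x` add up to an exponent of a monomial with nonzero coefficient, hence to at
    -- most 1, so `x` has positive degree in at most one factor.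
    product-term : ∀ {n} s d (ps : List (Poly F n)) → IsMultilinear F (prodPoly ps) →
      (∀ i → Decided (Data.List.lookup ps i)) → (∀ i → Cls (suc s) d (eval (Data.List.lookup ps i))) →
      (∀ v → eval (prodPoly ps) v ≈ 0#) ⊎ Product (Cls (suc s) d) (eval (prodPoly ps))
    product-term {n} s d ps ml dec cls with fin-search (length ps) (λ i → zero-or-lead (Data.List.lookup ps i) (dec i))
    ... | inj₁ (i , z) = inj₁ λ v → ≈trans (eval-prod ps v) (⨂-zero (length ps) i
          (≈trans (lin-cong (Data.List.lookup ps i) {ψ = λ _ → 0#} (inj₁ ∘ z)) (lin-zero (Data.List.lookup ps i))))
    ... | inj₂ L = inj₂ record
      -- Part `zero` collects the variables that occur in no factor; its factor is the constant 1.
      { parts = suc (length ps) ; part = part ; factor = factor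
      ; product = λ v → ≈trans (eval-prod ps v) (≈sym (⊗-identityˡ _))
      ; local = local ; inClass = inClass }
      where
      R = length ps
      deg : Fin n → Fin R → ℕ
      deg x i = lookup (lead (L i x)) x
      ∑deg≤1 : ∀ x → ∑ (fins R) (deg x) ≤ 1
      ∑deg≤1 x with lead-prod x ps (λ i → L i x)
      ... | l , e with 2 ≤? lookup (lead l) x
      ...   | yes 2≤ = ⊥-elim (nonzero l (ml (lead l) (x , 2≤)))
      ...   | no ≰   = subst (_≤ 1) e (≤-pred (≰⇒> ≰))
      part : Fin n → Fin (suc R)
      part x with Finₚ.any? (λ i → 1 ≤? deg x i)
      ... | yes (i , _) = suc i
      ... | no _        = zero
      part-deg : ∀ x i → 1 ≤ deg x i → part x ≡ suc i
      part-deg x i h with Finₚ.any? (λ i → 1 ≤? deg x i)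
      ... | yes (j , h′) = cong suc (∑≤1-unique (deg x) (∑deg≤1 x) j i h′ h)
      ... | no none      = ⊥-elim (none (i , h))
      factor : Fin (suc R) → Fn n
      factor zero    v = 1#
      factor (suc i) v = eval (Data.List.lookup ps i) v
      inClass : ∀ j → Cls (suc s) d (factor j)
      inClass zero    = Cls-one s d
      inClass (suc i) = cls i
      local : ∀ j v v′ → (∀ x → part x ≡ j → v x ≈ v′ x) → factor j v ≈ factor j v′
      local zero    v v′ h = ≈refl
      local (suc i) v v′ h = lin-cong (Data.List.lookup ps i) pt
        where
        pt : ∀ e → coeff F (Data.List.lookup ps i) e ≈ 0# ⊎ monEv v e ≈ monEv v′ e
        pt e with dec i e
        ... | inj₁ z  = inj₁ z
        ... | inj₂ nz = inj₂ (monEv-dep v v′ e var)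
          where
          e≤ : ∀ x → lookup e x ≤ deg x i
          e≤ x with maximal (L i x) e
          ... | inj₁ z                       = ⊥-elim (nz z)
          ... | inj₂ (inj₁ refl)             = ≤-refl
          ... | inj₂ (inj₂ (inj₁ lt))        = <⇒≤ lt
          ... | inj₂ (inj₂ (inj₂ (eq , _)))  = ≤-reflexive eq
          var : ∀ x → lookup e x ≡ 0 ⊎ v x ≈ v′ x
          var x with lookup e x in eq
          ... | zero  = inj₁ refl
          ... | suc k = inj₂ (h x (part-deg x i (≤-trans (s≤s z≤n) (≤-trans (≤-reflexive (sym eq)) (e≤ x)))))

    sumGate : ∀ {n K} → Circuit F n K → Fin K → Bool
    sumGate (C ▷ g)      (suc j) = sumGate C j
    sumGate (C ▷ sumG _) zero    = true
    sumGate (C ▷ _)      zero    = false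

    pd-suc : ∀ {n K} (C : Circuit F n K) g j → gatePD F (C ▷ g) (suc j) ≡ gatePD F C j
    pd-suc C (input _) j = refl
    pd-suc C (const _) j = refl
    pd-suc C (sumG _)  j = refl
    pd-suc C (prodG _) j = refl

    -- Sum gates feed other sum gates without raising the product-depth. Such nested sums collapse
    -- into a single linear combination of gates that are not sums.
    closure : ∀ {n K p} (C : Circuit F n K) D (𝒫 : Fn n → Set p) →
      (∀ f g → (∀ v → f v ≈ g v) → 𝒫 g → 𝒫 f) → 𝒫 (λ _ → 0#) →
      (∀ f g → 𝒫 f → 𝒫 g → 𝒫 (λ v → f v ⊕ g v)) → (∀ a f → 𝒫 f → 𝒫 (λ v → a ⊗ f v)) →
      (∀ h → sumGate C h ≡ false → gatePD F C h ≤ D → 𝒫 (eval (gatePoly F C h))) →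
      ∀ j → gatePD F C j ≤ D → 𝒫 (eval (gatePoly F C j))
    closure (C ▷ g) D 𝒫 cg z pl sc base (suc j) h = closure C D 𝒫 cg z pl sc
      (λ i ns pd → base (suc i) ns (≤-trans (≤-reflexive (pd-suc C g i)) pd)) j (≤-trans (≤-reflexive (sym (pd-suc C g j))) h)
    closure (C ▷ input x) D 𝒫 cg z pl sc base zero h = base zero refl h
    closure (C ▷ const a) D 𝒫 cg z pl sc base zero h = base zero refl h
    closure (C ▷ prodG x) D 𝒫 cg z pl sc base zero h = base zero refl h
    closure (C ▷ sumG cs) D 𝒫 cg z pl sc base zero h = go cs h
      where
      go : ∀ cs → foldr (λ { (_ , j) acc → Data.Nat._⊔_ (gatePD F C j) acc }) 0 cs ≤ D →
           𝒫 (eval (concatMap (λ { (a , j) → scaleP F a (gatePoly F C j) }) cs))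
      go []             _ = z
      go ((a , j) ∷ cs) h = cg _ _
        (λ v → ≈trans (⨁-++ (scaleP F a (gatePoly F C j)) _ _) (⊕-congʳ (eval-scale a (gatePoly F C j) v)))
        (pl _ _ (sc a _ (closure C D 𝒫 cg z pl sc (λ i ns pd → base (suc i) ns pd) j (m⊔n≤o⇒m≤o _ _ h))) (go cs (m⊔n≤o⇒n≤o (gatePD F C j) _ h)))

    leaf-affine : ∀ {n K} (C : Circuit F n K) h → sumGate C h ≡ false → gatePD F C h ≤ 0 → Affine (eval (gatePoly F C h))
    leaf-affine (C ▷ g) (suc h) ns pd = leaf-affine C h ns (≤-trans (≤-reflexive (sym (pd-suc C g h))) pd)
    leaf-affine (C ▷ input x) zero ns pd = span-cong affineBase _ _ (eval-var x) (span-base affineBase (suc x))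
    leaf-affine (C ▷ const a) zero ns pd = span-cong affineBase _ (λ v → a ⊗ 1#) (λ v → ≈trans (eval-const a v) (≈sym (⊗-identityʳ a)))
      (span-scale affineBase a (λ _ → 1#) (span-base affineBase zero))

    product-view : ∀ {n K} (C : Circuit F n K) h → sumGate C h ≡ false → gatePD F C h ≤ 0 ⊎
      Σ (List (Poly F n)) λ ps → gatePoly F C h ≡ prodPoly ps ×
        (∀ i → ∃[ j ] (Data.List.lookup ps i ≡ gatePoly F C j × gatePD F C j < gatePD F C h))
    product-view (C ▷ g) (suc h) ns with product-view C h ns
    ... | inj₁ pd = inj₁ (≤-trans (≤-reflexive (pd-suc C g h)) pd)
    ... | inj₂ (ps , e , ch) = inj₂ (ps , e , λ i → let (j , eq , lt) = ch i in
          suc j , eq , subst₂ _<_ (sym (pd-suc C g j)) (sym (pd-suc C g h)) lt)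
    product-view (C ▷ input x)  zero ns = inj₁ z≤n
    product-view (C ▷ const a)  zero ns = inj₁ z≤n
    product-view (C ▷ prodG js) zero ns = inj₂ (map (gatePoly F C) js , unfold js , λ i → let (j , eq , lt) = children js i in suc j , eq , lt)
      where
      unfold : ∀ js → foldr (λ j acc → mulP F (gatePoly F C j) acc) (oneP F) js ≡ prodPoly (map (gatePoly F C) js)
      unfold []       = refl
      unfold (j ∷ js) = cong (mulP F (gatePoly F C j)) (unfold js)
      children : ∀ js i → ∃[ j ] (Data.List.lookup (map (gatePoly F C) js) i ≡ gatePoly F C j ×
        gatePD F C j < suc (foldr (λ j acc → Data.Nat._⊔_ (gatePD F C j) acc) 0 js))
      children (j ∷ js) zero    = j , refl , s≤s (m≤m⊔n _ _)
      children (j ∷ js) (suc i) = let (j′ , e , lt) = children js i in j′ , e , ≤-trans lt (s≤s (m≤n⊔m (gatePD F C j) _))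

    -- Each sum ranges over all gates of the circuit, with sum gates and gates that are too deep
    -- replaced by 0. Hence the fan-in is the size of the circuit. The formula itself may be much
    -- larger, but only its fan-in enters the rank bound.
    circuit-class : ∀ {n k} (C : Circuit F n (suc k)) → (∀ j → Decided (gatePoly F C j)) → IsMultilinearCircuit F C →
      ∀ d j → gatePD F C j ≤ d → Cls (suc k) d (eval (gatePoly F C j))
    circuit-class C dec ml zero j pd = closure C 0 Affine (span-cong affineBase) (span-zero affineBase) (span-+ affineBase) (span-scale affineBase) (leaf-affine C) j pd
    circuit-class {n} {k} C dec ml (suc d) j pd =
      base , term , closure C (suc d) (Span base) (span-cong base) (span-zero base) (span-+ base) (span-scale base) fromBase j pd
      where
      sel : Fin (suc k) → Bool
      sel h = not (sumGate C h) ∧ does (gatePD F C h ≤? suc d)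
      base : Fin (suc k) → Fn n
      base h v = if sel h then eval (gatePoly F C h) v else 0#
      fromBase : ∀ h → sumGate C h ≡ false → gatePD F C h ≤ suc d → Span base (eval (gatePoly F C h))
      fromBase h ns pd = span-cong base _ (base h) (λ v → ≈reflexive (cong (λ b → if b then eval (gatePoly F C h) v else 0#) (sym selh))) (span-base base h)
        where
        selh : sel h ≡ true
        selh rewrite ns = dec-true (gatePD F C h ≤? suc d) pd
      whole : ∀ h → sumGate C h ≡ false → gatePD F C h ≤ suc d →
              (∀ v → eval (gatePoly F C h) v ≈ 0#) ⊎ Product (Cls (suc k) d) (eval (gatePoly F C h))
      whole h ns pd with product-view C h ns
      -- An input or constant gate enters as the one-factor product supplied by `Cls-suc`.
      ... | inj₁ pd0 = proj₁ (proj₂ (Cls-suc k d _ (circuit-class C dec ml d h (≤-trans pd0 z≤n)))) zero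
      ... | inj₂ (ps , e , ch) = subst (λ q → (∀ v → eval q v ≈ 0#) ⊎ Product (Cls (suc k) d) (eval q)) (sym e)
        (product-term k d ps (subst (IsMultilinear F) e (ml h))
          (λ i → let (j , eq , _) = ch i in subst Decided (sym eq) (dec j))
          (λ i → let (j , eq , lt) = ch i in subst (λ q → Cls (suc k) d (eval q)) (sym eq) (circuit-class C dec ml d j (≤-pred (≤-trans lt pd)))))
      term : ∀ h → (∀ v → base h v ≈ 0#) ⊎ Product (Cls (suc k) d) (base h)
      term h with sumGate C h in ns | gatePD F C h ≤ᵇ suc d in pd
      ... | true  | _     = inj₁ λ _ → ≈refl
      ... | false | false = inj₁ λ _ → ≈refl
      ... | false | true  = whole h ns (≤ᵇ⇒≤ _ _ (subst Data.Bool.T (sym pd) tt))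

  open Circuits public

  module _ (m : ℕ) (i₀ : Fin m) where

    open Restrictions m

    -- Values of restricted blocks.

    module Values where

      open import Relation.Binary.Reasoning.Setoid setoid

      -- The sign makes `y + z` vanish exactly for equal bits in every characteristic; with `+` for
      -- both, `1 + 1` would be nonzero outside characteristic 2.
      Y Z : Bool → Carrier
      Y a = if a then 1# else 0#
      Z b = ⊖ (Y b)

      valS : Status → Bool → Bool → Carrier
      valS S0 a b = 0#
      valS S1 a b = 1#
      valS SY a b = Y a
      valS SZ a b = Z b

      0⊕⊖0 : 0# ⊕ ⊖ 0# ≈ 0#
      0⊕⊖0 = ⊖-inverseʳ 0#

      YZ-zero : ∀ a b → a ≡ b → Y a ⊕ Z b ≈ 0#
      YZ-zero a .a refl = ⊖-inverseʳ (Y a)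

      YZ-nonzero : ∀ a b → a ≢ b → ¬ (Y a ⊕ Z b ≈ 0#)
      YZ-nonzero true  true  ne _ = ne refl
      YZ-nonzero false false ne _ = ne refl
      YZ-nonzero true  false ne e = 0≉1 (≈trans (≈sym e) (≈trans (⊕-congˡ (≈trans (≈sym (⊕-identityˡ _)) 0⊕⊖0)) (⊕-identityʳ 1#)))
      YZ-nonzero false true  ne e = 0≉1 (begin
        0#              ≈⟨ ⊖-inverseʳ 1# ⟨
        1# ⊕ ⊖ 1#       ≈⟨ ⊕-congˡ (≈trans (≈sym (⊕-identityˡ _)) e) ⟩
        1# ⊕ 0#         ≈⟨ ⊕-identityʳ 1# ⟩
        1#              ∎)

      half : (Bool → Bool → Carrier) → Carrier
      half e = e false false ⊗ e false true ⊕ e true false ⊗ e true true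

      curry³ : (Leaf 0 → Carrier) → Bool → Bool → Bool → Carrier
      curry³ e h g j = e (h , g , j)

      ev : ∀ d → (Leaf d → Carrier) → Carrier
      ev zero    e = half (curry³ e false) ⊗ half (curry³ e true)
      ev (suc d) e = ⨂ m (λ i → ev d (λ l → e (i , true , l)) ⊕ ev d (λ l → e (i , false , l)))

      half-cong : ∀ e e′ → (∀ g j → e g j ≈ e′ g j) → half e ≈ half e′
      half-cong e e′ h = +-cong (*-cong (h _ _) (h _ _)) (*-cong (h _ _) (h _ _))

      ev-cong : ∀ d {e e′} → (∀ l → e l ≈ e′ l) → ev d e ≈ ev d e′
      ev-cong zero    {e} {e′} h = *-cong (half-cong (curry³ e false) (curry³ e′ false) (λ g j → h _)) (half-cong (curry³ e true) (curry³ e′ true) (λ g j → h _))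
      ev-cong (suc d) h = ⨂-cong m (λ i → +-cong (ev-cong d (λ l → h _)) (ev-cong d (λ l → h _)))

      -- At positive levels the product has to be nonempty; `i₀` provides a factor that vanishes.
      ev-zero : ∀ d {e} → (∀ l → e l ≈ 0#) → ev d e ≈ 0#
      ev-zero zero    h = ≈trans (⊗-congʳ (≈trans (+-cong (≈trans (⊗-congʳ (h _)) (⊗-zeroˡ _)) (≈trans (⊗-congʳ (h _)) (⊗-zeroˡ _))) (⊕-identityˡ 0#))) (⊗-zeroˡ _)
      ev-zero (suc d) h = ⨂-zero m i₀ (≈trans (+-cong (ev-zero d (λ l → h _)) (ev-zero d (λ l → h _))) (⊕-identityˡ 0#))

      -- All free variables receive the same value `u`. Under `oneSt` no variable is free and under
      -- `leafSt` only one can be, so this covers every assignment there.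
      statV : Carrier → Status → Carrier
      statV u S0 = 0#
      statV u S1 = 1#
      statV u SY = u
      statV u SZ = u

      half-one : ∀ (e : Bool → Bool → Carrier) → e false false ≈ 1# → e false true ≈ 1# → e true false ≈ 0# → half e ≈ 1#
      half-one e p q r = ≈trans (+-cong (≈trans (*-cong p q) (⊗-identityˡ 1#)) (≈trans (⊗-congʳ r) (⊗-zeroˡ _))) (⊕-identityʳ 1#)

      ev-one : ∀ d u {e} → (∀ l → e l ≈ statV u (oneSt d l)) → ev d e ≈ 1#
      ev-one zero    u {e} h = ≈trans (*-cong (half-one (curry³ e false) (h (false , false , false)) (h (false , false , true)) (h (false , true , false)))
                                             (half-one (curry³ e true) (h (true , false , false)) (h (true , false , true)) (h (true , true , false)))) (⊗-identityˡ 1#)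
      ev-one (suc d) u h = ⨂-one m (λ i → ≈trans (+-cong (ev-one d u (λ l → h _)) (ev-zero d (λ l → h _))) (⊕-identityʳ 1#))

      ⨂-single : ∀ n (f : Fin n → Carrier) i → (∀ i′ → i′ ≢ i → f i′ ≈ 1#) → ⨂ n f ≈ f i
      ⨂-single (suc n) f zero    h = ≈trans (⊗-congˡ (⨂-one n (λ i → h (suc i) λ ()))) (⊗-identityʳ _)
      ⨂-single (suc n) f (suc i) h = ≈trans (⊗-congʳ (h zero λ ())) (≈trans (⊗-identityˡ _)
        (⨂-single n (f ∘ suc) i (λ i′ ne → h (suc i′) (ne ∘ Finₚ.suc-injective))))

      half-leaf : ∀ w g j (e : Bool → Bool → Carrier) →
        (∀ g′ j′ → e g′ j′ ≈ (if same g g′ then (if same j j′ then w else 1#) else 0#)) → half e ≈ w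
      half-leaf w true  true  e h = ≈trans (+-cong (≈trans (⊗-congʳ (h _ _)) (⊗-zeroˡ _)) (≈trans (*-cong (h _ _) (h _ _)) (⊗-identityˡ w))) (⊕-identityˡ w)
      half-leaf w true  false e h = ≈trans (+-cong (≈trans (⊗-congʳ (h _ _)) (⊗-zeroˡ _)) (≈trans (*-cong (h _ _) (h _ _)) (⊗-identityʳ w))) (⊕-identityˡ w)
      half-leaf w false true  e h = ≈trans (+-cong (≈trans (*-cong (h _ _) (h _ _)) (⊗-identityˡ w)) (≈trans (⊗-congʳ (h _ _)) (⊗-zeroˡ _))) (⊕-identityʳ w)
      half-leaf w false false e h = ≈trans (+-cong (≈trans (*-cong (h _ _) (h _ _)) (⊗-identityʳ w)) (≈trans (⊗-congʳ (h _ _)) (⊗-zeroˡ _))) (⊕-identityʳ w)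

      if-statV : ∀ u s p q → statV u (if p then (if q then s else S1) else S0) ≡ (if p then (if q then statV u s else 1#) else 0#)
      if-statV u s true  true  = refl
      if-statV u s true  false = refl
      if-statV u s false q     = refl

      ev-leaf : ∀ d u s y {e} → (∀ l → e l ≈ statV u (leafSt d s y l)) → ev d e ≈ statV u s
      ev-leaf zero u s (false , g , j) {e} h = ≈trans (*-cong
        (half-leaf (statV u s) g j (curry³ e false) (λ g′ j′ → ≈trans (h (false , g′ , j′)) (≈reflexive (if-statV u s (same g g′) (same j j′)))))
        (half-one (curry³ e true) (h (true , false , false)) (h (true , false , true)) (h (true , true , false)))) (⊗-identityʳ _)
      ev-leaf zero u s (true , g , j) {e} h = ≈trans (*-cong
        (half-one (curry³ e false) (h (false , false , false)) (h (false , false , true)) (h (false , true , false)))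
        (half-leaf (statV u s) g j (curry³ e true) (λ g′ j′ → ≈trans (h (true , g′ , j′)) (≈reflexive (if-statV u s (same g g′) (same j j′)))))) (⊗-identityˡ _)
      ev-leaf (suc d) u s (i , c , y) {e} h = ≈trans (⨂-single m _ i other) (mine c h)
        where
        other : ∀ i′ → i′ ≢ i → ev d (λ l → e (i′ , true , l)) ⊕ ev d (λ l → e (i′ , false , l)) ≈ 1#
        other i′ ne = ≈trans (+-cong (ev-one d u (λ l → ≈trans (h _) (≈reflexive (cong (λ b → statV u (if b then (if same c true then leafSt d s y l else S0) else oneSt d l)) i≠))))
                                     (ev-zero d (λ l → ≈trans (h _) (≈reflexive (cong (λ b → statV u (if b then (if same c false then leafSt d s y l else S0) else S0)) i≠)))))
                             (⊕-identityʳ 1#)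
          where
          i≠ : (i == i′) ≡ false
          i≠ = dec-false (i Fin.≟ i′) (ne ∘ sym)
        mine : ∀ c → (∀ l → e l ≈ statV u (leafSt (suc d) s (i , c , y) l)) → ev d (λ l → e (i , true , l)) ⊕ ev d (λ l → e (i , false , l)) ≈ statV u s
        mine true  h = ≈trans (+-cong (ev-leaf d u s y (λ l → ≈trans (h _) (≈reflexive (cong (λ b → statV u (if b then leafSt d s y l else oneSt d l)) (==-refl i)))))
                                      (ev-zero d (λ l → ≈trans (h _) (≈reflexive (cong (λ b → statV u (if b then S0 else S0)) (==-refl i))))))
                              (⊕-identityʳ _)
        mine false h = ≈trans (+-cong (ev-zero d (λ l → ≈trans (h _) (≈reflexive (cong (λ b → statV u (if b then S0 else oneSt d l)) (==-refl i)))))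
                                      (ev-leaf d u s y (λ l → ≈trans (h _) (≈reflexive (cong (λ b → statV u (if b then leafSt d s y l else S0)) (==-refl i))))))
                              (⊕-identityˡ _)

      val-statV : ∀ t α β u → (alive t ≡ true → valS t α β ≈ u) → valS t α β ≈ statV u t
      val-statV S0 α β u h = ≈refl
      val-statV S1 α β u h = ≈refl
      val-statV SY α β u h = h refl
      val-statV SZ α β u h = h refl

      ev-one-val : ∀ d (a b : Leaf d → Bool) → ev d (λ l → valS (oneSt d l) (a l) (b l)) ≈ 1#
      ev-one-val d a b = ev-one d 0# (λ l → val-statV (oneSt d l) _ _ 0# (λ al → case trans (sym al) (oneSt-fixed d l) of λ ()))

      ev-leaf-val : ∀ d s → alive s ≡ true → ∀ y (a b : Leaf d → Bool) → ev d (λ l → valS (leafSt d s y l) (a l) (b l)) ≈ valS s (a y) (b y)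
      ev-leaf-val d s al y a b = ≈trans (ev-leaf d u s y (λ l → val-statV (leafSt d s y l) _ _ u (at-y l))) (statV-alive s al)
        where
        u = valS s (a y) (b y)
        at-y : ∀ l → alive (leafSt d s y l) ≡ true → valS (leafSt d s y l) (a l) (b l) ≈ u
        at-y l al with leafSt-alive d s y l al
        ... | refl = ≈reflexive (cong (λ t → valS t (a y) (b y)) (leafSt-self d s y))
        statV-alive : ∀ s → alive s ≡ true → statV u s ≈ u
        statV-alive SY _ = ≈refl
        statV-alive SZ _ = ≈refl

      blockVal : ∀ d {N} → Seeds d N → Fin N → (a b : Bool × Leaf d → Bool) → Carrier
      blockVal d ω i a b = ev d (λ l → valS (st d ω i true l) (a (true , l)) (b (true , l)))
                         ⊕ ev d (λ l → valS (st d ω i false l) (a (false , l)) (b (false , l)))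

      pair-value : ∀ d y z (a b : Bool × Leaf d → Bool) →
        ev d (λ l → valS (leafSt d SY y l) (a (true , l)) (b (true , l))) ⊕
        ev d (λ l → valS (leafSt d SZ z l) (a (false , l)) (b (false , l))) ≈ Y (a (true , y)) ⊕ Z (b (false , z))
      pair-value d y z a b = +-cong (ev-leaf-val d SY refl y (λ l → a (true , l)) (λ l → b (true , l)))
                                    (ev-leaf-val d SZ refl z (λ l → a (false , l)) (λ l → b (false , l)))

      one-value : ∀ d (a b : Bool × Leaf d → Bool) →
        ev d (λ l → valS (oneSt d l) (a (true , l)) (b (true , l))) ⊕ ev d (λ l → 0#) ≈ 1#
      one-value d a b = ≈trans (+-cong (ev-one-val d (λ l → a (true , l)) (λ l → b (true , l))) (ev-zero d (λ l → ≈refl))) (⊕-identityʳ 1#)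

      quad-value : ∀ (a b : Bool × Leaf 0 → Bool) →
        ev 0 (λ l → valS (quadSt l) (a (true , l)) (b (true , l))) ⊕ ev 0 (λ l → 0#) ≈
        (Y (a (true , false , false , false)) ⊕ Z (b (true , false , true , false))) ⊗ (Y (a (true , true , false , false)) ⊕ Z (b (true , true , true , false)))
      quad-value a b = ≈trans (+-cong (*-cong (+-cong (⊗-identityʳ _) (⊗-identityʳ _)) (+-cong (⊗-identityʳ _) (⊗-identityʳ _))) (ev-zero 0 (λ l → ≈refl))) (⊕-identityʳ _)

      -- Every term `y + z = a - b` of the restricted block is nonzero at these assignments. As the
      -- block is the product of such terms, it is nonzero then, and it vanishes as soon as one term
      -- fails.
      Separated : ∀ d {N} → Seeds d N → Fin N → (a b : Bool × Leaf d → Bool) → Set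
      Separated d ω i a b = ∀ c l → st d ω i c l ≡ SY → a (c , l) ≢ b (partner d ω i (c , l))

      block-nonzero : ∀ d {N} (ω : Seeds d N) i a b → Separated d ω i a b → ¬ (blockVal d ω i a b ≈ 0#)
      block-nonzero zero ω i a b sep with lookup ω i
      ... | fixed     = λ e → 0≉1 (≈trans (≈sym e) (one-value 0 a b))
      ... | quad     = λ e → nonzero-* (YZ-nonzero _ _ (sep true (false , false , false) refl)) (YZ-nonzero _ _ (sep true (true , false , false) refl))
                         (≈trans (≈sym (quad-value a b)) e)
      ... | pair y z = λ e → YZ-nonzero _ _ (sep true y (leafSt-self 0 SY y)) (≈trans (≈sym (pair-value 0 y z a b)) e)
      block-nonzero (suc d) (τ , ω) i a b sep with lookup τ i
      ... | split , true  , y , z = λ e → YZ-nonzero _ _ (sep true y (leafSt-self (suc d) SY y)) (≈trans (≈sym (pair-value (suc d) y z a b)) e)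
      ... | split , false , y , z = λ e → 0≉1 (≈trans (≈sym e) (one-value (suc d) a b))
      ... | left  , _ = λ e → ⨂-nonzero m
              (λ i′ → block-nonzero d ω (combine i i′) (λ { (c , l) → a (true , i′ , c , l) }) (λ { (c , l) → b (true , i′ , c , l) })
                (λ c l → sep true (i′ , c , l)))
              (≈trans (≈sym (≈trans (⊕-congˡ (ev-zero (suc d) (λ l → ≈refl))) (⊕-identityʳ _))) e)
      ... | right , _ = λ e → ⨂-nonzero m
              (λ i′ → block-nonzero d ω (combine i i′) (λ { (c , l) → a (false , i′ , c , l) }) (λ { (c , l) → b (false , i′ , c , l) })
                (λ c l → sep false (i′ , c , l)))
              (≈trans (≈sym (≈trans (⊕-congʳ (ev-zero (suc d) (λ l → ≈refl))) (⊕-identityˡ _))) e)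

      block-zero : ∀ d {N} (ω : Seeds d N) i a b c l → st d ω i c l ≡ SY → a (c , l) ≡ b (partner d ω i (c , l)) → blockVal d ω i a b ≈ 0#
      block-zero zero ω i a b c l sy eq with lookup ω i
      block-zero zero ω i a b true l sy eq | fixed with trans (sym (cong alive sy)) (oneSt-fixed 0 l)
      ... | ()
      block-zero zero ω i a b true (false , false , false) sy eq | quad = ≈trans (quad-value a b) (≈trans (⊗-congʳ (YZ-zero _ _ eq)) (⊗-zeroˡ _))
      block-zero zero ω i a b true (true  , false , false) sy eq | quad = ≈trans (quad-value a b) (≈trans (⊗-congˡ (YZ-zero _ _ eq)) (⊗-zeroʳ _))
      block-zero zero ω i a b true l sy eq | pair y z with leafSt-alive 0 SY y l (cong alive sy)
      ... | refl = ≈trans (pair-value 0 y z a b) (YZ-zero _ _ eq)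
      block-zero zero ω i a b false l sy eq | pair y z with leafSt-alive 0 SZ z l (cong alive sy)
      ... | refl = case trans (sym sy) (leafSt-self 0 SZ z) of λ ()
      block-zero (suc d) (τ , ω) i a b c l sy eq with lookup τ i
      block-zero (suc d) (τ , ω) i a b true l sy eq | split , true , y , z with leafSt-alive (suc d) SY y l (cong alive sy)
      ... | refl = ≈trans (pair-value (suc d) y z a b) (YZ-zero _ _ eq)
      block-zero (suc d) (τ , ω) i a b false l sy eq | split , true , y , z with leafSt-alive (suc d) SZ z l (cong alive sy)
      ... | refl = case trans (sym sy) (leafSt-self (suc d) SZ z) of λ ()
      block-zero (suc d) (τ , ω) i a b true l sy eq | split , false , y , z with trans (sym (cong alive sy)) (oneSt-fixed (suc d) l)
      ... | ()
      block-zero (suc d) (τ , ω) i a b true (i′ , c , l) sy eq | left , _ =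
        ≈trans (+-cong (⨂-zero m i′ (block-zero d ω (combine i i′) (λ { (c , l) → a (true , i′ , c , l) }) (λ { (c , l) → b (true , i′ , c , l) }) c l sy eq))
                       (ev-zero (suc d) (λ l → ≈refl))) (⊕-identityˡ 0#)
      block-zero (suc d) (τ , ω) i a b false (i′ , c , l) sy eq | right , _ =
        ≈trans (+-cong (ev-zero (suc d) (λ l → ≈refl))
                       (⨂-zero m i′ (block-zero d ω (combine i i′) (λ { (c , l) → a (false , i′ , c , l) }) (λ { (c , l) → b (false , i′ , c , l) }) c l sy eq))) (⊕-identityˡ 0#)

    open Values public

    -- The hard polynomial attains the trivial rank bound under every restriction.

    module Hard where

      open import Relation.Binary.Reasoning.Setoid setoid

      bit : Bool → Fin 2
      bit false = zero
      bit true  = suc zero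

      unbit : Fin 2 → Bool
      unbit zero       = false
      unbit (suc zero) = true

      unbit-bit : ∀ b → unbit (bit b) ≡ b
      unbit-bit true  = refl
      unbit-bit false = refl

      bit-unbit : ∀ i → bit (unbit i) ≡ i
      bit-unbit zero       = refl
      bit-unbit (suc zero) = refl

      -- Side `true` is the first copy, which `embedP` places in half `zero`; hence the `not`.
      idx : ∀ d → Leaf d → Fin (numVars F m d)
      idx zero    (h , g , j) = combine (bit h) (combine (bit g) (bit j))
      idx (suc d) (i , s , l) = combine i (combine (bit (not s)) (idx d l))

      unidx : ∀ d → Fin (numVars F m d) → Leaf d
      unidx zero x = let (h , r) = remQuot {2} 4 x ; (g , j) = remQuot {2} 2 r in unbit h , unbit g , unbit j
      unidx (suc d) x = let (i , r) = remQuot {m} (2 * numVars F m d) x ; (s , l) = remQuot {2} (numVars F m d) r in i , not (unbit s) , unidx d l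

      unidx-idx : ∀ d l → unidx d (idx d l) ≡ l
      unidx-idx zero (true  , true  , true ) = refl
      unidx-idx zero (true  , true  , false) = refl
      unidx-idx zero (true  , false , true ) = refl
      unidx-idx zero (true  , false , false) = refl
      unidx-idx zero (false , true  , true ) = refl
      unidx-idx zero (false , true  , false) = refl
      unidx-idx zero (false , false , true ) = refl
      unidx-idx zero (false , false , false) = refl
      unidx-idx (suc d) (i , s , l) = trans
        (cong (λ p → let (s , l) = remQuot {2} (numVars F m d) (proj₂ p) in proj₁ p , not (unbit s) , unidx d l)
          (Finₚ.remQuot-combine {m} {2 * numVars F m d} i (combine (bit (not s)) (idx d l)))) (trans
        (cong (λ p → i , not (unbit (proj₁ p)) , unidx d (proj₂ p)) (Finₚ.remQuot-combine {2} {numVars F m d} (bit (not s)) (idx d l)))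
        (cong₂ (λ b l → i , b , l) (trans (cong not (unbit-bit (not s))) (Boolₚ.not-involutive s)) (unidx-idx d l)))

      idx-unidx : ∀ d x → idx d (unidx d x) ≡ x
      idx-unidx zero x = trans (cong₂ (combine {2} {4}) (bit-unbit (proj₁ p)) (trans
          (cong₂ (combine {2} {2}) (bit-unbit (proj₁ q)) (bit-unbit (proj₂ q)))
          (Finₚ.combine-remQuot {2} 2 (proj₂ p)))) (Finₚ.combine-remQuot {2} 4 x)
        where
        p = remQuot {2} 4 x
        q = remQuot {2} 2 (proj₂ p)
      idx-unidx (suc d) x = trans (cong (combine {m} {2 * k} (proj₁ p)) (trans
          (cong₂ (combine {2} {k}) (trans (cong bit (Boolₚ.not-involutive (unbit (proj₁ q)))) (bit-unbit (proj₁ q))) (idx-unidx d (proj₂ q)))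
          (Finₚ.combine-remQuot {2} k (proj₂ p)))) (Finₚ.combine-remQuot {m} (2 * k) x)
        where
        k = numVars F m d
        p = remQuot {m} (2 * k) x
        q = remQuot {2} k (proj₂ p)

      monEv-++ : ∀ {k n} (v : Env (k + n)) (e : Monomial k) (f : Monomial n) →
                 monEv v (e Vec.++ f) ≈ monEv (λ x → v (x ↑ˡ n)) e ⊗ monEv (λ x → v (k ↑ʳ x)) f
      monEv-++ v []      f = ≈sym (⊗-identityˡ _)
      monEv-++ v (k ∷ e) f = ≈trans (⊗-congˡ (monEv-++ (v ∘ suc) e f)) (≈sym (⊗-assoc _ _ _))

      monEv-concat : ∀ k {n} (v : Env (k * n)) (f : Fin k → Monomial n) →
                     monEv v (Vec.concat (Vec.tabulate f)) ≈ ⨂ k (λ i → monEv (λ x → v (combine i x)) (f i))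
      monEv-concat zero    v f = ≈refl
      monEv-concat (suc k) {n} v f = ≈trans (monEv-++ v (f zero) _) (⊗-congˡ (monEv-concat k (λ x → v (n ↑ʳ x)) (f ∘ suc)))

      monEv-place : ∀ {d} (v : Env (m * (2 * d))) i j (e : Monomial d) →
                    monEv v (placeMon F i j e) ≈ monEv (λ x → v (combine i (combine j x))) e
      monEv-place {d} v i j e = ≈trans (monEv-concat m v blocks)
        (≈trans (⨂-single m _ i (λ i′ ne → ≈trans (halves i′ 𝟘 𝟘 (away i′ ne)) (≈trans (*-cong (monEv-0 (V i′ zero)) (monEv-0 (V i′ (suc zero)))) (⊗-identityˡ 1#)))) (home j refl))
        where
        -- The blocks concatenated by placeMon, recovered by unification.
        placed : (f : Fin m → Monomial (2 * d)) → placeMon F i j e ≡ Vec.concat (Vec.tabulate f) → Fin m → Monomial (2 * d)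
        placed f _ = f
        blocks = placed _ refl
        𝟘 = zeroMon F {d}
        V : Fin m → Fin 2 → Env d
        V i′ j′ x = v (combine i′ (combine j′ x))
        halves : ∀ i′ p q → blocks i′ ≡ p Vec.++ (q Vec.++ []) → monEv (λ x → v (combine i′ x)) (blocks i′) ≈ monEv (V i′ zero) p ⊗ monEv (V i′ (suc zero)) q
        halves i′ p q eq = ≈trans (≈reflexive (cong (monEv (λ x → v (combine i′ x))) eq))
          (≈trans (monEv-++ _ p _) (⊗-congˡ (≈trans (monEv-++ _ q []) (⊗-identityʳ _))))
        away : ∀ i′ → i′ ≢ i → blocks i′ ≡ 𝟘 Vec.++ (𝟘 Vec.++ [])
        away i′ ne with i′ Fin.≟ i
        ... | yes eq = ⊥-elim (ne eq)
        ... | no _   = refl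
        here₀ : j ≡ zero → blocks i ≡ e Vec.++ (𝟘 Vec.++ [])
        here₀ refl with i Fin.≟ i
        ... | yes _ = refl
        ... | no ne = ⊥-elim (ne refl)
        here₁ : j ≡ suc zero → blocks i ≡ 𝟘 Vec.++ (e Vec.++ [])
        here₁ refl with i Fin.≟ i
        ... | yes _ = refl
        ... | no ne = ⊥-elim (ne refl)
        home : ∀ j′ → j ≡ j′ → monEv (λ x → v (combine i x)) (blocks i) ≈ monEv (V i j) e
        home zero       refl = ≈trans (halves i e 𝟘 (here₀ refl)) (≈trans (⊗-congˡ (monEv-0 (V i (suc zero)))) (⊗-identityʳ _))
        home (suc zero) refl = ≈trans (halves i 𝟘 e (here₁ refl)) (≈trans (⊗-congʳ (monEv-0 (V i zero))) (⊗-identityˡ _))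

      eval-embed : ∀ {d} i j (p : Poly F d) v → eval (embedP F i j p) v ≈ eval p (λ x → v (combine i (combine j x)))
      eval-embed i j p v = ≈trans (⨁-map _ p _) (⨁-cong p (λ t → ⊗-congˡ (monEv-place v i j (proj₂ t))))

      eval-prodFin : ∀ {n} {A : Set} k (f : Fin k → A) (h : A → Poly F n) v →
        eval (foldr (λ i acc → mulP F (h i) acc) (oneP F) (Data.List.tabulate f)) v ≈ ⨂ k (λ i → eval (h (f i)) v)
      eval-prodFin zero    f h v = eval-const 1# v
      eval-prodFin (suc k) f h v = ≈trans (eval-mul (h (f zero)) _ v) (⊗-congˡ (eval-prodFin k (f ∘ suc) h v))

      eval-P : ∀ d v → eval (P F m d) v ≈ ev d (v ∘ idx d)
      eval-P zero v = solve 8 (λ a b c d e f g h →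
          con 1 :* ((a :* con 1) :* ((b :* con 1) :* (con 1 :* (con 1 :* ((e :* con 1) :* ((f :* con 1) :* (con 1 :* (con 1 :* con 1)))))))) :+
         (con 1 :* ((a :* con 1) :* ((b :* con 1) :* (con 1 :* (con 1 :* (con 1 :* (con 1 :* ((g :* con 1) :* ((h :* con 1) :* con 1)))))))) :+
         (con 1 :* (con 1 :* (con 1 :* ((c :* con 1) :* ((d :* con 1) :* ((e :* con 1) :* ((f :* con 1) :* (con 1 :* (con 1 :* con 1)))))))) :+
         (con 1 :* (con 1 :* (con 1 :* ((c :* con 1) :* ((d :* con 1) :* (con 1 :* (con 1 :* ((g :* con 1) :* ((h :* con 1) :* con 1)))))))) :+ con 0)))
          := (a :* b :+ c :* d) :* (e :* f :+ g :* h)) ≈refl (v x₀) (v x₁) (v x₂) (v x₃) (v x₄) (v x₅) (v x₆) (v x₇)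
        where
        x₀ x₁ x₂ x₃ x₄ x₅ x₆ x₇ : Fin 8
        x₀ = zero
        x₁ = suc zero
        x₂ = suc (suc zero)
        x₃ = suc (suc (suc zero))
        x₄ = suc (suc (suc (suc zero)))
        x₅ = suc (suc (suc (suc (suc zero))))
        x₆ = suc (suc (suc (suc (suc (suc zero)))))
        x₇ = suc (suc (suc (suc (suc (suc (suc zero))))))
      eval-P (suc d) v = ≈trans (eval-prodFin m (λ i → i) (λ i → embedP F i zero (P F m d) ++ embedP F i (suc zero) (P F m d)) v) (⨂-cong m (λ i →
        ≈trans (⨁-++ (embedP F i zero (P F m d)) (embedP F i (suc zero) (P F m d)) _) (+-cong (copy i zero true refl) (copy i (suc zero) false refl))))
        where
        copy : ∀ i j s → j ≡ bit (not s) → eval (embedP F i j (P F m d)) v ≈ ev d (λ l → v (idx (suc d) (i , s , l)))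
        copy i j s refl = ≈trans (eval-embed i j (P F m d) v) (eval-P d _)

      restricted : ∀ {n} → (Fin n → Status) → (a b : Fin n → Bool) → Env n
      restricted ρ a b x = valS (ρ x) (a x) (b x)

      module _ (d : ℕ) where

        private
          n = numVars F m (suc d)

        -- P^(d+1) is a product of `m` sums of two copies of P^(d): these are the `m` blocks, and
        -- none of their variables is missing.
        topFamily : Family n m d
        topFamily = record
          { pos = λ x → inj₂ (unidx (suc d) x)
          ; inv = λ i s l → just (idx (suc d) (i , s , l))
          ; inv-pos = λ { refl → cong inj₂ (unidx-idx (suc d) _) }
          ; pos-inv = λ { refl → cong just (idx-unidx (suc d) _) } }

        module _ (ω : Seeds d m) where

          private
            ρ = Family.status topFamily ω
            at-leaf : Leaf (suc d) → Status
            at-leaf (i , s , l) = st d ω i s l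

            ρ-idx : ∀ t → ρ (idx (suc d) t) ≡ at-leaf t
            ρ-idx t = cong at-leaf (unidx-idx (suc d) t)

            mate : Leaf (suc d) → Leaf (suc d)
            mate (i , p) = i , partner d ω i p

            mate-swaps : ∀ t → alive (at-leaf t) ≡ true → at-leaf (mate t) ≡ swapYZ (at-leaf t)
            mate-swaps (i , s , l) al = Paired.swaps (pair-partner d ω i s l al)

            mate-invol : ∀ t → alive (at-leaf t) ≡ true → mate (mate t) ≡ t
            mate-invol (i , s , l) al = cong (i ,_) (Paired.invol (pair-partner d ω i s l al))

            mateX : Fin n → Fin n
            mateX x = idx (suc d) (mate (unidx (suc d) x))

            mateX-idx : ∀ t → mateX (idx (suc d) t) ≡ idx (suc d) (mate t)
            mateX-idx t = cong (idx (suc d) ∘ mate) (unidx-idx (suc d) t)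

          restrictedP : (a b : Fin n → Bool) → Carrier
          restrictedP a b = eval (P F m (suc d)) (restricted ρ a b)

          private
            onBlock : (Fin n → Bool) → Fin m → Bool × Leaf d → Bool
            onBlock a i p = a (idx (suc d) (i , p))

            restrictedP-blocks : ∀ a b → restrictedP a b ≈ ⨂ m (λ i → blockVal d ω i (onBlock a i) (onBlock b i))
            restrictedP-blocks a b = ≈trans (eval-P (suc d) _) (ev-cong (suc d) {e′ = λ { (i , s , l) → valS (st d ω i s l) (a (idx (suc d) (i , s , l))) (b (idx (suc d) (i , s , l))) }}
              (λ t → ≈reflexive (cong (λ s → valS s (a (idx (suc d) t)) (b (idx (suc d) t))) (ρ-idx t))))

            P-nonzero : ∀ a b → (∀ t → at-leaf t ≡ SY → a (idx (suc d) t) ≢ b (idx (suc d) (mate t))) → ¬ (restrictedP a b ≈ 0#)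
            P-nonzero a b h e = ⨂-nonzero m (λ i → block-nonzero d ω i (onBlock a i) (onBlock b i) (λ s l → h (i , s , l))) (≈trans (≈sym (restrictedP-blocks a b)) e)

            P-zero : ∀ a b t → at-leaf t ≡ SY → a (idx (suc d) t) ≡ b (idx (suc d) (mate t)) → restrictedP a b ≈ 0#
            P-zero a b (i , s , l) sy eq = ≈trans (restrictedP-blocks a b) (⨂-zero m i (block-zero d ω i (onBlock a i) (onBlock b i) s l sy eq))

          -- The column `β a` contradicts the row `a` at every mate, so the diagonal entries are
          -- nonzero. If `a` and `a′` differ at some `y`, then `a` agrees with `β a′` at the mate of
          -- that `y`, and the term there vanishes.
          P-rankY : ∀ {r} → HasRank restrictedP r → 2 ^ count (isY ∘ ρ) ≤ r
          P-rankY h = rank-lower-bound (isY ∘ ρ) {λ a a′ → restrictedP a (β a′)} diag off (rank-∘ (λ a → a) β h)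
            where
            β : (Fin n → Bool) → Fin n → Bool
            β a x = not (a (mateX x))
            β-mate : ∀ a t → at-leaf t ≡ SY → β a (idx (suc d) (mate t)) ≡ not (a (idx (suc d) t))
            β-mate a t sy = cong (not ∘ a) (trans (mateX-idx (mate t)) (cong (idx (suc d)) (mate-invol t (cong alive sy))))
            diag : ∀ a → ¬ (restrictedP a (β a) ≈ 0#)
            diag a = P-nonzero a (β a) (λ t sy eq → ≢not _ (trans eq (β-mate a t sy)))
            off : ∀ a a′ x → isY (ρ x) ≡ true → a x ≢ a′ x → restrictedP a (β a′) ≈ 0#
            off a a′ x y ne = P-zero a (β a′) t sy (trans (cong a (idx-unidx (suc d) x)) (sym (trans (β-mate a′ t sy)
                (trans (cong (not ∘ a′) (idx-unidx (suc d) x)) (not≢ ne)))))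
              where
              t = unidx (suc d) x
              sy : at-leaf t ≡ SY
              sy = isY⇒≡ y

          -- The mirror image, with rows chosen for columns. The two bounds multiply to
          -- `rank² ≥ 2^(number of free variables)` without a comparison of the numbers of `y` and
          -- `z`.
          P-rankZ : ∀ {r} → HasRank restrictedP r → 2 ^ count (isZ ∘ ρ) ≤ r
          P-rankZ h = rank-lower-bound (isZ ∘ ρ) {λ b b′ → restrictedP (α b) b′} diag off (rank-∘ α (λ b → b) h)
            where
            α : (Fin n → Bool) → Fin n → Bool
            α b x = not (b (mateX x))
            diag : ∀ b → ¬ (restrictedP (α b) b ≈ 0#)
            diag b = P-nonzero (α b) b (λ t sy eq → ≢not _ (sym (trans (cong (not ∘ b) (sym (mateX-idx t))) eq)))
            off : ∀ b b′ x → isZ (ρ x) ≡ true → b x ≢ b′ x → restrictedP (α b) b′ ≈ 0#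
            off b b′ x z ne = P-zero (α b) b′ (mate t) (trans (mate-swaps t (cong alive sz)) (cong swapYZ sz))
                (trans (cong (not ∘ b) (trans (mateX-idx (mate t)) back)) (trans (not≢ (ne ∘ sym)) (cong b′ (sym back))))
              where
              t = unidx (suc d) x
              sz : at-leaf t ≡ SZ
              sz = isZ⇒≡ z
              back : idx (suc d) (mate (mate t)) ≡ x
              back = trans (cong (idx (suc d)) (mate-invol t (cong alive sz))) (idx-unidx (suc d) x)

    open Hard public

    -- Trivial rank bounds and averaged rank bounds.

    module Claims where

      open Family

      module _ {n : ℕ} where

        envOn : (Fin n → Bool) → (Fin n → Status) → (a b : Fin n → Bool) → Env n
        envOn V ρ a b x = if V x then valS (ρ x) (a x) (b x) else 0#

        matrix : Fn n → (Fin n → Bool) → (Fin n → Status) → (a b : Fin n → Bool) → Carrier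
        matrix f V ρ a b = f (envOn V ρ a b)

        live dead : (Fin n → Bool) → (Fin n → Status) → Fin n → Bool
        live V ρ x = V x ∧ alive (ρ x)
        dead V ρ x = not (live V ρ x)

        dead+live : ∀ V ρ → count (dead V ρ) + count (live V ρ) ≡ n
        dead+live V ρ = trans (sym (∑-+ (fins n) (⟦_⟧ ∘ dead V ρ) (⟦_⟧ ∘ live V ρ))) (trans (∑-cong (fins n) (λ x → pt (live V ρ x))) (∣fins∣ n))
          where
          pt : ∀ b → ⟦ not b ⟧ + ⟦ b ⟧ ≡ 1
          pt true  = refl
          pt false = refl

        Ext : Fn n → Set (c ⊔ ℓ)
        Ext f = ∀ v v′ → (∀ x → v x ≈ v′ x) → f v ≈ f v′

        -- The rank is at most 2 to the smaller of the numbers of `y` and `z`; if their sum is odd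
        -- they differ, which gives the extra factor 2 in the square.
        trivial-rank : ∀ f V ρ → Ext f →
          ∃[ r ] (HasRank (matrix f V ρ) r × r * r * 2 ^ ⟦ parity (live V ρ) ⟧ ≤ 2 ^ count (live V ρ))
        trivial-rank f V ρ ext =
          [ (λ u≤w → 2 ^ u , rank-dep U depY , bound u w live≡ u≤w)
          , (λ w≤u → 2 ^ w , rank-transpose (rank-dep W depZ) , bound w u (trans live≡ (+-comm u w)) w≤u) ]′ (≤-total u w)
          where
          U W : Fin n → Bool
          U x = V x ∧ isY (ρ x)
          W x = V x ∧ isZ (ρ x)
          u = count U
          w = count W
          live≡ : count (live V ρ) ≡ u + w
          live≡ = trans (∑-cong (fins n) (λ x → pt (V x) (ρ x))) (∑-+ (fins n) (⟦_⟧ ∘ U) (⟦_⟧ ∘ W))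
            where
            pt : ∀ v s → ⟦ v ∧ alive s ⟧ ≡ ⟦ v ∧ isY s ⟧ + ⟦ v ∧ isZ s ⟧
            pt false s  = refl
            pt true  S0 = refl
            pt true  S1 = refl
            pt true  SY = refl
            pt true  SZ = refl
          depY : ∀ a a′ b → (∀ x → U x ≡ true → a x ≡ a′ x) → matrix f V ρ a b ≈ matrix f V ρ a′ b
          depY a a′ b h = ext _ _ pt
            where
            pt : ∀ x → envOn V ρ a b x ≈ envOn V ρ a′ b x
            pt x with V x | ρ x | h x
            ... | false | _  | _ = ≈refl
            ... | true  | S0 | _ = ≈refl
            ... | true  | S1 | _ = ≈refl
            ... | true  | SZ | _ = ≈refl
            ... | true  | SY | q = ≈reflexive (cong Y (q refl))
          depZ : ∀ b b′ a → (∀ x → W x ≡ true → b x ≡ b′ x) → matrix f V ρ a b ≈ matrix f V ρ a b′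
          depZ b b′ a h = ext _ _ pt
            where
            pt : ∀ x → envOn V ρ a b x ≈ envOn V ρ a b′ x
            pt x with V x | ρ x | h x
            ... | false | _  | _ = ≈refl
            ... | true  | S0 | _ = ≈refl
            ... | true  | S1 | _ = ≈refl
            ... | true  | SY | _ = ≈refl
            ... | true  | SZ | q = ≈reflexive (cong Z (q refl))
          bound : ∀ u w → count (live V ρ) ≡ u + w → u ≤ w → 2 ^ u * 2 ^ u * 2 ^ ⟦ parity (live V ρ) ⟧ ≤ 2 ^ count (live V ρ)
          bound u w e u≤w rewrite parity-odd (live V ρ) | e =
            ≤-trans (≤-reflexive (trans (cong (_* 2 ^ ⟦ odd (u + w) ⟧) (sym (^-distribˡ-+-* 2 u u))) (sym (^-distribˡ-+-* 2 (u + u) ⟦ odd (u + w) ⟧)))) (^-monoʳ-≤ 2 fits)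
            where
            fits : u + u + ⟦ odd (u + w) ⟧ ≤ u + w
            fits with odd (u + w) in o
            ... | false = ≤-trans (≤-reflexive (+-identityʳ _)) (+-monoʳ-≤ u u≤w)
            ... | true with m≤n⇒m<n∨m≡n u≤w
            ...   | inj₁ u<w  = ≤-trans (≤-reflexive (trans (+-assoc u u 1) (cong (u +_) (+-comm u 1)))) (+-monoʳ-≤ u u<w)
            ...   | inj₂ refl = case trans (sym o) (odd-double u) of λ ()

        -- An affine function separates: the constants and the `y` depend on the row alone, the `z`
        -- on the column alone.
        affine-rank : ∀ f V ρ → Affine f → HasRank (matrix f V ρ) 2
        affine-rank f V ρ (k , e) = rank-cong (λ a b → ≈trans (e _) (≈trans (⨁-cong (fins (suc n)) (λ h → ≈trans (⊗-congˡ (halves a b h)) (⊗-distribˡ (k h) (u h a) (w h b))))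
            (⨁-+ (fins (suc n)) (λ h → k h ⊗ u h a) (λ h → k h ⊗ w h b))))
            (rank-affine (λ a → ⨁ (fins (suc n)) (λ h → k h ⊗ u h a)) (λ b → ⨁ (fins (suc n)) (λ h → k h ⊗ w h b)))
          where
          u₁ : Bool → Status → Bool → Carrier
          u₁ true S1 _ = 1#
          u₁ true SY a = Y a
          u₁ _    _  _ = 0#
          w₁ : Bool → Status → Bool → Carrier
          w₁ true SZ b = Z b
          w₁ _    _  _ = 0#
          u w : Fin (suc n) → (Fin n → Bool) → Carrier
          u zero    a = 1#
          u (suc x) a = u₁ (V x) (ρ x) (a x)
          w zero    b = 0#
          w (suc x) b = w₁ (V x) (ρ x) (b x)
          halves : ∀ a b h → affineBase h (envOn V ρ a b) ≈ u h a ⊕ w h b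
          halves a b zero    = ≈sym (⊕-identityʳ 1#)
          halves a b (suc x) with V x | ρ x
          ... | false | _  = ≈sym (⊕-identityʳ 0#)
          ... | true  | S0 = ≈sym (⊕-identityʳ 0#)
          ... | true  | S1 = ≈sym (⊕-identityʳ 1#)
          ... | true  | SY = ≈sym (⊕-identityʳ _)
          ... | true  | SZ = ≈sym (⊕-identityˡ _)

        module OfProduct {𝒞 : Fn n → Set (c ⊔ ℓ)} {T : Fn n} (P : Product 𝒞 T) (V : Fin n → Bool) where

          open Product P public

          within : Fin parts → Fin n → Bool
          within j x = V x ∧ (part x == j)

          factor-ext : ∀ j → Ext (factor j)
          factor-ext j v v′ h = local j v v′ (λ x _ → h x)

          product-rank : ∀ ρ {r : Fin parts → ℕ} → (∀ j → HasRank (matrix (factor j) (within j) ρ) (r j)) → HasRank (matrix T V ρ) (∏ parts r)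
          product-rank ρ h = rank-cong (λ a b → ≈trans (product _) (⨂-cong parts (λ j → local j _ _ (λ x px → on a b j x px)))) (rank-⨂ parts h)
            where
            on : ∀ a b j x → part x ≡ j → envOn V ρ a b x ≈ envOn (within j) ρ a b x
            on a b j x refl rewrite ==-refl (part x) | Boolₚ.∧-identityʳ (V x) = ≈refl

          ∑-live : ∀ ρ → ∑ (fins parts) (λ j → count (live (within j) ρ)) ≡ count (live V ρ)
          ∑-live ρ = trans (∑-swap (fins parts) (fins n) (λ j x → ⟦ live (within j) ρ x ⟧)) (∑-cong (fins n) (λ x → ∑-class (V x) (alive (ρ x)) (part x)))

      module _ {n N d : ℕ} (fam : Family n N d) where

        onBlock? : (Fin n → Bool) → Fin N → Bool → Leaf d → Bool
        onBlock? V i s l = holds V (inv fam i s l)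

        cell : (Fin n → Bool) → Fin N → Bool → ℕ
        cell V i s = ∑ (leaves d) (λ l → ⟦ onBlock? V i s l ⟧)

        mass : (Fin n → Bool) → ℕ
        mass V = ∑ (fins N) (λ i → cell V i true + cell V i false)

        -- Multiplying by `2^dead` replaces division by `2^live`; the two differ by the constant
        -- factor `2 ^ n`.
        cost : (Fin n → Bool) → (Seeds d N → ℕ) → ℕ
        cost V rk = ∑ (seeds d N) (λ ω → rk ω * rk ω * 2 ^ count (dead V (status fam ω)))

        -- The average over all restrictions of (rank)² / 2^(number of unfixed variables) is at most B / 2^k.
        record Bounded (k B : ℕ) (f : Fn n) (V : Fin n → Bool) : Set (c ⊔ ℓ) where
          field
            rk      : Seeds d N → ℕ
            hasRank : ∀ ω → HasRank (matrix f V (status fam ω)) (rk ω)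
            small   : cost V rk * 2 ^ k ≤ B * (2 ^ n * ∣ seeds d N ∣)

        bounded-zero : ∀ k B T V → (∀ v → T v ≈ 0#) → Bounded k B T V
        bounded-zero k B T V z = record
          { rk = λ _ → 0 ; hasRank = λ ω → rank-cong (λ a b → z _) rank-zero
          ; small = ≤-trans (≤-reflexive (cong (_* 2 ^ k) (∑-zero (seeds d N)))) z≤n }

        -- One factor `s` comes from Cauchy-Schwarz for the squared sum of ranks, the other from
        -- adding up the costs of the `s` terms.
        bounded-span : ∀ k B s (T : Fin s → Fn n) f V → Span T f → (∀ t → Bounded k B (T t) V) → Bounded k (s * s * B) f V
        bounded-span k B s T f V (κ , e) h = record
          { rk = λ ω → ∑ (fins s) (λ t → rkₜ t ω)
          ; hasRank = λ ω → rank-cong (λ a b → e _) (rank-⨁ s (λ t → rank-*ˡ (λ _ → κ t) (hasRank (h t) ω)))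
          ; small = begin
              cost V (λ ω → ∑ (fins s) (λ t → rkₜ t ω)) * 2 ^ k
                ≤⟨ *-monoˡ-≤ (2 ^ k) (∑-mono Ω (λ ω → ≤-trans (*-monoˡ-≤ (w ω) (cauchy-schwarz (fins s) (λ t → rkₜ t ω))) (≤-reflexive (*-assoc ∣ fins s ∣ _ (w ω))))) ⟩
              ∑ Ω (λ ω → ∣ fins s ∣ * (∑ (fins s) (λ t → rkₜ t ω * rkₜ t ω) * w ω)) * 2 ^ k
                ≡⟨ cong (_* 2 ^ k) (∑-*ˡ Ω ∣ fins s ∣ (λ ω → ∑ (fins s) (λ t → rkₜ t ω * rkₜ t ω) * w ω)) ⟩
              ∣ fins s ∣ * ∑ Ω (λ ω → ∑ (fins s) (λ t → rkₜ t ω * rkₜ t ω) * w ω) * 2 ^ k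
                ≡⟨ cong (λ z → ∣ fins s ∣ * z * 2 ^ k) (trans (∑-cong Ω (λ ω → sym (∑-*ʳ (fins s) (λ t → rkₜ t ω * rkₜ t ω) (w ω)))) (∑-swap Ω (fins s) (λ ω t → rkₜ t ω * rkₜ t ω * w ω))) ⟩
              ∣ fins s ∣ * ∑ (fins s) (λ t → cost V (rkₜ t)) * 2 ^ k
                ≡⟨ trans (*-assoc ∣ fins s ∣ _ (2 ^ k)) (cong (∣ fins s ∣ *_) (sym (∑-*ʳ (fins s) (λ t → cost V (rkₜ t)) (2 ^ k)))) ⟩
              ∣ fins s ∣ * ∑ (fins s) (λ t → cost V (rkₜ t) * 2 ^ k)
                ≤⟨ *-monoʳ-≤ ∣ fins s ∣ (∑-mono (fins s) (λ t → small (h t))) ⟩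
              ∣ fins s ∣ * ∑ (fins s) (λ t → B * W)
                ≡⟨ cong (∣ fins s ∣ *_) (∑-const (fins s) (B * W)) ⟩
              ∣ fins s ∣ * (∣ fins s ∣ * (B * W))
                ≡⟨ cong (λ z → z * (z * (B * W))) (∣fins∣ s) ⟩
              s * (s * (B * W))
                ≡⟨ l s B W ⟩
              s * s * B * W ∎ }
          where
          open ≤-Reasoning
          open Bounded
          Ω = seeds d N
          W = 2 ^ n * ∣ seeds d N ∣
          rkₜ : Fin s → Seeds d N → ℕ
          rkₜ t = rk (h t)
          w : Seeds d N → ℕ
          w ω = 2 ^ count (dead V (status fam ω))
          l : ∀ s B W → s * (s * (B * W)) ≡ s * s * B * W
          l = solve-∀

        module Parts {𝒞 : Fn n → Set (c ⊔ ℓ)} {T : Fn n} (P : Product 𝒞 T) (V : Fin n → Bool) where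

          open OfProduct P V public

          label : Fin N → Bool → Leaf d → Fin (suc parts)
          label i s l = tagged V part (inv fam i s l)

          cell-label : ∀ j i s → cell (within j) i s ≡ ∑ (leaves d) (λ l → ⟦ label i s l == suc j ⟧)
          cell-label j i s = ∑-cong (leaves d) (λ l → cong ⟦_⟧ (sym (holds-tagged V part (inv fam i s l) j)))

          ∑-cell : ∀ i s → ∑ (fins parts) (λ j → cell (within j) i s) ≡ cell V i s
          ∑-cell i s = trans (∑-swap (fins parts) (leaves d) (λ j l → ⟦ onBlock? (within j) i s l ⟧))
            (∑-cong (leaves d) (λ l → ∑-holds V part (inv fam i s l)))

          row-cell : ∀ i s → ∑ (fins parts) (λ j → cell (within j) i s) ≤ ∣ leaves d ∣
          row-cell i s = ≤-trans (≤-reflexive (∑-cell i s)) (∑-mono (leaves d) (λ l → ⟦⟧-≤1 (onBlock? V i s l)))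

          ∑-mass : ∑ (fins parts) (λ j → mass (within j)) ≡ mass V
          ∑-mass = trans (∑-swap (fins parts) (fins N) (λ j i → cell (within j) i true + cell (within j) i false))
            (∑-cong (fins N) (λ i → trans (∑-+ (fins parts) (λ j → cell (within j) i true) (λ j → cell (within j) i false)) (cong₂ _+_ (∑-cell i true) (∑-cell i false))))

          label⇒ : ∀ {i s l j} → label i s l ≡ suc j → ∃[ x ] (inv fam i s l ≡ just x × within j x ≡ true)
          label⇒ {i} {s} {l} {j} = tagged-suc V part (inv fam i s l) j

          ⇒label : ∀ {i s l j x} → pos fam x ≡ inj₂ (i , s , l) → within j x ≡ true → label i s l ≡ suc j
          ⇒label {i} {s} {l} {j} {x} px wx rewrite pos-inv fam px =
            trans (cong (λ v → if v then suc (part x) else zero) (∧-trueˡ (V x) wx)) (cong suc (==⇒≡ (part x) j (∧-trueʳ (V x) wx)))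

    open Claims public

    -- The inductive step for one product layer.

    module Step where

      open Family

      private
        dd : ∀ {n} → (Fin n → Bool) → (Fin n → Status) → ℕ
        dd V ρ = 2 ^ count (dead V ρ)

      module _ {n N d} (fam : Family n N (suc d)) {𝒞 : Fn n → Set (c ⊔ ℓ)} {T : Fn n} (P : Product 𝒞 T) (V : Fin n → Bool) where

        open Parts fam P V

        trivial : ∀ ρ j → ∃[ r ] (HasRank (matrix (factor j) (within j) ρ) r × r * r * 2 ^ ⟦ parity (live (within j) ρ) ⟧ ≤ 2 ^ count (live (within j) ρ))
        trivial ρ j = trivial-rank (factor j) (within j) ρ (factor-ext j)

        triv : (Fin n → Status) → Fin parts → ℕ
        triv ρ j = proj₁ (trivial ρ j)

        triv-rank : ∀ ρ → HasRank (matrix T V ρ) (∏ parts (triv ρ))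
        triv-rank ρ = product-rank ρ (λ j → proj₁ (proj₂ (trivial ρ j)))

        triv-cost : ∀ ρ (e : Fin parts → ℕ) → (∀ j → e j ≤ ⟦ parity (live (within j) ρ) ⟧) →
          ∏ parts (triv ρ) * ∏ parts (triv ρ) * dd V ρ * 2 ^ ∑ (fins parts) e ≤ 2 ^ n
        triv-cost ρ e h = begin
          p * p * dd V ρ * 2 ^ ∑ (fins parts) e                   ≡⟨ l (p * p) (dd V ρ) (2 ^ ∑ (fins parts) e) ⟩
          dd V ρ * (p * p * 2 ^ ∑ (fins parts) e)                 ≤⟨ *-monoʳ-≤ (dd V ρ) (∏² parts (triv ρ) e (λ j → count (live (within j) ρ))
                                                                       (λ j → ≤-trans (*-monoʳ-≤ (triv ρ j * triv ρ j) (^-monoʳ-≤ 2 (h j))) (proj₂ (proj₂ (trivial ρ j))))) ⟩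
          dd V ρ * 2 ^ ∑ (fins parts) (λ j → count (live (within j) ρ)) ≡⟨ cong (λ z → dd V ρ * 2 ^ z) (∑-live ρ) ⟩
          dd V ρ * 2 ^ count (live V ρ)                           ≡⟨ ^-distribˡ-+-* 2 (count (dead V ρ)) _ ⟨
          2 ^ (count (dead V ρ) + count (live V ρ))               ≡⟨ cong (2 ^_) (dead+live V ρ) ⟩
          2 ^ n                                                   ∎
          where
          open ≤-Reasoning
          p = ∏ parts (triv ρ)
          l : ∀ x y z → x * y * z ≡ y * (x * z)
          l = solve-∀

        triv-cost₀ : ∀ ρ → ∏ parts (triv ρ) * ∏ parts (triv ρ) * dd V ρ ≤ 2 ^ n
        triv-cost₀ ρ = drop-2^ _ (∑ (fins parts) (λ _ → 0)) (triv-cost ρ (λ _ → 0) (λ _ → z≤n))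

        -- Indexed like `label`, where `zero` stands for leaves outside `V` and never counts.
        parityAt : Seeds d (N * m) → Vec (Top (Leaf (suc d))) N → Fin (suc parts) → Bool
        parityAt ω τ zero    = false
        parityAt ω τ (suc j) = parity (live (within j) (status fam (τ , ω)))

        module _ (ω : Seeds d (N * m)) {i : Fin N} {τ τ′ : Vec (Top (Leaf (suc d))) N} {y z : Leaf (suc d)}
                 (off : OffBy i τ τ′) (e : lookup τ i ≡ (split , true , y , z)) (e′ : lookup τ′ i ≡ (split , false , y , z)) where

          private
            ρ ρ′ : Fin n → Status
            ρ  = status fam (τ , ω)
            ρ′ = status fam (τ′ , ω)

          -- With coin `true` the free variables of the block are exactly `y` and `z`, with coin
          -- `false` there are none; nothing outside the block depends on its coin.
          coin-same : ∀ x → alive (ρ x) ≡ alive (ρ′ x) ⊎ (pos fam x ≡ inj₂ (i , true , y) ⊎ pos fam x ≡ inj₂ (i , false , z))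
          coin-same x with pos fam x
          ... | inj₁ s = inj₁ refl
          ... | inj₂ (i′ , s , l) with i′ Fin.≟ i
          ...   | no ne rewrite off i′ ne = inj₁ refl
          ...   | yes refl rewrite e | e′ = here? s
            where
            here? : ∀ s → alive (at d ω (lowPos d (split , true , y , z) i s l)) ≡ alive (at d ω (lowPos d (split , false , y , z) i s l))
                          ⊎ (inj₂ (i , s , l) ≡ inj₂ (i , true , y) ⊎ inj₂ (i , s , l) ≡ inj₂ (i , false , z))
            here? true with alive (leafSt (suc d) SY y l) in al
            ... | true  = inj₂ (inj₁ (cong (λ l → inj₂ (i , true , l)) (leafSt-alive (suc d) SY y l al)))
            ... | false = inj₁ (sym (oneSt-fixed (suc d) l))
            here? false with alive (leafSt (suc d) SZ z l) in al
            ... | true  = inj₂ (inj₂ (cong (λ l → inj₂ (i , false , l)) (leafSt-alive (suc d) SZ z l al)))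
            ... | false = inj₁ refl

          coin-y : ∀ x → pos fam x ≡ inj₂ (i , true , y) → alive (ρ x) ≡ true × alive (ρ′ x) ≡ false
          coin-y x px rewrite px | e | e′ | leafSt-self (suc d) SY y = refl , oneSt-fixed (suc d) y

          coin-z : ∀ x → pos fam x ≡ inj₂ (i , false , z) → alive (ρ x) ≡ true × alive (ρ′ x) ≡ false
          coin-z x px rewrite px | e | e′ | leafSt-self (suc d) SZ z = refl , refl

          coin-elsewhere : ∀ j → suc j ≢ label i true y → suc j ≢ label i false z → parityAt ω τ (suc j) ≡ parityAt ω τ′ (suc j)
          coin-elsewhere j ny nz = parity-cong _ _ pt
            where
            pt : ∀ x → live (within j) ρ x ≡ live (within j) ρ′ x
            pt x with within j x in wx
            ... | false = refl
            ... | true with coin-same x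
            ...   | inj₁ q          = q
            ...   | inj₂ (inj₁ px) = ⊥-elim (ny (sym (⇒label px wx)))
            ...   | inj₂ (inj₂ px) = ⊥-elim (nz (sym (⇒label px wx)))

          coin-flips : ∀ j s l → suc j ≡ label i s l → (∀ x → pos fam x ≡ inj₂ (i , s , l) → alive (ρ x) ≡ true × alive (ρ′ x) ≡ false) →
            (∀ x → within j x ≡ true → (pos fam x ≡ inj₂ (i , true , y) ⊎ pos fam x ≡ inj₂ (i , false , z)) → pos fam x ≡ inj₂ (i , s , l)) →
            parityAt ω τ (suc j) ≡ not (parityAt ω τ′ (suc j))
          coin-flips j s l eq coin only with label⇒ (sym eq)
          ... | x₀ , ix₀ , wx₀ = parity-flip _ _ x₀ flip₀ rest
            where
            flip₀ : live (within j) ρ x₀ ≡ not (live (within j) ρ′ x₀)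
            flip₀ = trans (cong₂ _∧_ wx₀ (proj₁ (coin x₀ (inv-pos fam ix₀)))) (cong not (sym (cong₂ _∧_ wx₀ (proj₂ (coin x₀ (inv-pos fam ix₀))))))
            rest : ∀ x → x ≢ x₀ → live (within j) ρ x ≡ live (within j) ρ′ x
            rest x ne with within j x in wx
            ... | false = refl
            ... | true with coin-same x
            ...   | inj₁ q = q
            ...   | inj₂ h = ⊥-elim (ne (just-injective (trans (sym (pos-inv fam (only x wx h))) ix₀)))

        flips : ∀ ω (c : Fin (suc parts) → Bool) → c zero ≡ false → ∀ g (G≡ : suc g ≡ 96 * ∣ leaves (suc d) ∣) →
                SmallParts.Flips (leaves (suc d)) g G≡ label (parityAt ω) c
        flips ω c c0 g G≡ i τ τ′ y z off e e′ = elsewhere , flip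
          where
          elsewhere : ∀ j → j ≢ label i true y → j ≢ label i false z → parityAt ω τ j ≡ parityAt ω τ′ j
          elsewhere zero    _ _ = refl
          elsewhere (suc j) = coin-elsewhere ω off e e′ j
          flip : label i true y ≢ label i false z → ∀ j → (j ≡ label i true y ⊎ j ≡ label i false z) → c j ≡ true → parityAt ω τ j ≡ not (parityAt ω τ′ j)
          flip ne zero    _ cj = case trans (sym cj) c0 of λ ()
          flip ne (suc j) (inj₁ eq) cj = coin-flips ω off e e′ j true y eq (coin-y ω off e e′) λ where
            x wx (inj₁ px) → px
            x wx (inj₂ px) → ⊥-elim (ne (trans (sym eq) (sym (⇒label px wx))))
          flip ne (suc j) (inj₂ eq) cj = coin-flips ω off e e′ j false z eq (coin-z ω off e e′) λ where
            x wx (inj₁ px) → ⊥-elim (ne (trans (⇒label px wx) eq))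
            x wx (inj₂ px) → px

        isSmall : Fin (suc parts) → Bool
        isSmall zero    = false
        isSmall (suc j) = 2 * mass fam (within j) ≤ᵇ ∣ leaves (suc d) ∣

        module _ (g : ℕ) .{{_ : NonZero g}} (G≡ : suc g ≡ 96 * ∣ leaves (suc d) ∣) (k : ℕ) where

          open SmallParts (leaves (suc d)) g G≡ using (weight; small-parts)

          weight≡mass : ∀ j → ∑ (fins N) (weight label (_== suc j)) ≡ mass fam (within j)
          weight≡mass j = ∑-cong (fins N) (λ i → trans (cong (∑ (leaves (suc d)) (λ l → ⟦ label i true l == suc j ⟧) +_) (+-identityʳ _))
            (cong₂ _+_ (sym (cell-label j i true)) (sym (cell-label j i false))))

          -- The choices `ω` for the lower levels are held fixed, and the saving comes from the
          -- top-level choices alone. The weight `k * suc g` yields `(1 - 1/G)^(kG) ≤ 2^(-k)`.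
          many-small : k * suc g ≤ ∑ (fins N) (weight label isSmall) → Bounded fam k 1 T V
          many-small enough = record
            { rk = λ ω → ∏ parts (triv (status fam ω))
            ; hasRank = λ ω → triv-rank (status fam ω)
            ; small = begin
                ∑ (seeds (suc d) N) A * 2 ^ k                              ≡⟨ cong (_* 2 ^ k) (trans (∑-pairs Ts Ω A) (∑-swap Ts Ω (λ τ ω → A (τ , ω)))) ⟩
                ∑ Ω (λ ω → ∑ Ts (λ τ → A (τ , ω))) * 2 ^ k                 ≡⟨ ∑-*ʳ Ω _ (2 ^ k) ⟨
                ∑ Ω (λ ω → ∑ Ts (λ τ → A (τ , ω)) * 2 ^ k)                 ≤⟨ ∑-mono Ω per-ω ⟩
                ∑ Ω (λ ω → 2 ^ n * ∣ tops (leaves (suc d)) ∣ ^ N)          ≡⟨ ∑-const Ω _ ⟩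
                ∣ Ω ∣ * (2 ^ n * ∣ tops (leaves (suc d)) ∣ ^ N)            ≡⟨ cong (λ z → ∣ Ω ∣ * (2 ^ n * z)) (∣vecs∣ (tops (leaves (suc d))) N) ⟨
                ∣ Ω ∣ * (2 ^ n * ∣ Ts ∣)                                   ≡⟨ l (∣ Ω ∣) (2 ^ n) (∣ Ts ∣) ⟩
                1 * (2 ^ n * (∣ Ts ∣ * ∣ Ω ∣))                             ≡⟨ cong (λ z → 1 * (2 ^ n * z)) (∣pairs∣ Ts Ω) ⟨
                1 * (2 ^ n * ∣ seeds (suc d) N ∣)                          ∎ }
            where
            open ≤-Reasoning
            Ts = vecs (tops (leaves (suc d))) N
            Ω = seeds d (N * m)
            A : Seeds (suc d) N → ℕ
            A ω = ∏ parts (triv (status fam ω)) * ∏ parts (triv (status fam ω)) * dd V (status fam ω)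
            l : ∀ x y z → x * (y * z) ≡ 1 * (y * (z * x))
            l = solve-∀
            per-ω : ∀ ω → ∑ Ts (λ τ → A (τ , ω)) * 2 ^ k ≤ 2 ^ n * ∣ tops (leaves (suc d)) ∣ ^ N
            per-ω ω = halving g k (∑ Ts (λ τ → A (τ , ω))) (2 ^ n * ∣ tops (leaves (suc d)) ∣ ^ N) (small-parts N label (parityAt ω) isSmall (λ τ → A (τ , ω)) (2 ^ n)
              (flips ω isSmall refl g G≡) small-mass bd (k * suc g) enough)
              where
              small-mass : ∀ j → isSmall j ≡ true → 2 * ∑ (fins N) (weight label (_== j)) ≤ ∣ leaves (suc d) ∣
              small-mass (suc j) s = ≤-trans (≤-reflexive (cong (2 *_) (weight≡mass j))) (≤ᵇ⇒≤ _ _ (subst Data.Bool.T (sym s) tt))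
              bd : ∀ τ → A (τ , ω) * 2 ^ ∑ (fins (suc parts)) (λ j → ⟦ isSmall j ∧ parityAt ω τ j ⟧) ≤ 2 ^ n
              bd τ = ≤-trans (≤-reflexive (cong (λ z → A (τ , ω) * 2 ^ z) (∑-fins parts (λ j → ⟦ isSmall j ∧ parityAt ω τ j ⟧))))
                (triv-cost (status fam (τ , ω)) _ (λ j → ⟦⟧-∧-≤ʳ (isSmall (suc j)) (parityAt ω τ (suc j))))

          ∑-small≤weight : ∑ (fins parts) (λ j → ⟦ isSmall (suc j) ⟧ * mass fam (within j)) ≤ ∑ (fins N) (weight label isSmall)
          ∑-small≤weight = begin
            ∑ (fins parts) (λ j → ⟦ isSmall (suc j) ⟧ * mass fam (within j))
              ≡⟨ ∑-cong (fins parts) (λ j → trans (cong (⟦ isSmall (suc j) ⟧ *_) (sym (weight≡mass j))) (trans (*-comm ⟦ isSmall (suc j) ⟧ _) (sym (∑³-*ʳ (fins N) bools (leaves (suc d)) (λ i s l → ⟦ label i s l == suc j ⟧) ⟦ isSmall (suc j) ⟧)))) ⟩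
            ∑ (fins parts) (λ j → ∑³ (fins N) bools (leaves (suc d)) (λ i s l → ⟦ label i s l == suc j ⟧ * ⟦ isSmall (suc j) ⟧))
              ≡⟨ ∑³-swap (fins N) bools (leaves (suc d)) (fins parts) (λ j i s l → ⟦ label i s l == suc j ⟧ * ⟦ isSmall (suc j) ⟧) ⟩
            ∑³ (fins N) bools (leaves (suc d)) (λ i s l → ∑ (fins parts) (λ j → ⟦ label i s l == suc j ⟧ * ⟦ isSmall (suc j) ⟧))
              ≤⟨ ∑³-mono (fins N) bools (leaves (suc d)) (λ i s l → pt (label i s l)) ⟩
            ∑ (fins N) (weight label isSmall) ∎
            where
            open ≤-Reasoning
            pt : ∀ t → ∑ (fins parts) (λ j → ⟦ t == suc j ⟧ * ⟦ isSmall (suc j) ⟧) ≤ ⟦ isSmall t ⟧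
            pt zero    = ≤-reflexive (∑-zero (fins parts))
            pt (suc t) = ≤-reflexive (trans (∑-cong (fins parts) (λ j → eq j (t == j) refl)) (∑-indicator t ⟦ isSmall (suc t) ⟧))
              where
              eq : ∀ j b → (t == j) ≡ b → ⟦ t == j ⟧ * ⟦ isSmall (suc j) ⟧ ≡ ⟦ t == j ⟧ * ⟦ isSmall (suc t) ⟧
              eq j true  e rewrite ==⇒≡ t j e = refl
              eq j false e rewrite e = refl

          module _ (K B : ℕ) .{{nzK : NonZero K}} (108k≤K : 108 * suc k ≤ K) (12Kk≤m : 12 * K * suc k ≤ m)
            (IH : ∀ τ j → K * ∣ leaves d ∣ ≤ mass (lower fam τ) (within j) → Bounded (lower fam τ) k B (factor j) (within j)) where

            private
              n′ = ∣ leaves d ∣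
              nn = ∣ leaves (suc d) ∣
              W  = 2 ^ n * ∣ seeds d (N * m) ∣

              nn≡ : nn ≡ m * (2 * n′)
              nn≡ = trans (∣pairs∣ (fins m) (pairs bools (leaves d))) (cong₂ _*_ (∣fins∣ m) (∣pairs∣ bools (leaves d)))

            -- Only the copy that does not vanish is passed on, and it consists exactly of the `m`
            -- pairs that form the new blocks.
            lower-mass : ∀ τ U → ∑ (fins N) (λ i → side-of (proj₁ (lookup τ i)) (cell fam U i)) ≡ mass (lower fam τ) U
            lower-mass τ U = sym (trans (∑-combine N m (λ k → cell low U k true + cell low U k false)) (∑-cong (fins N) per-block))
              where
              low = lower fam τ
              block : Fin N → Fin m → Bool → ℕ
              block i i′ s = ∑ (leaves d) (λ l → ⟦ holds U (lowInv fam τ i i′ s l) ⟧)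
              cell≡ : ∀ i i′ s → cell low U (combine i i′) s ≡ block i i′ s
              cell≡ i i′ s = cong (λ p → block (proj₁ p) (proj₂ p) s) (Finₚ.remQuot-combine {N} {m} i i′)
              from : ∀ i s → cell fam U i s ≡ ∑ (fins m) (λ i′ → ∑ (leaves d) (λ l → ⟦ holds U (inv fam i s (i′ , true , l)) ⟧) + ∑ (leaves d) (λ l → ⟦ holds U (inv fam i s (i′ , false , l)) ⟧))
              from i s = trans (∑-pairs (fins m) (pairs bools (leaves d)) (λ l → ⟦ onBlock? fam U i s l ⟧)) (∑-cong (fins m) (λ i′ →
                trans (∑-pairs bools (leaves d) (λ p → ⟦ onBlock? fam U i s (i′ , p) ⟧)) (cong (∑ (leaves d) (λ l → ⟦ onBlock? fam U i s (i′ , true , l) ⟧) +_) (+-identityʳ _))))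
              blocks : ∀ i → ∑ (fins m) (λ i′ → block i i′ true + block i i′ false) ≡ side-of (proj₁ (lookup τ i)) (cell fam U i)
              blocks i with lookup τ i
              ... | split , _ = trans (∑-cong (fins m) (λ _ → cong₂ _+_ (∑-zero (leaves d)) (∑-zero (leaves d)))) (∑-zero (fins m))
              ... | left  , _ = sym (from i true)
              ... | right , _ = sym (from i false)
              per-block : ∀ i → ∑ (fins m) (λ i′ → cell low U (combine i i′) true + cell low U (combine i i′) false) ≡ side-of (proj₁ (lookup τ i)) (cell fam U i)
              per-block i = trans (∑-cong (fins m) (λ i′ → cong₂ _+_ (cell≡ i i′ true) (cell≡ i i′ false))) (blocks i)

            good? : ∀ τ → Dec (∃[ j ] K * n′ ≤ mass (lower fam τ) (within j))
            good? τ = Finₚ.any? (λ j → K * n′ ≤? mass (lower fam τ) (within j))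

            bad : Vec (Top (Leaf (suc d))) N → Bool
            bad τ = not (does (good? τ))

            -- The bound for fixed top-level choices: `B` when some part keeps enough mass for the
            -- induction hypothesis, and otherwise the trivial bound, charged to `isBad`.
            record Conditional (τ : Vec (Top (Leaf (suc d))) N) (isBad : Bool) : Set (c ⊔ ℓ) where
              field
                rk      : Seeds d (N * m) → ℕ
                hasRank : ∀ ω → HasRank (matrix T V (status fam (τ , ω))) (rk ω)
                small   : ∑ (seeds d (N * m)) (λ ω → rk ω * rk ω * dd V (status fam (τ , ω))) * 2 ^ k ≤ B * W + ⟦ isBad ⟧ * 2 ^ k * W

            split-on : ∀ τ (g? : Dec (∃[ j ] K * n′ ≤ mass (lower fam τ) (within j))) → Conditional τ (not (does g?))
            split-on τ (no _) = record
              { rk = λ ω → ∏ parts (triv (status fam (τ , ω)))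
              ; hasRank = λ ω → triv-rank (status fam (τ , ω))
              ; small = ≤-trans (*-monoˡ-≤ (2 ^ k) (≤-trans (∑-mono (seeds d (N * m)) (λ ω → triv-cost₀ (status fam (τ , ω)))) (≤-reflexive (∑-const (seeds d (N * m)) (2 ^ n)))))
                                (≤-trans (≤-reflexive (l (∣ seeds d (N * m) ∣) (2 ^ n) (2 ^ k))) (m≤n+m _ (B * W))) }
              where
              l : ∀ x y z → x * y * z ≡ 1 * z * (y * x)
              l = solve-∀
            split-on τ (yes (j , ge)) = record
              { rk = λ ω → ∏ parts (rks ω)
              ; hasRank = λ ω → product-rank (status fam (τ , ω)) (ranks ω)
              ; small = ≤-trans (*-monoˡ-≤ (2 ^ k) (∑-mono (seeds d (N * m)) compare)) (≤-trans (Bounded.small b) (m≤m+n _ 0)) }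
              where
              b = IH τ j ge
              low = lower fam τ
              rks : Seeds d (N * m) → Fin parts → ℕ
              rks ω j′ = if j′ == j then Bounded.rk b ω else triv (status fam (τ , ω)) j′
              ranks : ∀ ω j′ → HasRank (matrix (factor j′) (within j′) (status fam (τ , ω))) (rks ω j′)
              ranks ω j′ with j′ Fin.≟ j
              ... | no _     = proj₁ (proj₂ (trivial (status fam (τ , ω)) j′))
              ... | yes refl = rank-cong (λ a b → factor-ext j _ _ (λ x → ≈reflexive (cong (λ s → if within j x then valS s (a x) (b x) else 0#) (sym (lower-status fam τ ω x))))) (Bounded.hasRank b ω)
              -- The other factors meet their trivial bounds, so the cost on `V` is at most the cost
              -- of factor `j` alone on its own part, where all variables outside the part count as
              -- dead.
              compare : ∀ ω → ∏ parts (rks ω) * ∏ parts (rks ω) * dd V (status fam (τ , ω)) ≤ Bounded.rk b ω * Bounded.rk b ω * dd (within j) (status low ω)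
              compare ω = *-cancelʳ-≤ _ _ (2 ^ Lj) {{m^n≢0 2 Lj}} (begin
                p * p * D * 2 ^ Lj                      ≡⟨ l (p * p) D (2 ^ Lj) ⟩
                p * p * 2 ^ Lj * D                      ≤⟨ *-monoˡ-≤ D (∏²-one parts (rks ω) L j others) ⟩
                rks ω j * rks ω j * 2 ^ ∑ (fins parts) L * D ≡⟨ cong₂ (λ x y → x * x * 2 ^ y * D) rj (∑-live ρ) ⟩
                r * r * 2 ^ count (live V ρ) * D        ≡⟨ l′ (r * r) (2 ^ count (live V ρ)) D ⟩
                r * r * (D * 2 ^ count (live V ρ))      ≡⟨ cong (r * r *_) (full V ρ) ⟩
                r * r * 2 ^ n                           ≡⟨ cong (r * r *_) (full (within j) ρ) ⟨
                r * r * (dd (within j) ρ * 2 ^ Lj)      ≡⟨ *-assoc (r * r) _ _ ⟨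
                r * r * dd (within j) ρ * 2 ^ Lj        ≡⟨ cong (λ z → r * r * 2 ^ z * 2 ^ Lj) (count-cong (λ x → cong (λ s → not (within j x ∧ alive s)) (sym (lower-status fam τ ω x)))) ⟩
                r * r * dd (within j) (status low ω) * 2 ^ Lj ∎)
                where
                open ≤-Reasoning
                ρ = status fam (τ , ω)
                p = ∏ parts (rks ω)
                r = Bounded.rk b ω
                D = dd V ρ
                L : Fin parts → ℕ
                L j′ = count (live (within j′) ρ)
                Lj = L j
                l : ∀ x y z → x * y * z ≡ x * z * y
                l = solve-∀
                l′ : ∀ x y z → x * y * z ≡ x * (z * y)
                l′ = solve-∀
                full : ∀ U ρ → dd U ρ * 2 ^ count (live U ρ) ≡ 2 ^ n
                full U ρ = trans (sym (^-distribˡ-+-* 2 (count (dead U ρ)) _)) (cong (2 ^_) (dead+live U ρ))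
                rj : rks ω j ≡ r
                rj rewrite ==-refl j = refl
                others : ∀ j′ → j′ ≢ j → rks ω j′ * rks ω j′ ≤ 2 ^ L j′
                others j′ ne rewrite dec-false (j′ Fin.≟ j) ne = drop-2^ (triv ρ j′ * triv ρ j′) ⟦ parity (live (within j′) ρ) ⟧ (proj₂ (proj₂ (trivial ρ j′)))

            conditional : ∀ τ → Conditional τ (bad τ)
            conditional τ = split-on τ (good? τ)

            -- A good `τ` needs one part with surviving mass `T = K * n′`. The condition
            -- `12 * K * suc k ≤ m` says that `24 * suc k * T` still fits into one copy, as
            -- `large-parts` requires.
            few-bad : K * nn ≤ mass fam V → ∑ (fins N) (weight label isSmall) ≤ k * suc g →
                      ∑ (vecs (tops (leaves (suc d))) N) (⟦_⟧ ∘ bad) * 2 ^ k ≤ ∣ tops (leaves (suc d)) ∣ ^ N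
            few-bad heavy light = large-parts (leaves (suc d)) {{nz}} N parts (K * n′) {{m*n≢0 K n′ {{nzK}} {{nz′}}}} k
                (λ i s j → cell fam (within j) i s) (λ j → not (isSmall (suc j))) row-cell big total T≤ bad isbad
              where
              open ≤-Reasoning
              nz : NonZero nn
              nz = pos-factor nn G≡
              nz′ : NonZero n′
              nz′ = factorʳ m n′ (subst NonZero nn≡ nz)
                where
                factorʳ : ∀ m n → NonZero (m * (2 * n)) → NonZero n
                factorʳ m (suc n) _ = _
                factorʳ (suc m) zero nz = factorʳ m zero nz
              big : ∀ j → not (isSmall (suc j)) ≡ true → nn ≤ 2 * mass fam (within j)
              big j h = <⇒≤ (≰⇒> λ le → subst Data.Bool.T (not-true⇒false h) (≤⇒≤ᵇ le))
              T≤ : 24 * suc k * (K * n′) ≤ nn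
              T≤ = begin
                24 * suc k * (K * n′)         ≡⟨ l (suc k) K n′ ⟩
                12 * K * suc k * (2 * n′)     ≤⟨ *-monoˡ-≤ (2 * n′) 12Kk≤m ⟩
                m * (2 * n′)                  ≡⟨ nn≡ ⟨
                nn                            ∎
                where l : ∀ k K n → 24 * k * (K * n) ≡ 12 * K * k * (2 * n)
                      l = solve-∀
              isbad : ∀ τ → bad τ ≡ true → ∀ j → ∑ (fins N) (λ i → side-of (proj₁ (lookup τ i)) (λ s → cell fam (within j) i s)) < K * n′
              isbad τ b j = ≤-<-trans (≤-reflexive (lower-mass τ (within j))) (≰⇒> (λ ge → case trans (sym b) (cong not (dec-true (good? τ) (j , ge))) of λ ()))
              L S : ℕ
              L = ∑ (fins parts) (λ j → ⟦ not (isSmall (suc j)) ⟧ * mass fam (within j))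
              S = ∑ (fins parts) (λ j → ⟦ isSmall (suc j) ⟧ * mass fam (within j))
              -- Small parts hold at most `96 k nn`, so a total mass of `108(k+1)nn` leaves
              -- `12(k+1)nn` to the large ones; this explains 108.
              total : 12 * suc k * nn ≤ L
              total = +-cancelˡ-≤ (96 * suc k * nn) _ _ (begin
                96 * suc k * nn + 12 * suc k * nn          ≡⟨ l₁ (suc k) nn ⟩
                108 * suc k * nn                           ≤⟨ *-monoˡ-≤ nn 108k≤K ⟩
                K * nn                                     ≤⟨ heavy ⟩
                mass fam V                                 ≡⟨ ∑-mass ⟨
                ∑ (fins parts) (λ j → mass fam (within j)) ≡⟨ ∑-cong (fins parts) (λ j → both (isSmall (suc j)) (mass fam (within j))) ⟩
                ∑ (fins parts) (λ j → ⟦ isSmall (suc j) ⟧ * mass fam (within j) + ⟦ not (isSmall (suc j)) ⟧ * mass fam (within j))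
                                                           ≡⟨ ∑-+ (fins parts) (λ j → ⟦ isSmall (suc j) ⟧ * mass fam (within j)) (λ j → ⟦ not (isSmall (suc j)) ⟧ * mass fam (within j)) ⟩
                S + L                                      ≤⟨ +-monoˡ-≤ L (begin
                  S                                            ≤⟨ ∑-small≤weight ⟩
                  ∑ (fins N) (weight label isSmall)            ≤⟨ light ⟩
                  k * suc g                                    ≡⟨ cong (k *_) G≡ ⟩
                  k * (96 * nn)                                ≤⟨ *-monoˡ-≤ (96 * nn) (n≤1+n k) ⟩
                  suc k * (96 * nn)                            ≡⟨ l₂ (suc k) nn ⟩
                  96 * suc k * nn                              ∎) ⟩
                96 * suc k * nn + L                        ∎)
                where
                l₁ : ∀ k n → 96 * k * n + 12 * k * n ≡ 108 * k * n
                l₁ = solve-∀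
                l₂ : ∀ k n → k * (96 * n) ≡ 96 * k * n
                l₂ = solve-∀
                both : ∀ b x → x ≡ ⟦ b ⟧ * x + ⟦ not b ⟧ * x
                both true  x = sym (trans (+-identityʳ (1 * x)) (+-identityʳ x))
                both false x = sym (+-identityʳ x)

            -- The summand 1 in `B + 1` pays for the bad `τ`: they have density at most `2^(-k)` and
            -- each costs at most the trivial bound.
            few-small : K * nn ≤ mass fam V → ∑ (fins N) (weight label isSmall) ≤ k * suc g → Bounded fam k (B + 1) T V
            few-small heavy light = record
              { rk = λ { (τ , ω) → Conditional.rk (conditional τ) ω }
              ; hasRank = λ { (τ , ω) → Conditional.hasRank (conditional τ) ω }
              ; small = begin
                  ∑ (seeds (suc d) N) A * 2 ^ k                           ≡⟨ cong (_* 2 ^ k) (∑-pairs Ts Ω A) ⟩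
                  ∑ Ts (λ τ → ∑ Ω (λ ω → A (τ , ω))) * 2 ^ k              ≡⟨ ∑-*ʳ Ts _ (2 ^ k) ⟨
                  ∑ Ts (λ τ → ∑ Ω (λ ω → A (τ , ω)) * 2 ^ k)              ≤⟨ ∑-mono Ts (λ τ → Conditional.small (conditional τ)) ⟩
                  ∑ Ts (λ τ → B * W + ⟦ bad τ ⟧ * 2 ^ k * W)              ≡⟨ ∑-+ Ts (λ _ → B * W) (λ τ → ⟦ bad τ ⟧ * 2 ^ k * W) ⟩
                  ∑ Ts (λ τ → B * W) + ∑ Ts (λ τ → ⟦ bad τ ⟧ * 2 ^ k * W) ≡⟨ cong₂ _+_ (∑-const Ts (B * W)) (trans (∑-*ʳ Ts (λ τ → ⟦ bad τ ⟧ * 2 ^ k) W) (cong (_* W) (∑-*ʳ Ts (⟦_⟧ ∘ bad) (2 ^ k)))) ⟩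
                  ∣ Ts ∣ * (B * W) + ∑ Ts (⟦_⟧ ∘ bad) * 2 ^ k * W         ≤⟨ +-monoʳ-≤ (∣ Ts ∣ * (B * W)) (*-monoˡ-≤ W (≤-trans (few-bad heavy light) (≤-reflexive (sym (∣vecs∣ (tops (leaves (suc d))) N))))) ⟩
                  ∣ Ts ∣ * (B * W) + ∣ Ts ∣ * W                           ≡⟨ l (∣ Ts ∣) B (2 ^ n) (∣ Ω ∣) ⟩
                  (B + 1) * (2 ^ n * (∣ Ts ∣ * ∣ Ω ∣))                    ≡⟨ cong (λ z → (B + 1) * (2 ^ n * z)) (∣pairs∣ Ts Ω) ⟨
                  (B + 1) * (2 ^ n * ∣ seeds (suc d) N ∣)                 ∎ }
              where
              open ≤-Reasoning
              Ts = vecs (tops (leaves (suc d))) N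
              Ω = seeds d (N * m)
              A : Seeds (suc d) N → ℕ
              A (τ , ω) = Conditional.rk (conditional τ) ω * Conditional.rk (conditional τ) ω * dd V (status fam (τ , ω))
              l : ∀ t B x y → t * (B * (x * y)) + t * (x * y) ≡ (B + 1) * (x * (t * y))
              l = solve-∀

    open Step public

    -- The lowest level: products of affine factors.

    module Base where

      open Family

      complete-leaves₀ : Complete (leaves 0)
      complete-leaves₀ = complete-pairs complete-bools (complete-pairs complete-bools complete-bools)

      complete-blks : ∀ (f : Blk → ℕ) b → f b ≤ ∑ blks f
      complete-blks f fixed      = m≤m+n (f fixed) (∑ (quad ∷ map (uncurry pair) (pairs (leaves 0) (leaves 0))) f)
      complete-blks f quad       = ≤-trans (m≤m+n (f quad) (∑ (map (uncurry pair) (pairs (leaves 0) (leaves 0))) f))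
                                           (m≤n+m (∑ (quad ∷ map (uncurry pair) (pairs (leaves 0) (leaves 0))) f) (f fixed))
      complete-blks f (pair y z) = ≤-trans (term≤∑ (complete-pairs complete-leaves₀ complete-leaves₀) (f ∘ uncurry pair) (y , z))
        (≤-trans (≤-reflexive (sym (∑-map (uncurry pair) (pairs (leaves 0) (leaves 0)) f)))
        (≤-trans (m≤n+m (∑ (map (uncurry pair) (pairs (leaves 0) (leaves 0))) f) (f quad))
                 (m≤n+m (∑ (quad ∷ map (uncurry pair) (pairs (leaves 0) (leaves 0))) f) (f fixed))))

      module _ {n N} (fam : Family n N 0) {T : Fn n} (P : Product Affine T) (V : Fin n → Bool) where

        open Parts fam P V

        private
          ρ : Vec Blk N → Fin n → Status
          ρ = status fam

        L : Vec Blk N → Fin parts → ℕ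
        L v j = count (live (within j) (ρ v))

        -- With 0 or 1 free variables the trivial bound is at least as good as rank 2; from 3 on,
        -- `2² * 2 ≤ 2^L`. The separate bound `r * r ≤ 4` is kept for the case of one large part.
        affine-or-trivial : ∀ v j → ∃[ r ] (HasRank (matrix (factor j) (within j) (ρ v)) r × r * r * 2 ^ ⟦ lossy (L v j) ⟧ ≤ 2 ^ L v j × r * r ≤ 4)
        affine-or-trivial v j with trivial-rank (factor j) (within j) (ρ v) (factor-ext j)
        ... | r , h , b rewrite parity-odd (live (within j) (ρ v)) with L v j
        ...   | 0 = r , h , b , ≤-trans (drop-2^ (r * r) 0 b) (s≤s z≤n)
        ...   | 1 = r , h , b , ≤-trans (drop-2^ (r * r) 1 b) (s≤s (s≤s z≤n))
        ...   | 2 = 2 , affine-rank (factor j) (within j) (ρ v) (inClass j) , ≤-refl , ≤-refl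
        ...   | suc (suc (suc x)) = 2 , affine-rank (factor j) (within j) (ρ v) (inClass j) , ^-monoʳ-≤ 2 {3} {suc (suc (suc x))} (s≤s (s≤s (s≤s z≤n))) , ≤-refl

        rk₀ : Vec Blk N → Fin parts → ℕ
        rk₀ v j = proj₁ (affine-or-trivial v j)

        A : Vec Blk N → ℕ
        A v = ∏ parts (rk₀ v) * ∏ parts (rk₀ v) * 2 ^ count (dead V (ρ v))

        private
          full : ∀ v → 2 ^ count (live V (ρ v)) * 2 ^ count (dead V (ρ v)) ≡ 2 ^ n
          full v = trans (*-comm (2 ^ count (live V (ρ v))) _) (trans (sym (^-distribˡ-+-* 2 (count (dead V (ρ v))) _)) (cong (2 ^_) (dead+live V (ρ v))))

        open ≤-Reasoning

        A-lossy : ∀ v → A v * 2 ^ ∑ (fins parts) (λ j → ⟦ lossy (L v j) ⟧) ≤ 2 ^ n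
        A-lossy v = begin
          p * p * D * 2 ^ e                      ≡⟨ l (p * p) D (2 ^ e) ⟩
          p * p * 2 ^ e * D                      ≤⟨ *-monoˡ-≤ D (∏² parts (rk₀ v) _ (L v) (λ j → proj₁ (proj₂ (proj₂ (affine-or-trivial v j))))) ⟩
          2 ^ ∑ (fins parts) (L v) * D           ≡⟨ cong (λ z → 2 ^ z * D) (∑-live (ρ v)) ⟩
          2 ^ count (live V (ρ v)) * D           ≡⟨ full v ⟩
          2 ^ n                                  ∎
          where
          p = ∏ parts (rk₀ v)
          D = 2 ^ count (dead V (ρ v))
          e = ∑ (fins parts) (λ j → ⟦ lossy (L v j) ⟧)
          l : ∀ x y z → x * y * z ≡ x * z * y
          l = solve-∀

        -- A single affine factor has squared rank at most 4 however many free variables it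
        -- contains, so a part with many of them is enough.
        A-one : ∀ v j → A v * 2 ^ L v j ≤ 4 * 2 ^ n
        A-one v j = begin
          p * p * D * 2 ^ L v j                                  ≡⟨ l (p * p) D (2 ^ L v j) ⟩
          p * p * 2 ^ L v j * D                                  ≤⟨ *-monoˡ-≤ D (∏²-one parts (rk₀ v) (L v) j (λ j′ _ → drop-2^ (rk₀ v j′ * rk₀ v j′) ⟦ lossy (L v j′) ⟧ (proj₁ (proj₂ (proj₂ (affine-or-trivial v j′)))))) ⟩
          rk₀ v j * rk₀ v j * 2 ^ ∑ (fins parts) (L v) * D       ≡⟨ cong (λ z → rk₀ v j * rk₀ v j * 2 ^ z * D) (∑-live (ρ v)) ⟩
          rk₀ v j * rk₀ v j * 2 ^ count (live V (ρ v)) * D       ≡⟨ trans (*-assoc (rk₀ v j * rk₀ v j) _ D) (cong (rk₀ v j * rk₀ v j *_) (full v)) ⟩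
          rk₀ v j * rk₀ v j * 2 ^ n                              ≤⟨ *-monoˡ-≤ (2 ^ n) (proj₂ (proj₂ (proj₂ (affine-or-trivial v j)))) ⟩
          4 * 2 ^ n                                              ∎
          where
          p = ∏ parts (rk₀ v)
          D = 2 ^ count (dead V (ρ v))
          l : ∀ x y z → x * y * z ≡ x * z * y
          l = solve-∀

        bounded₀ : ∀ k → ∑ (vecs blks N) A * 2 ^ k ≤ 2 ^ n * ∣ blks ∣ ^ N → Bounded fam k 1 T V
        bounded₀ k h = record
          { rk = λ v → ∏ parts (rk₀ v)
          ; hasRank = λ v → product-rank (ρ v) (λ j → proj₁ (proj₂ (affine-or-trivial v j)))
          ; small = ≤-trans h (≤-reflexive (trans (cong (2 ^ n *_) (sym (∣vecs∣ blks N))) (sym (*-identityˡ _)))) }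

        pairAt : Bool → Leaf 0 → Leaf 0 → Blk
        pairAt true  l l′ = pair l l′
        pairAt false l l′ = pair l′ l

        pairAt-live : ∀ t l l′ → alive (blkSt (pairAt t l l′) t l) ≡ true
        pairAt-live true  l l′ = cong alive (leafSt-self 0 SY l)
        pairAt-live false l l′ = cong alive (leafSt-self 0 SZ l)

        pairAt-only : ∀ t l l′ t₁ l₁ → alive (blkSt (pairAt t l l′) t₁ l₁) ≡ true → (t₁ ≡ t × l₁ ≡ l) ⊎ (t₁ ≡ not t × l₁ ≡ l′)
        pairAt-only true  l l′ true  l₁ al = inj₁ (refl , leafSt-alive 0 SY l l₁ al)
        pairAt-only true  l l′ false l₁ al = inj₂ (refl , leafSt-alive 0 SZ l′ l₁ al)
        pairAt-only false l l′ true  l₁ al = inj₂ (refl , leafSt-alive 0 SY l′ l₁ al)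
        pairAt-only false l l′ false l₁ al = inj₁ (refl , leafSt-alive 0 SZ l l₁ al)

        fixed-none : ∀ t l → alive (blkSt fixed t l) ≡ false
        fixed-none true  l = oneSt-fixed 0 l
        fixed-none false l = refl

        setBlk : Vec Blk N → Fin N → Blk → Vec Blk N
        setBlk v i b = v Vec.[ i ]≔ b

        set-off : ∀ v i b → OffBy i v (setBlk v i b)
        set-off v i b i′ ne = sym (Vecₚ.lookup∘update′ ne v b)

        set-at : ∀ v i b {x t l} → pos fam x ≡ inj₂ (i , t , l) → ρ (setBlk v i b) x ≡ blkSt b t l
        set-at v i b {t = t} {l} px rewrite px = cong (λ b → blkSt b t l) (Vecₚ.lookup∘update i v b)

        off-status : ∀ {i} v v′ → OffBy i v v′ → ∀ x → (∀ t l → pos fam x ≢ inj₂ (i , t , l)) → ρ v x ≡ ρ v′ x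
        off-status {i} v v′ off x no-i with pos fam x
        ... | inj₁ s = refl
        ... | inj₂ (i′ , t , l) = cong (λ b → blkSt b t l) (off i′ (λ { refl → no-i t l refl }))

        cells : Fin parts → Fin N → ℕ
        cells j i = cell fam (within j) i true + cell fam (within j) i false

        cells≤16 : ∀ j i → cells j i ≤ 16
        cells≤16 j i = +-mono-≤ (∑-mono (leaves 0) (λ l → ⟦⟧-≤1 (onBlock? fam (within j) i true l))) (∑-mono (leaves 0) (λ l → ⟦⟧-≤1 (onBlock? fam (within j) i false l)))

        cells-∃ : ∀ j i → 1 ≤ cells j i → ∃[ t ] ∃[ l ] onBlock? fam (within j) i t l ≡ true
        cells-∃ j i h with 1 ≤? cell fam (within j) i true
        ... | yes h₁ = let (l , e) = ∑-positive (leaves 0) (onBlock? fam (within j) i true) h₁ in true , l , e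
        ... | no ≰ = let (l , e) = ∑-positive (leaves 0) (onBlock? fam (within j) i false) (≤-trans h (+-monoˡ-≤ _ (≤-pred (≰⇒> ≰)))) in false , l , e

        onBlock-cells : ∀ j i t l → onBlock? fam (within j) i t l ≡ true → 1 ≤ cells j i
        onBlock-cells j i true  l e = ≤-trans (≤-trans (≤-reflexive (sym (cong ⟦_⟧ e))) (term≤∑ complete-leaves₀ (λ l → ⟦ onBlock? fam (within j) i true l ⟧) l)) (m≤m+n _ _)
        onBlock-cells j i false l e = ≤-trans (≤-trans (≤-reflexive (sym (cong ⟦_⟧ e))) (term≤∑ complete-leaves₀ (λ l → ⟦ onBlock? fam (within j) i false l ⟧) l)) (m≤n+m _ (cell fam (within j) i true))

        onBlock-var : ∀ j i t l → onBlock? fam (within j) i t l ≡ true → ∃[ x ] (pos fam x ≡ inj₂ (i , t , l) × within j x ≡ true × inv fam i t l ≡ just x)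
        onBlock-var j i t l e with inv fam i t l in ix
        ... | just x = x , inv-pos fam ix , e , refl

        var-onBlock : ∀ j i t l {x} → pos fam x ≡ inj₂ (i , t , l) → within j x ≡ true → onBlock? fam (within j) i t l ≡ true
        var-onBlock j i t l px wx rewrite pos-inv fam px = wx

        Hit : Fin N → Vec Blk N → Fin parts → Set
        Hit i v j = ∃[ v′ ] (OffBy i v v′ × lossy (L v′ j) ≡ true)

        -- Making the block constant, or freeing the pair `l`, `l′`, of which only `l` lies in the
        -- part, gives two restrictions whose parities on the part differ; one of them is odd.
        hit-flip : ∀ i v j t l l′ → onBlock? fam (within j) i t l ≡ true → onBlock? fam (within j) i (not t) l′ ≡ false → Hit i v j
        hit-flip i v j t l l′ on off with onBlock-var j i t l on
        ... | x₀ , px₀ , wx₀ , ix₀ = choose (parity (live (within j) (ρ v₀))) refl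
          where
          v₁ = setBlk v i (pairAt t l l′)
          v₀ = setBlk v i fixed
          at₁ : live (within j) (ρ v₁) x₀ ≡ true
          at₁ = cong₂ _∧_ wx₀ (trans (cong alive (set-at v i (pairAt t l l′) px₀)) (pairAt-live t l l′))
          none : ∀ x t₁ l₁ → pos fam x ≡ inj₂ (i , t₁ , l₁) → alive (ρ v₀ x) ≡ false
          none x t₁ l₁ px = trans (cong alive (set-at v i fixed px)) (fixed-none t₁ l₁)
          at₀ : live (within j) (ρ v₀) x₀ ≡ false
          at₀ = cong₂ _∧_ wx₀ (none x₀ t l px₀)
          rest : ∀ x → x ≢ x₀ → live (within j) (ρ v₁) x ≡ live (within j) (ρ v₀) x
          rest x ne with within j x in wx
          ... | false = refl
          ... | true  = go (pos fam x) refl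
            where
            only : ∀ t₁ l₁ → pos fam x ≡ inj₂ (i , t₁ , l₁) → ∀ b → alive (blkSt (pairAt t l l′) t₁ l₁) ≡ b → b ≡ false
            only t₁ l₁ px false al = refl
            only t₁ l₁ px true  al with pairAt-only t l l′ t₁ l₁ al
            ... | inj₁ (refl , refl) = ⊥-elim (ne (just-injective (trans (sym (pos-inv fam px)) ix₀)))
            ... | inj₂ (refl , refl) = case trans (sym off) (var-onBlock j i (not t) l′ px wx) of λ ()
            go : ∀ p → pos fam x ≡ p → alive (ρ v₁ x) ≡ alive (ρ v₀ x)
            go (inj₁ s) px = cong alive (trans (sym (off-status v v₁ (set-off v i (pairAt t l l′)) x (λ t l e → case trans (sym px) e of λ ()))) (off-status v v₀ (set-off v i fixed) x (λ t l e → case trans (sym px) e of λ ())))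
            go (inj₂ (i′ , t₁ , l₁)) px with i′ Fin.≟ i
            ... | yes refl = trans (cong alive (set-at v i (pairAt t l l′) px)) (trans (only t₁ l₁ px _ refl) (sym (none x t₁ l₁ px)))
            ... | no i≢ = cong alive (trans (sym (off-status v v₁ (set-off v i (pairAt t l l′)) x (elsewhere))) (off-status v v₀ (set-off v i fixed) x elsewhere))
              where
              elsewhere : ∀ t l → pos fam x ≢ inj₂ (i , t , l)
              elsewhere t l e with trans (sym px) e
              ... | refl = i≢ refl
          flip : parity (live (within j) (ρ v₁)) ≡ not (parity (live (within j) (ρ v₀)))
          flip = parity-flip _ _ x₀ (trans at₁ (cong not (sym at₀))) rest
          choose : ∀ b → parity (live (within j) (ρ v₀)) ≡ b → Hit i v j
          choose true  e = v₀ , set-off v i fixed , odd⇒lossy (L v₀ j) (trans (sym (parity-odd (live (within j) (ρ v₀)))) e)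
          choose false e = v₁ , set-off v i (pairAt t l l′) , odd⇒lossy (L v₁ j) (trans (sym (parity-odd (live (within j) (ρ v₁)))) (trans flip (cong not e)))

        hit-quad : ∀ i v j → (∀ l → onBlock? fam (within j) i true l ≡ true) → Hit i v j
        hit-quad i v j all = setBlk v i quad , set-off v i quad , 3≤⇒lossy (three≤count _ (x l₁) (x l₂) (x l₃)
            (λ e → case pos-eq e of λ ()) (λ e → case pos-eq e of λ ()) (λ e → case pos-eq e of λ ()) (lv l₁ refl) (lv l₂ refl) (lv l₃ refl))
          where
          l₁ l₂ l₃ : Leaf 0
          l₁ = false , false , false
          l₂ = false , true , false
          l₃ = true , false , false
          x : Leaf 0 → Fin n
          x l = proj₁ (onBlock-var j i true l (all l))
          px : ∀ l → pos fam (x l) ≡ inj₂ (i , true , l)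
          px l = proj₁ (proj₂ (onBlock-var j i true l (all l)))
          pos-eq : ∀ {l l′} → x l ≡ x l′ → l ≡ l′
          pos-eq {l} {l′} e with trans (sym (px l)) (trans (cong (pos fam) e) (px l′))
          ... | refl = refl
          lv : ∀ l → alive (quadSt l) ≡ true → live (within j) (ρ (setBlk v i quad)) (x l) ≡ true
          lv l al = cong₂ _∧_ (proj₁ (proj₂ (proj₂ (onBlock-var j i true l (all l))))) (trans (cong alive (set-at v i quad (px l))) al)

        -- A pair that meets the part on one side only flips its parity. No such pair exists exactly
        -- when the part contains the whole block; then every pair adds an even number, and the
        -- block with four free variables is needed.
        hit : ∀ i v j → 1 ≤ cells j i → Hit i v j
        hit i v j h with cells-∃ j i h
        ... | t , l , on with search-bool³ (onBlock? fam (within j) i (not t))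
        ...   | inj₂ (l′ , off) = hit-flip i v j t l l′ on off
        ...   | inj₁ all₁ with search-bool³ (onBlock? fam (within j) i t)
        ...     | inj₂ (l′ , off) = hit-flip i v j (not t) l l′ (all₁ l) (subst (λ t → onBlock? fam (within j) i t l′ ≡ false) (sym (Boolₚ.not-involutive t)) off)
        ...     | inj₁ all₂ = hit-quad i v j (side t all₁ all₂)
          where
          side : ∀ t → (∀ l → onBlock? fam (within j) i (not t) l ≡ true) → (∀ l → onBlock? fam (within j) i t l ≡ true) → ∀ l → onBlock? fam (within j) i true l ≡ true
          side true  a b = b
          side false a b = a

        -- A block meets at most 16 parts and a part at most `D` blocks. The mass divided by 16
        -- bounds the number of incidences from below, and each touched part can be made lossy by
        -- its block.
        all-small : ∀ p .{{_ : NonZero p}} → 2 * ∣ blks ∣ ≡ suc p → ∀ k D .{{_ : NonZero D}} → (∀ j → mass fam (within j) ≤ D) →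
          k * suc p * (16 * D) * 16 ≤ mass fam V → Bounded fam k 1 T V
        all-small p 2blks k D small big = bounded₀ k (halving p k (∑ (vecs blks N) A) (2 ^ n * ∣ blks ∣ ^ N)
            (bounded-parts blks fixed complete-blks p 2blks 16 D N touch (λ v j → lossy (L v j)) (λ _ → true) A (2 ^ n)
              loc (λ i v j t → hit i v j (≤ᵇ⇒≤ _ _ (subst Data.Bool.T (sym t) tt))) row col A-lossy (k * suc p) enough))
          where
          touch : Fin N → Fin parts → Bool
          touch i j = 1 ≤ᵇ cells j i
          touch≤ : ∀ x → ⟦ 1 ≤ᵇ x ⟧ ≤ x
          touch≤ zero    = z≤n
          touch≤ (suc x) = s≤s z≤n
          loc : ∀ i v v′ j → touch i j ≡ false → OffBy i v v′ → lossy (L v j) ≡ lossy (L v′ j)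
          loc i v v′ j t off = cong lossy (count-cong pt)
            where
            pt : ∀ x → live (within j) (ρ v) x ≡ live (within j) (ρ v′) x
            pt x with within j x in wx
            ... | false = refl
            ... | true  = cong alive (off-status v v′ off x (λ t₁ l₁ px → subst Data.Bool.T t (≤⇒≤ᵇ (onBlock-cells j i t₁ l₁ (var-onBlock j i t₁ l₁ px wx)))))
          row : ∀ i → ∑ (fins parts) (⟦_⟧ ∘ touch i) ≤ 16
          row i = ≤-trans (∑-mono (fins parts) (λ j → touch≤ (cells j i))) (≤-trans (≤-reflexive (∑-+ (fins parts) (λ j → cell fam (within j) i true) (λ j → cell fam (within j) i false)))
            (+-mono-≤ (row-cell i true) (row-cell i false)))
          col : ∀ j → true ≡ true → ∑ (fins N) (λ i → ⟦ touch i j ⟧) ≤ D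
          col j _ = ≤-trans (∑-mono (fins N) (λ i → touch≤ (cells j i))) (small j)
          W = ∑ (fins N) (λ i → ∑ (fins parts) (λ j → ⟦ touch i j ⟧))
          cells≤ : ∀ j i → cells j i ≤ ⟦ touch i j ⟧ * 16
          cells≤ j i with cells j i | cells≤16 j i
          ... | zero  | _ = z≤n
          ... | suc x | h = h
          enough : k * suc p * (16 * D) ≤ W
          enough = *-cancelʳ-≤ _ _ 16 (begin
            k * suc p * (16 * D) * 16                                    ≤⟨ big ⟩
            mass fam V                                                   ≡⟨ ∑-mass ⟨
            ∑ (fins parts) (λ j → mass fam (within j))                   ≡⟨ ∑-swap (fins parts) (fins N) cells ⟩
            ∑ (fins N) (λ i → ∑ (fins parts) (λ j → cells j i))          ≤⟨ ∑-mono (fins N) (λ i → ≤-trans (∑-mono (fins parts) (λ j → cells≤ j i)) (≤-reflexive (∑-*ʳ (fins parts) (⟦_⟧ ∘ touch i) 16))) ⟩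
            ∑ (fins N) (λ i → ∑ (fins parts) (λ j → ⟦ touch i j ⟧) * 16) ≡⟨ ∑-*ʳ (fins N) (λ i → ∑ (fins parts) (λ j → ⟦ touch i j ⟧)) 16 ⟩
            W * 16                                                       ∎)

        -- Here `bounded-parts` runs over single variables: one variable of the part is chosen in
        -- each block it meets, and being free is the event that counts. The initial loss of 4 is
        -- compensated by `2 + k` in place of `k`.
        one-large : ∀ p .{{_ : NonZero p}} → 2 * ∣ blks ∣ ≡ suc p → ∀ k j → (2 + k) * suc p * 16 ≤ mass fam (within j) → Bounded fam k 1 T V
        one-large p 2blks k j big = bounded₀ k (*-cancelˡ-≤ 4 (begin
            4 * (∑ (vecs blks N) A * 2 ^ k)              ≡⟨ l₁ (∑ (vecs blks N) A) (2 ^ k) ⟩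
            ∑ (vecs blks N) A * 2 ^ (2 + k)              ≤⟨ halving p (2 + k) (∑ (vecs blks N) A) (4 * 2 ^ n * ∣ blks ∣ ^ N)
                                                              (bounded-parts blks fixed complete-blks p 2blks 1 1 N touch lost (λ _ → true) A (4 * 2 ^ n)
                                                                 loc hits row col bd ((2 + k) * suc p) (≤-trans (≤-reflexive (*-identityʳ _)) enough)) ⟩
            4 * 2 ^ n * ∣ blks ∣ ^ N                     ≡⟨ *-assoc 4 (2 ^ n) _ ⟩
            4 * (2 ^ n * ∣ blks ∣ ^ N)                   ∎))
          where
          l₁ : ∀ x y → 4 * (x * y) ≡ x * (2 * (2 * y))
          l₁ = solve-∀
          inBlock : Position N 0 → Fin N → Bool
          inBlock (inj₁ _)        i = false
          inBlock (inj₂ (i′ , _)) i = i′ == i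
          inBlock-pos : ∀ p i → inBlock p i ≡ true → ∃[ t ] ∃[ l ] p ≡ inj₂ (i , t , l)
          inBlock-pos (inj₂ (i′ , t , l)) i e with ==⇒≡ i′ i e
          ... | refl = t , l , refl
          candidate : Fin N → Fin n → Bool
          candidate i x = within j x ∧ inBlock (pos fam x) i
          rep? : ∀ i → Dec (∃[ x ] candidate i x ≡ true)
          rep? i = Finₚ.any? (λ x → candidate i x Data.Bool.≟ true)
          -- One variable of the part is chosen in each block.
          chosen : ∀ {i} → Dec (∃[ x ] candidate i x ≡ true) → Fin n → Bool
          chosen (yes (y , _)) x = y == x
          chosen (no _)        x = false
          touch : Fin N → Fin n → Bool
          touch i = chosen (rep? i)
          chosen-cand : ∀ {i} (r : Dec (∃[ x ] candidate i x ≡ true)) x → chosen r x ≡ true → candidate i x ≡ true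
          chosen-cand (yes (y , e)) x h with ==⇒≡ y x h
          ... | refl = e
          touch-pos : ∀ i x → touch i x ≡ true → ∃[ t ] ∃[ l ] (pos fam x ≡ inj₂ (i , t , l) × within j x ≡ true)
          touch-pos i x h with chosen-cand (rep? i) x h
          ... | e with inBlock-pos (pos fam x) i (∧-trueʳ (within j x) e)
          ...   | t , l , px = t , l , px , ∧-trueˡ (within j x) e
          isRep? : ∀ x → Dec (∃[ i ] touch i x ≡ true)
          isRep? x = Finₚ.any? (λ i → touch i x Data.Bool.≟ true)
          lost : Vec Blk N → Fin n → Bool
          lost v x = live (within j) (ρ v) x ∧ does (isRep? x)
          loc : ∀ i v v′ x → touch i x ≡ false → OffBy i v v′ → lost v x ≡ lost v′ x
          loc i v v′ x t off with isRep? x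
          ... | no _ = trans (Boolₚ.∧-zeroʳ _) (sym (Boolₚ.∧-zeroʳ _))
          ... | yes (i′ , t′) = cong (λ s → (within j x ∧ alive s) ∧ true) (off-status v v′ off x elsewhere)
            where
            elsewhere : ∀ t₁ l₁ → pos fam x ≢ inj₂ (i , t₁ , l₁)
            elsewhere t₁ l₁ px with touch-pos i′ x t′
            ... | _ , _ , px′ , _ with trans (sym px) px′
            ...   | refl = case trans (sym t) t′ of λ ()
          hits : ∀ i v x → touch i x ≡ true → ∃[ v′ ] (OffBy i v v′ × lost v′ x ≡ true)
          hits i v x t with touch-pos i x t
          ... | s , l , px , wx = setBlk v i (pairAt s l l) , set-off v i (pairAt s l l) ,
            cong₂ _∧_ (cong₂ _∧_ wx (trans (cong alive (set-at v i (pairAt s l l) px)) (pairAt-live s l l))) (dec-true (isRep? x) (i , t))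
          row : ∀ i → ∑ (fins n) (⟦_⟧ ∘ touch i) ≤ 1
          row i = ∑≤1 (touch i) (same-rep (rep? i))
            where
            same-rep : ∀ (r : Dec (∃[ x ] candidate i x ≡ true)) x y → chosen r x ≡ true → chosen r y ≡ true → x ≡ y
            same-rep (yes (z , _)) x y p q = trans (sym (==⇒≡ z x p)) (==⇒≡ z y q)
          col : ∀ x → true ≡ true → ∑ (fins N) (λ i → ⟦ touch i x ⟧) ≤ 1
          col x _ = ∑≤1 (λ i → touch i x) same-block
            where
            same-block : ∀ i i′ → touch i x ≡ true → touch i′ x ≡ true → i ≡ i′
            same-block i i′ p q with touch-pos i x p | touch-pos i′ x q
            ... | _ , _ , px , _ | _ , _ , px′ , _ with trans (sym px) px′
            ...   | refl = refl
          bd : ∀ v → A v * 2 ^ ∑ (fins n) (λ x → ⟦ true ∧ lost v x ⟧) ≤ 4 * 2 ^ n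
          bd v = ≤-trans (*-monoʳ-≤ (A v) (^-monoʳ-≤ 2 (∑-mono (fins n) (λ x → ⟦⟧-∧-≤ˡ (live (within j) (ρ v) x) (does (isRep? x)))))) (A-one v j)
          W = ∑ (fins N) (λ i → ∑ (fins n) (λ x → ⟦ touch i x ⟧))
          cells≤ : ∀ i → cells j i ≤ ∑ (fins n) (⟦_⟧ ∘ touch i) * 16
          cells≤ i = pt (rep? i)
            where
            pt : ∀ r → cells j i ≤ ∑ (fins n) (⟦_⟧ ∘ chosen {i} r) * 16
            pt (yes (y , e)) = ≤-trans (cells≤16 j i) (*-monoˡ-≤ 16 (≤-trans (≤-reflexive (sym (cong ⟦_⟧ (==-refl y)))) (≤∑-fins (λ x → ⟦ y == x ⟧) y)))
            pt (no none) with 1 ≤? cells j i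
            ... | no ≰ = ≤-trans (≤-pred (≰⇒> ≰)) z≤n
            ... | yes h with cells-∃ j i h
            ...   | t , l , on with onBlock-var j i t l on
            ...     | x , px , wx , _ = ⊥-elim (none (x , cong₂ _∧_ wx (trans (cong (λ p → inBlock p i) px) (==-refl i))))
          enough : (2 + k) * suc p ≤ W
          enough = *-cancelʳ-≤ _ _ 16 (begin
            (2 + k) * suc p * 16                                         ≤⟨ big ⟩
            ∑ (fins N) (cells j)                                         ≤⟨ ∑-mono (fins N) cells≤ ⟩
            ∑ (fins N) (λ i → ∑ (fins n) (λ x → ⟦ touch i x ⟧) * 16)     ≡⟨ ∑-*ʳ (fins N) (λ i → ∑ (fins n) (λ x → ⟦ touch i x ⟧)) 16 ⟩
            W * 16                                                       ∎)

        base-bounded : ∀ p .{{_ : NonZero p}} → 2 * ∣ blks ∣ ≡ suc p → ∀ k D .{{_ : NonZero D}} → (2 + k) * suc p * 16 ≤ D →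
          k * suc p * (16 * D) * 16 ≤ mass fam V → Bounded fam k 1 T V
        base-bounded p 2blks k D D≥ big with Finₚ.any? (λ j → D ≤? mass fam (within j))
        ... | yes (j , h) = one-large p 2blks k j (≤-trans D≥ h)
        ... | no none     = all-small p 2blks k D (λ j → <⇒≤ (≰⇒> (λ h → none (j , h)))) big

    open Base public

    -- The induction over the layers and the comparison with the hard polynomial.

    module LowerBound where

      open Family
      open Bounded

      private
        nonzero-m : NonZero m
        nonzero-m = inhabited i₀
          where
          inhabited : ∀ {m} → Fin m → NonZero m
          inhabited zero    = _
          inhabited (suc _) = _

      leaves-nonzero : ∀ d → NonZero ∣ leaves d ∣
      leaves-nonzero zero    = _
      leaves-nonzero (suc d) = subst NonZero (sym (trans (∣pairs∣ (fins m) (pairs bools (leaves d))) (cong₂ _*_ (∣fins∣ m) (∣pairs∣ bools (leaves d)))))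
        (m*n≢0 m (2 * ∣ leaves d ∣) {{nonzero-m}} {{m*n≢0 2 ∣ leaves d ∣ {{_}} {{leaves-nonzero d}}}})

      seeds-nonzero : ∀ d N → NonZero ∣ seeds d N ∣
      seeds-nonzero zero    N = subst NonZero (sym (∣vecs∣ blks N)) (m^n≢0 66 N)
      seeds-nonzero (suc d) N = subst NonZero (sym (∣pairs∣ (vecs (tops (leaves (suc d))) N) (seeds d (N * m))))
        (m*n≢0 ∣ vecs (tops (leaves (suc d))) N ∣ ∣ seeds d (N * m) ∣ {{vec}} {{seeds-nonzero d (N * m)}})
        where
        n = ∣ leaves (suc d) ∣
        vec : NonZero ∣ vecs (tops (leaves (suc d))) N ∣
        vec = subst NonZero (sym (trans (∣vecs∣ (tops (leaves (suc d))) N) (cong (_^ N) (∣tops∣ (leaves (suc d))))))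
          (m^n≢0 (6 * (n * n)) N {{m*n≢0 6 (n * n) {{_}} {{m*n≢0 n n {{leaves-nonzero (suc d)}} {{leaves-nonzero (suc d)}}}}}})

      weaken : ∀ {n N d} {fam : Family n N d} {k B B′ f V} → B ≤ B′ → Bounded fam k B f V → Bounded fam k B′ f V
      weaken {n} {N} {d} B≤ b = record { rk = rk b ; hasRank = hasRank b ; small = ≤-trans (small b) (*-monoˡ-≤ (2 ^ n * ∣ seeds d N ∣) B≤) }

      module _ (s k : ℕ) (t : Thresholds k) (large : 12 * Thresholds.K t * suc k ≤ m) where

        open Thresholds t

        private
          S C : ℕ
          S = suc s
          C = 2 * (S * S)

        -- The bounds satisfy `B(d+1) = S²(B(d) + 1) ≤ 2S² B(d)`, so `C = 2S²` gives `C ^ suc d`.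
        -- The statement ranges over all families and all `V` because the hypothesis is used for one
        -- part of a lower family; the mass is measured in units of one copy, so `K` is the same at
        -- every level.
        claim : ∀ d {n N} (fam : Family n N d) f V → Cls S (suc d) f → K * ∣ leaves d ∣ ≤ mass fam V → Bounded fam k (C ^ suc d) f V
        claim zero fam f V (T , terms , sp) heavy = weaken {fam = fam} (≤-trans (≤-reflexive (*-identityʳ (S * S))) (≤-trans (m≤m+n (S * S) (S * S + 0)) (≤-reflexive (sym (*-identityʳ C)))))
            (bounded-span fam k 1 S T f V sp term)
          where
          term : ∀ t → Bounded fam k 1 (T t) V
          term t with terms t
          ... | inj₁ z = bounded-zero fam k 1 (T t) V z
          ... | inj₂ P = base-bounded fam P V p {{p≢0}} 2blks k D {{D≢0}} D-large (≤-trans K-base heavy)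
        claim (suc d) {n} {N} fam f V (T , terms , sp) heavy = weaken {fam = fam} sum≤ (bounded-span fam k (C ^ suc d + 1) S T f V sp term)
          where
          nn = ∣ leaves (suc d) ∣
          sum≤ : S * S * (C ^ suc d + 1) ≤ C ^ suc (suc d)
          sum≤ = ≤-trans (*-monoʳ-≤ (S * S) (+-monoʳ-≤ (C ^ suc d) (>-nonZero⁻¹ (C ^ suc d) {{m^n≢0 C (suc d)}}))) (≤-reflexive (l (S * S) (C ^ suc d)))
            where l : ∀ a x → a * (x + x) ≡ 2 * a * x
                  l = solve-∀
          from : ∀ {T} (P : Product (Cls S (suc d)) T) g → NonZero g → suc g ≡ 96 * nn → Bounded fam k (C ^ suc d + 1) T V
          from {T} P g nz G≡ with k * suc g ≤? ∑ (fins N) (SmallParts.weight (leaves (suc d)) g G≡ (Parts.label fam P V) (isSmall fam P V))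
          ... | yes enough = weaken {fam = fam} (m≤n+m 1 (C ^ suc d)) (many-small fam P V g {{nz}} G≡ k enough)
          ... | no few     = few-small fam P V g {{nz}} G≡ k K (C ^ suc d) {{K≢0}} K-step large
                               (λ τ j → claim d (lower fam τ) (Product.factor P j) (OfProduct.within P V j) (Product.inClass P j)) heavy (<⇒≤ (≰⇒> few))
          term : ∀ t → Bounded fam k (C ^ suc d + 1) (T t) V
          term t with terms t
          ... | inj₁ z = bounded-zero fam k _ (T t) V z
          ... | inj₂ P = pick (96 * nn) refl (m≤m*n 96 nn {{leaves-nonzero (suc d)}})
            where
            -- Writes `96 * nn` as the successor of a nonzero `g`, as `halving` requires.
            pick : ∀ G → G ≡ 96 * nn → 96 ≤ G → Bounded fam k (C ^ suc d + 1) (T t) V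
            pick (suc (suc g)) G≡ _ = from P (suc g) _ G≡
            pick (suc zero) _ (s≤s ())

        -- For every restriction the hard polynomial has cost at least `2 ^ n`, so its average
        -- cannot be as small as `claim` asserts unless `C ^ suc d` absorbs the factor `2 ^ k`.
        size-bound : ∀ d f → (∀ v → f v ≈ eval (P F m (suc d)) v) → Cls S (suc d) f → 2 ^ k ≤ C ^ suc d
        size-bound d f f≈P cls = *-cancelʳ-≤ _ _ (2 ^ n * Ω) {{m*n≢0 (2 ^ n) Ω {{m^n≢0 2 n}} {{seeds-nonzero d m}}}} (begin
          2 ^ k * (2 ^ n * Ω)            ≡⟨ *-comm (2 ^ k) (2 ^ n * Ω) ⟩
          2 ^ n * Ω * 2 ^ k              ≤⟨ *-monoˡ-≤ (2 ^ k) (begin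
            2 ^ n * Ω                        ≡⟨ *-comm (2 ^ n) Ω ⟩
            Ω * 2 ^ n                        ≡⟨ ∑-const (seeds d m) (2 ^ n) ⟨
            ∑ (seeds d m) (λ _ → 2 ^ n)      ≤⟨ ∑-mono (seeds d m) full ⟩
            cost fam all (rk b)              ∎) ⟩
          cost fam all (rk b) * 2 ^ k    ≤⟨ small b ⟩
          C ^ suc d * (2 ^ n * Ω)        ∎)
          where
          open ≤-Reasoning
          n = numVars F m (suc d)
          Ω = ∣ seeds d m ∣
          fam = topFamily d
          all : Fin n → Bool
          all _ = true
          K≤m : K ≤ m
          K≤m = ≤-trans (≤-trans (m≤n*m K 12) (m≤m*n (12 * K) (suc k))) large
          heavy : K * ∣ leaves d ∣ ≤ mass fam all
          heavy = ≤-trans (*-mono-≤ K≤m (m≤m+n ∣ leaves d ∣ ∣ leaves d ∣)) (≤-reflexive (trans (cong (_* (∣ leaves d ∣ + ∣ leaves d ∣)) (sym (∣fins∣ m))) (sym (∑-const (fins m) _))))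
          b = claim d fam f all cls heavy
          full : ∀ ω → 2 ^ n ≤ rk b ω * rk b ω * 2 ^ count (dead all (status fam ω))
          full ω = begin
            2 ^ n                                      ≡⟨ cong (2 ^_) (dead+live all ρ) ⟨
            2 ^ (e + count (live all ρ))               ≡⟨ cong (2 ^_) (trans (cong (e +_) live≡) (+-comm e (y + z))) ⟩
            2 ^ (y + z + e)                            ≡⟨ trans (^-distribˡ-+-* 2 (y + z) e) (cong (_* 2 ^ e) (^-distribˡ-+-* 2 y z)) ⟩
            2 ^ y * 2 ^ z * 2 ^ e                      ≤⟨ *-monoˡ-≤ (2 ^ e) (*-mono-≤ (P-rankY d ω h) (P-rankZ d ω h)) ⟩
            rk b ω * rk b ω * 2 ^ e                    ∎
            where
            ρ = status fam ω
            e = count (dead all ρ)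
            y = count (isY ∘ ρ)
            z = count (isZ ∘ ρ)
            h : HasRank (restrictedP d ω) (rk b ω)
            h = rank-cong (λ a b → ≈sym (f≈P (restricted ρ a b))) (hasRank b ω)
            live≡ : count (live all ρ) ≡ y + z
            live≡ = trans (∑-cong (fins n) (λ x → pt (ρ x))) (∑-+ (fins n) (⟦_⟧ ∘ isY ∘ ρ) (⟦_⟧ ∘ isZ ∘ ρ))
              where
              pt : ∀ s → ⟦ alive s ⟧ ≡ ⟦ isY s ⟧ + ⟦ isZ s ⟧
              pt S0 = refl
              pt S1 = refl
              pt SY = refl
              pt SZ = refl

    open LowerBound public

-- From the parameters to the asymptotic statement.

exp-lower-bound : ∀ {c ℓ} (F : Field c ℓ) c₀ → 1 ≤ c₀ → (t : ∀ k → Σ (Thresholds k) λ t → Thresholds.K t ≡ (2 + k) * (2 + k) * c₀) →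
  ∀ m D → 12 * c₀ * 216 * (12 * c₀ * 216) ≤ m → 1 ≤ D → D ^ 12 ≤ m →
  ∀ {s} (C : Circuit F (numVars F m D) (suc s)) → IsMultilinearCircuit F C → productDepth F C ≡ D →
  Computes F C (P F m D) → AtLeastExpRoot 12 m (suc s)
exp-lower-bound F c₀ 1≤c₀ t m (suc d) a≤m _ D≤m {s} C ml pd comp zero    _   = s≤s z≤n
exp-lower-bound F c₀ 1≤c₀ t m (suc d) a≤m _ D≤m {s} C ml pd comp κ@(suc _) κ≤m =
  decidable-stable (2 ^ κ ≤? suc s) λ ¬bound → ¬¬-all (suc s) (λ j → Bounds.¬¬-decided F (gatePoly F C j)) λ dec →
    <⇒≱ (^-monoʳ-< 2 (s≤s (s≤s z≤n)) (n<1+n ((2 * κ + 1) * suc d)))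
      (≤-trans (Bounds.size-bound F m i₀ s k (proj₁ (t k)) (subst (λ K → 12 * K * suc k ≤ m) (sym (proj₂ (t k))) (parameters c₀ κ d m (s≤s z≤n) κ≤m D≤m a≤m)) d (Bounds.eval F (output F C))
                  (λ v → Bounds.lin-≈P F (output F C) (P F m (suc d)) (Bounds.monEv F v) comp)
                  (Bounds.circuit-class F C dec ml (suc d) zero (≤-reflexive pd)))
               (few-gates (<⇒≤ (≰⇒> ¬bound))))
  where
  1≤a : 1 ≤ 12 * c₀ * 216
  1≤a = *-mono-≤ {1} {12 * c₀} (*-mono-≤ {1} {12} (s≤s z≤n) 1≤c₀) (s≤s z≤n)
  i₀ : Fin m
  i₀ = Fin.fromℕ< {0} {m} (≤-trans (*-mono-≤ {1} {12 * c₀ * 216} 1≤a 1≤a) a≤m)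
  -- If the circuit has at most `2^κ` gates, then `2S² ≤ 2^(2κ+1)` and its Δ-th power is at most
  -- `2^((2κ+1)Δ)`; one unit more makes `2 ^ k` exceed it.
  k = suc ((2 * κ + 1) * suc d)
  few-gates : suc s ≤ 2 ^ κ → (2 * (suc s * suc s)) ^ suc d ≤ 2 ^ ((2 * κ + 1) * suc d)
  few-gates h = ≤-trans (^-monoˡ-≤ (suc d) (≤-trans (*-monoʳ-≤ 2 (*-mono-≤ h h)) (≤-reflexive (begin-equality
      2 * (2 ^ κ * 2 ^ κ)       ≡⟨ cong (2 *_) (^-distribˡ-+-* 2 κ κ) ⟨
      2 ^ suc (κ + κ)           ≡⟨ cong (2 ^_) (l κ) ⟩
      2 ^ (2 * κ + 1)           ∎)))) (≤-reflexive (^-*-assoc 2 (2 * κ + 1) (suc d)))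
    where
    open ≤-Reasoning
    l : ∀ κ → suc (κ + κ) ≡ 2 * κ + 1
    l = solve-∀

asymptotic : ∀ p c₀ → NonZero p → 2 * 66 ≡ suc p → suc p * suc p * (16 * 16 * 16) ≤ c₀ * 8 → 108 ≤ c₀ →
    ∀ {c ℓ} (F : Field c ℓ) (Δ : ℕ → ℕ) → (∀ m → 1 ≤ Δ m) → IsSubpolynomial Δ →
    ∃[ b ] (1 ≤ b × ∃[ M ] (∀ m → M ≤ m →
    ∀ {k} (C : Circuit F (numVars F m (Δ m)) (suc k)) →
    IsMultilinearCircuit F C →
    productDepth F C ≡ Δ m →
    Computes F C (P F m (Δ m)) →
    AtLeastExpRoot b m (size F C)))
asymptotic p c₀ nz 2blks big 108≤ F Δ 1≤Δ sub with sub 12 (s≤s z≤n)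
-- The exponent 12 is the one found in `parameters`; the summand `a * a` makes `m` exceed the square
-- of the constant there.
... | M , Δ≤m = 12 , s≤s z≤n , a * a + M , λ m M≤m →
  exp-lower-bound F c₀ (≤-trans (s≤s z≤n) 108≤) (λ k → thresholds p c₀ nz 2blks big 108≤ k , refl) m (Δ m) (≤-trans (m≤m+n (a * a) M) M≤m) (1≤Δ m) (Δ≤m m (≤-trans (m≤n+m M (a * a)) M≤m))
  where a = 12 * c₀ * 216

theorem4p1 : ∀ {c ℓ} (F : Field c ℓ) (Δ : ℕ → ℕ) →
    (∀ m → 1 ≤ Δ m) → IsSubpolynomial Δ →
    ∃[ b ] (1 ≤ b × ∃[ M ] (∀ m → M ≤ m →
    ∀ {k} (C : Circuit F (numVars F m (Δ m)) (ℕ.suc k)) →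
    IsMultilinearCircuit F C →
    productDepth F C ≡ Δ m →
    Computes F C (P F m (Δ m)) →
    AtLeastExpRoot b m (size F C)))
theorem4p1 = asymptotic 131 8921088 _ refl (≤ᵇ⇒≤ (132 * 132 * (16 * 16 * 16)) (8921088 * 8) tt) (≤ᵇ⇒≤ 108 8921088 tt)
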